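{- Let $G=\mathbb Z_{12}$. Then $\mathcal S(G)$ is described as follows (here $m_t$ denotes an arbitrary integer coprime to $t$, and $\mathcal P_1$ is as in the context): (a) The odd elements of $\mathcal S(G)$ coprime to $3$ are exactly all integers $m_6$ coprime to $6$. The odd elements of $\mathcal S(G)$ divisible by $3$ are exactly the integers $9m_6p$, where $p$ is a prime with $p\equiv 5\pmod{12}$, $p\equiv 7\pmod{12}$, or $p\in\mathcal P_1$, together with the integers $27m_2$. (b) The even elements of $\mathcal S(G)$ divisible by $3$ are exactly the integers $2^4\cdot 3^2m$, $m\in\mathbb Z$. The even elements of $\mathcal S(G)$ coprime to $3$ are exactly the integers $2^4m_6$; $2^5m_6p$ where $p$ is a prime with $p\equiv 5\pmod{12}$, $p\equiv 7\pmod{12}$, or $p\in\mathcal P_1$; and $2^6m_3$.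
   Context: For a finite group $G=\{g_1,\dots,g_n\}$, assign an independent variable $x_g$ to each $g\in G$; the group determinant $\mathscr D_G(x_{g_1},\dots,x_{g_n})$ is the determinant of the $n\times n$ matrix whose $(i,j)$ entry is $x_{g_ig_j^{ -1}}$. Define $\mathcal S(G)=\{\mathscr D_G(x_{g_1},\dots,x_{g_n}) : x_{g_i}\in\mathbb Z\}$. $\mathbb Z_{12}$ is the cyclic group of order $12$. $\mathcal P_1$ is the set of primes $p\equiv 1\pmod{12}$ of the form $p=(6k+2)^2+(6t+3)^2$ for some integers $k,t$. -}

module Defs where

open import Data.Nat as ℕ using (ℕ; zero; suc; NonZero)
open import Data.Nat.DivMod using (_mod_; _%_)
open import Data.Nat.Primality using (Prime)
open import Data.Nat.Coprimality using (Coprime)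
open import Data.Fin using (Fin; zero; suc; toℕ; punchIn)
open import Data.Integer as ℤ using (ℤ; +_; _+_; _*_; -_; ∣_∣)
open import Data.Integer.Divisibility using (_∣_)
open import Data.Product using (Σ; ∃; _×_)
open import Data.Sum using (_⊎_)
open import Relation.Binary.PropositionalEquality using (_≡_)
open import Relation.Nullary using (¬_)

sumFin : (n : ℕ) → (Fin n → ℤ) → ℤ
sumFin zero    f = + 0
sumFin (suc n) f = f zero + sumFin n (λ i → f (suc i))

sign : ℕ → ℤ
sign zero    = + 1
sign (suc k) = - sign k

det : (n : ℕ) → (Fin n → Fin n → ℤ) → ℤ
det zero    M = + 1
det (suc n) M =
  sumFin (suc n) (λ j → sign (toℕ j) * (M zero j * det n (λ i k → M (suc i) (punchIn j k))))

-- The cyclic group ℤ_n realised as Fin n; the element g_i g_j⁻¹ = i - j (mod n).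
subMod : (n : ℕ) .{{_ : NonZero n}} → Fin n → Fin n → Fin n
subMod n i j = ((n ℕ.+ toℕ i) ℕ.∸ toℕ j) mod n

groupDetCyclic : (n : ℕ) .{{_ : NonZero n}} → (Fin n → ℤ) → ℤ
groupDetCyclic n x = det n (λ i j → x (subMod n i j))

InS : (n : ℕ) .{{_ : NonZero n}} → ℤ → Set
InS n d = Σ (Fin n → ℤ) (λ x → groupDetCyclic n x ≡ d)

CoprimeTo : ℕ → ℤ → Set
CoprimeTo t m = Coprime ∣ m ∣ t

Odd : ℤ → Set
Odd n = ¬ (+ 2 ∣ n)

Even : ℤ → Set
Even n = + 2 ∣ n

InP1 : ℕ → Set
InP1 p = Prime p × (p % 12 ≡ 1) ×
  ∃ λ k → ∃ λ t → + p ≡ (+ 6 * k + + 2) * (+ 6 * k + + 2) + (+ 6 * t + + 3) * (+ 6 * t + + 3)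

GoodPrime : ℕ → Set
GoodPrime p = (Prime p × p % 12 ≡ 5) ⊎ (Prime p × p % 12 ≡ 7) ⊎ InP1 p

{-# OPTIONS --safe #-}
module Submission where

open import Defs
open import Algebra.Bundles using (CommutativeRing)
open import Algebra.Structures using (IsCommutativeRing)
import Algebra.Properties.CommutativeSemiring.Binomial as CommutativeBinomial
import Algebra.Properties.Semiring.Exp as SemiringExp
import Algebra.Properties.Semiring.Mult as SemiringMult
import Algebra.Properties.Semiring.Sum as SemiringSum
open import Data.Bool as Bool using (Bool; true; false; _∧_)
open import Data.Empty using (⊥; ⊥-elim)
open import Data.Fin using (Fin; zero; suc; toℕ; fromℕ; fromℕ<; inject₁; punchIn; #_)
import Data.Fin as F
import Data.Fin.Properties as F
open import Data.Integer using (ℤ; +_; _+_; _*_; -_; -[1+_])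
import Data.Integer as ℤ
open import Data.Integer.DivMod using (a≡a%n+[a/n]*n; n%d<d; a≡a%ℕn+[a/ℕn]*n; n%ℕd<d)
open import Data.Integer.Divisibility using (_∣_)
open import Data.Integer.Divisibility.Signed hiding (quotient) renaming (_∣_ to _∣ₛ_)
open import Data.Integer.Properties
open import Data.Integer.Tactic.RingSolver using (solve-∀; ring)
open import Data.List using ([]; _∷_)
open import Data.List.Relation.Unary.All using ([]; _∷_)
open import Data.Maybe using (just; nothing)
open import Data.Nat as ℕ using (ℕ; zero; suc; z≤n; s≤s; _!)
import Data.Nat.Combinatorics as ℕ using (_C_)
open import Data.Nat.Combinatorics using (k![n∸k]!∣n!; nCk≡n!/k![n-k]!; nCn≡1)
import Data.Nat.Divisibility as ℕ
open import Data.Nat.DivMod using (_mod_; _%_; _/_; m≡m%n+[m/n]*n; m/n*n≡m)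
import Data.Nat.DivMod as ℕ
open import Data.Nat.Induction using (<-wellFounded)
open import Data.Nat.ListAction using (product)
open import Data.Nat.Primality using (Prime; euclidsLemma; prime?; prime⇒irreducible; prime⇒nonTrivial; prime⇒nonZero)
open import Data.Nat.Primality.Factorisation using (factorise)
import Data.Nat.Properties as ℕ
import Data.Nat.Tactic.RingSolver as ℕ-Solver
open import Data.Product using (∃; ∃₂; _×_; _,_; proj₁; proj₂; uncurry)
open import Data.Sum as Sum using (_⊎_; inj₁; inj₂; [_,_]′)
open import Data.Vec using (Vec; []; _∷_; lookup)
open import Data.Vec.Functional using (insertAt; updateAt)
open import Data.Vec.Functional.Properties using (insertAt-lookup; insertAt-punchIn; updateAt-updates; updateAt-minimal)
open import Function using (_∘_)
open import Function.Bundles using (_⇔_; mk⇔)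
open import Induction.WellFounded using (Acc; acc)
open import Level using (0ℓ)
open import Relation.Binary.PropositionalEquality
open import Relation.Nullary using (Dec; yes; no; ¬_)
open import Relation.Nullary.Decidable using (True; toWitness; ¬?; _×-dec_; _⊎-dec_; _→-dec_)
import Tactic.RingSolver.Core.AlmostCommutativeRing as ACR
import Tactic.RingSolver.NonReflective as RingSolver
open RingSolver ring using (solve; Expr; Κ) renaming (_⊜_ to infix 4 _⊜_; _⊕_ to _⊞_; _⊗_ to _⊠_; ⊝_ to ⊟_)

-- Up to conjugacy a character of ℤ₁₂ sends a generator to 1, -1, i, ω, -ω or iω, and the group
-- determinant of F = Σ x_g g is the product a b e c c′ f of the norms of the values of F there.  Values at
-- points differing by a third (a fourth) root of unity agree modulo the prime above 3 (above 2), so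
-- that powers of 3 and 2 come together: 9 ∣ d if 3 ∣ d, and 16 ∣ d if 2 ∣ d.
--
-- The good primes come from the following obstruction.  Let α = u + iv be the relative norm of F(iω) to
-- ℤ[i]; then α ≡ F(i)² modulo 3 and c - c′ ≡ 2v modulo 4.  If no good prime divides d, then each odd
-- norm from ℤ[i] prime to 3 is the norm of an element congruent to a unit modulo 6, and each norm from
-- ℤ[ω] prime to 6 is 1 modulo 4.  When 9 exactly divides d, one of c, c′ is 3 times such a norm, which
-- forces v odd and contradicts the congruence modulo 3; when 32 exactly divides d, v is even, 3 divides
-- v, and the odd part of e would be a norm violating the first condition.
--
-- Conversely a good prime is a norm from ℤ[i], ℤ[ω] or ℤ[i, ω], and the condition p ∈ P₁ is what makes
-- its prime factor compatible with suitable values at the other points; the remaining values are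
-- changed by adding multiples of Σ g, which affects only F(1).

private
  module Binomial = CommutativeBinomial ℕ.+-*-commutativeSemiring
  module Exp = SemiringExp ℕ.+-*-semiring
  module Mult = SemiringMult ℕ.+-*-semiring
open SemiringSum ℕ.+-*-semiring using (sum; sum-init-last)

-- The determinant is defined by expansion along the first row, which is out of reach for a symbolic
-- 12 × 12 matrix. Hence the detour through uniqueness of alternating forms: it gives
-- multiplicativity of `det`, and then one integral change of basis, tested on twelve coordinate
-- vectors only, reduces the group determinant to diagonal blocks of size at most four. The other
-- obstacle is that primes must be exhibited as norms from three rings. A single descent for x² +
-- εxy + y² serves all of them: over ℤ with ε = 0 and ε = -1, and over ℤ[ω] with ε = 0, since the
-- norm from ℤ[i, ω] to ℤ[ω] is X² + Y². So division with remainder is needed in ℤ and ℤ[ω] only,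
-- never in ℤ[i, ω]. For the converse, the values at the characters can be prescribed only subject
-- to congruences at 2 and 3. This is why each representation of a prime is first moved by units and
-- conjugation into a normal form modulo 6, 12, or 2 and 1 - ω.

gauss eis : ℤ → ℤ → ℤ
gauss x y = x * x + y * y
eis x y = x * x + - (x * y) + y * y

-- The trace of (x₀ + x₁ω) times the conjugate of (y₀ + y₁ω).
tr : ℤ → ℤ → ℤ → ℤ → ℤ
tr x₀ x₁ y₀ y₁ = + 2 * (x₀ * y₀) + - (x₀ * y₁) + - (x₁ * y₀) + + 2 * (x₁ * y₁)

-- The norm from ℤ[i, ω] in the basis 1, ω, i, iω: the relative norm to ℤ[i] is re₁₂ + i tr.
re₁₂ norm₁₂ : ℤ → ℤ → ℤ → ℤ → ℤ
re₁₂ b₀ b₁ b₂ b₃ = eis b₀ b₁ + - eis b₂ b₃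
norm₁₂ b₀ b₁ b₂ b₃ = gauss (re₁₂ b₀ b₁ b₂ b₃) (tr b₀ b₁ b₂ b₃)

-- The forms in the syntax of the ring solver. Each evaluates definitionally to its namesake, so
-- identities can mention `gauss`, `eis` and `norm₁₂` by name and still close by `refl`.
module _ {n : ℕ} where
  gaussₑ eisₑ : Expr ℤ n → Expr ℤ n → Expr ℤ n
  gaussₑ x y = x ⊠ x ⊞ y ⊠ y
  eisₑ x y = x ⊠ x ⊞ ⊟ (x ⊠ y) ⊞ y ⊠ y
  trₑ re₁₂ₑ norm₁₂ₑ : Expr ℤ n → Expr ℤ n → Expr ℤ n → Expr ℤ n → Expr ℤ n
  trₑ x₀ x₁ y₀ y₁ = Κ (+ 2) ⊠ (x₀ ⊠ y₀) ⊞ ⊟ (x₀ ⊠ y₁) ⊞ ⊟ (x₁ ⊠ y₀) ⊞ Κ (+ 2) ⊠ (x₁ ⊠ y₁)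
  re₁₂ₑ b₀ b₁ b₂ b₃ = eisₑ b₀ b₁ ⊞ ⊟ eisₑ b₂ b₃
  norm₁₂ₑ b₀ b₁ b₂ b₃ = gaussₑ (re₁₂ₑ b₀ b₁ b₂ b₃) (trₑ b₀ b₁ b₂ b₃)

-- Determinants

Mat : ℕ → ℕ → Set
Mat m n = Fin m → Fin n → ℤ

infix 4 _≋_
_≋_ : ∀ {m n} → Mat m n → Mat m n → Set
M ≋ N = ∀ i j → M i j ≡ N i j

sumFin-cong : ∀ n {f g : Fin n → ℤ} → (∀ i → f i ≡ g i) → sumFin n f ≡ sumFin n g
sumFin-cong zero    e = refl
sumFin-cong (suc n) e = cong₂ _+_ (e zero) (sumFin-cong n (e ∘ suc))

sumFin-lin : ∀ n a b (f g : Fin n → ℤ) →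
  sumFin n (λ i → a * f i + b * g i) ≡ a * sumFin n f + b * sumFin n g
sumFin-lin zero a b f g = l a b
  where
  l : ∀ a b → + 0 ≡ a * + 0 + b * + 0
  l = solve-∀
sumFin-lin (suc n) a b f g =
  trans (cong (λ z → a * f zero + b * g zero + z) (sumFin-lin n a b (f ∘ suc) (g ∘ suc)))
        (l a b (f zero) (g zero) _ _)
  where
  l : ∀ a b x y u v → a * x + b * y + (a * u + b * v) ≡ a * (x + u) + b * (y + v)
  l = solve-∀

sumFin-zero : ∀ n {f : Fin n → ℤ} → (∀ i → f i ≡ + 0) → sumFin n f ≡ + 0
sumFin-zero zero    e = refl
sumFin-zero (suc n) e = cong₂ _+_ (e zero) (sumFin-zero n (e ∘ suc))

sumFin-* : ∀ n a (f : Fin n → ℤ) → sumFin n (λ i → a * f i) ≡ a * sumFin n f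
sumFin-* zero    a f = sym (*-zeroʳ a)
sumFin-* (suc n) a f =
  trans (cong (λ z → a * f zero + z) (sumFin-* n a (f ∘ suc))) (sym (*-distribˡ-+ a _ _))

sumFin-+ : ∀ n (f g : Fin n → ℤ) → sumFin n (λ i → f i + g i) ≡ sumFin n f + sumFin n g
sumFin-+ zero    f g = refl
sumFin-+ (suc n) f g = trans (cong (λ z → f zero + g zero + z) (sumFin-+ n (f ∘ suc) (g ∘ suc)))
  (l (f zero) (g zero) _ _)
  where
  l : ∀ x y u v → x + y + (u + v) ≡ x + u + (y + v)
  l = solve-∀

sumFin-swap : ∀ m n (f : Fin m → Fin n → ℤ) →
  sumFin m (λ i → sumFin n (f i)) ≡ sumFin n (λ j → sumFin m (λ i → f i j))
sumFin-swap zero    n f = sym (sumFin-zero n (λ _ → refl))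
sumFin-swap (suc m) n f =
  trans (cong (λ z → sumFin n (f zero) + z) (sumFin-swap m n (f ∘ suc))) (sym (sumFin-+ n _ _))

δ : ∀ {n} → Fin n → Fin n → ℤ
δ zero    zero    = + 1
δ zero    (suc _) = + 0
δ (suc _) zero    = + 0
δ (suc i) (suc j) = δ i j

δ-refl : ∀ {n} (i : Fin n) → δ i i ≡ + 1
δ-refl zero    = refl
δ-refl (suc i) = δ-refl i

δ-≢ : ∀ {n} {i j : Fin n} → i ≢ j → δ i j ≡ + 0
δ-≢ {i = zero}  {zero}  ne = ⊥-elim (ne refl)
δ-≢ {i = zero}  {suc j} ne = refl
δ-≢ {i = suc i} {zero}  ne = refl
δ-≢ {i = suc i} {suc j} ne = δ-≢ (ne ∘ cong suc)

δ-sym : ∀ {n} (i j : Fin n) → δ i j ≡ δ j i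
δ-sym zero    zero    = refl
δ-sym zero    (suc j) = refl
δ-sym (suc i) zero    = refl
δ-sym (suc i) (suc j) = δ-sym i j

δ-punchIn : ∀ {n} (j : Fin (suc n)) i k → δ (punchIn j i) (punchIn j k) ≡ δ i k
δ-punchIn zero    i       k       = refl
δ-punchIn (suc j) zero    zero    = refl
δ-punchIn (suc j) zero    (suc k) = refl
δ-punchIn (suc j) (suc i) zero    = refl
δ-punchIn (suc j) (suc i) (suc k) = δ-punchIn j i k

sumFin-δ : ∀ n (f : Fin n → ℤ) i → sumFin n (λ k → f k * δ i k) ≡ f i
sumFin-δ (suc n) f zero = trans (cong₂ _+_ (*-identityʳ (f zero))
  (sumFin-zero n (λ i → *-zeroʳ (f (suc i))))) (+-identityʳ _)
sumFin-δ (suc n) f (suc i) = trans (cong₂ _+_ (*-zeroʳ (f zero)) (sumFin-δ n (f ∘ suc) i)) (+-identityˡ _)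

det-cong : ∀ n {M N : Mat n n} → M ≋ N → det n M ≡ det n N
det-cong zero    e = refl
det-cong (suc n) e = sumFin-cong (suc n) λ j →
  cong (sign (toℕ j) *_) (cong₂ _*_ (e zero j) (det-cong n (λ i k → e (suc i) (punchIn j k))))

minor : ∀ {n} → Mat (suc n) (suc n) → Fin (suc n) → Mat n n
minor M j i k = M (suc i) (punchIn j k)

laplace : ∀ n → Mat (suc n) (suc n) → Fin (suc n) → ℤ
laplace n M j = sign (toℕ j) * (M zero j * det n (minor M j))

-- Phrased with three matrices agreeing off row `k` instead of row replacement, because matrices are
-- compared only pointwise.
RowLinear : ∀ {m n} → (Mat m n → ℤ) → Set
RowLinear {m} {n} f = ∀ (k : Fin m) a b (A B C : Mat m n) →
  (∀ j → C k j ≡ a * A k j + b * B k j) →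
  (∀ i → i ≢ k → ∀ j → A i j ≡ C i j) → (∀ i → i ≢ k → ∀ j → B i j ≡ C i j) →
  f C ≡ a * f A + b * f B

Vanishes : ∀ {m n} → (Mat m n → ℤ) → Set
Vanishes {m} {n} f = ∀ (i k : Fin m) → i ≢ k → (M : Mat m n) → (∀ j → M i j ≡ M k j) → f M ≡ + 0

record Alternating {m n} (f : Mat m n → ℤ) : Set where
  field
    extens   : ∀ {M N} → M ≋ N → f M ≡ f N
    linear   : RowLinear f
    vanishes : Vanishes f

det-linear : ∀ n → RowLinear (det n)
det-linear (suc n) zero a b A B C ek eA eB = trans
    (sumFin-cong (suc n) {laplace n C} {λ j → a * laplace n A j + b * laplace n B j} λ j → begin
      sign (toℕ j) * (C zero j * det n (minor C j))
        ≡⟨ cong (λ x → sign (toℕ j) * (x * det n (minor C j))) (ek j) ⟩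
      sign (toℕ j) * ((a * A zero j + b * B zero j) * det n (minor C j))
        ≡⟨ l (sign (toℕ j)) a b (A zero j) (B zero j) (det n (minor C j)) ⟩
      a * (sign (toℕ j) * (A zero j * det n (minor C j))) + b * (sign (toℕ j) * (B zero j * det n (minor C j)))
        ≡⟨ cong₂ (λ x y → a * (sign (toℕ j) * (A zero j * x)) + b * (sign (toℕ j) * (B zero j * y)))
             (det-cong n (λ i k → sym (eA (suc i) (λ ()) _)))
             (det-cong n (λ i k → sym (eB (suc i) (λ ()) _))) ⟩
      a * laplace n A j + b * laplace n B j ∎)
    (sumFin-lin (suc n) a b (laplace n A) (laplace n B))
  where
  open ≡-Reasoning
  l : ∀ s a b x y d → s * ((a * x + b * y) * d) ≡ a * (s * (x * d)) + b * (s * (y * d))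
  l = solve-∀
det-linear (suc n) (suc k) a b A B C ek eA eB = trans
    (sumFin-cong (suc n) {laplace n C} {λ j → a * laplace n A j + b * laplace n B j} λ j → begin
      sign (toℕ j) * (C zero j * det n (minor C j))
        ≡⟨ cong (λ x → sign (toℕ j) * (C zero j * x))
             (det-linear n k a b (minor A j) (minor B j) (minor C j)
               (λ l → ek (punchIn j l))
               (λ i ne l → eA (suc i) (ne ∘ F.suc-injective) _)
               (λ i ne l → eB (suc i) (ne ∘ F.suc-injective) _)) ⟩
      sign (toℕ j) * (C zero j * (a * det n (minor A j) + b * det n (minor B j)))
        ≡⟨ l (sign (toℕ j)) (C zero j) a b (det n (minor A j)) (det n (minor B j)) ⟩
      a * (sign (toℕ j) * (C zero j * det n (minor A j))) + b * (sign (toℕ j) * (C zero j * det n (minor B j)))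
        ≡⟨ cong₂ (λ x y → a * (sign (toℕ j) * (x * det n (minor A j))) + b * (sign (toℕ j) * (y * det n (minor B j))))
             (sym (eA zero (λ ()) j)) (sym (eB zero (λ ()) j)) ⟩
      a * laplace n A j + b * laplace n B j ∎)
    (sumFin-lin (suc n) a b (laplace n A) (laplace n B))
  where
  open ≡-Reasoning
  l : ∀ s c a b x y → s * (c * (a * x + b * y)) ≡ a * (s * (c * x)) + b * (s * (c * y))
  l = solve-∀

punchIn-above : ∀ {n} (j k : Fin (suc n)) → j F.≤ k → punchIn (inject₁ j) k ≡ suc k
punchIn-above zero    k       _       = refl
punchIn-above {suc n} (suc j) (suc k) (s≤s p) = cong suc (punchIn-above j k p)

punchIn-below : ∀ {n} (j k : Fin (suc n)) → j F.≤ k → punchIn (suc k) j ≡ inject₁ j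
punchIn-below zero    k       _       = refl
punchIn-below {suc n} (suc j) (suc k) (s≤s p) = cong suc (punchIn-below j k p)

-- Two columns may be removed in either order; this identifies the second minors of the paired terms
-- in the double expansion.
punchIn-punchIn : ∀ {n} (j k : Fin (suc n)) (i : Fin n) → j F.≤ k →
  punchIn (inject₁ j) (punchIn k i) ≡ punchIn (suc k) (punchIn j i)
punchIn-punchIn zero    k       i       _       = refl
punchIn-punchIn (suc j) (suc k) zero    _       = refl
punchIn-punchIn (suc j) (suc k) (suc i) (s≤s p) = cong suc (punchIn-punchIn j k i p)

-- The pairs (j , k) and (1 + k , j) with j ≤ k name the same two columns, with opposite signs.
double-sum-cancels : ∀ n (f : Fin (suc n) → Fin n → ℤ) →
  (∀ (j k : Fin n) → j F.≤ k → f (inject₁ j) k ≡ f (suc k) j) →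
  sumFin (suc n) (λ j → sign (toℕ j) * sumFin n (λ k → sign (toℕ k) * f j k)) ≡ + 0
double-sum-cancels zero    f e = refl
double-sum-cancels (suc n) f e = trans (cong₂ _+_ (*-identityˡ (S₀ + S₁)) lower) cancel
  where
  U : Fin (suc n) → ℤ
  U j = sumFin n λ k → sign (toℕ k) * f (suc j) (suc k)
  S₀ S₁ T : ℤ
  S₀ = sign 0 * f zero zero
  S₁ = sumFin n (λ k → sign (suc (toℕ k)) * f zero (suc k))
  T  = sumFin (suc n) (λ j → sign (toℕ j) * U j)
  l₁ : ∀ s x y → - s * (+ 1 * x + y) ≡ - (+ 1) * (s * x) + - s * y
  l₁ = solve-∀
  l₂ : ∀ s x → - s * x ≡ - (+ 1) * (s * x)
  l₂ = solve-∀
  l₃ : ∀ s x → - s * (- (+ 1) * x) ≡ + 1 * (s * x)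
  l₃ = solve-∀
  -- Splitting off `k = 0` from the rows `1 + j` leaves a column, which cancels row 0 by the
  -- symmetry `e zero`, and the double sum `T` of smaller size, whose two sign changes compensate.
  lower : sumFin (suc n) (λ j → sign (suc (toℕ j)) * sumFin (suc n) (λ k → sign (toℕ k) * f (suc j) k))
        ≡ - (+ 1) * sumFin (suc n) (λ j → sign (toℕ j) * f (suc j) zero) + + 1 * T
  lower = trans (sumFin-cong (suc n) {g = λ j → - (+ 1) * (sign (toℕ j) * f (suc j) zero) + + 1 * (sign (toℕ j) * U j)} λ j → trans (l₁ (sign (toℕ j)) (f (suc j) zero) (sumFin n λ k → - sign (toℕ k) * f (suc j) (suc k)))
      (cong (λ z → - (+ 1) * (sign (toℕ j) * f (suc j) zero) + z)
        (trans (cong (- sign (toℕ j) *_)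
          (trans (sumFin-cong n λ k → l₂ (sign (toℕ k)) (f (suc j) (suc k))) (sumFin-* n (- (+ 1)) λ k → sign (toℕ k) * f (suc j) (suc k))))
          (l₃ (sign (toℕ j)) (U j)))))
    (sumFin-lin (suc n) (- (+ 1)) (+ 1) (λ j → sign (toℕ j) * f (suc j) zero) (λ j → sign (toℕ j) * U j))
  T≡0 : T ≡ + 0
  T≡0 = double-sum-cancels n (λ j k → f (suc j) (suc k)) (λ j k p → e (suc j) (suc k) (s≤s p))
  l₄ : ∀ x → x + (- (+ 1) * x + + 1 * + 0) ≡ + 0
  l₄ = solve-∀
  cancel : S₀ + S₁ + (- (+ 1) * sumFin (suc n) (λ j → sign (toℕ j) * f (suc j) zero) + + 1 * T) ≡ + 0
  cancel = trans (cong₂ (λ x t → S₀ + S₁ + (- (+ 1) * x + + 1 * t))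
      (sumFin-cong (suc n) λ k → cong (sign (toℕ k) *_) (sym (e zero k z≤n))) T≡0)
    (l₄ (S₀ + S₁))

infixl 6 _[_]≔_
_[_]≔_ : ∀ {m n} → Mat m n → Fin m → (Fin n → ℤ) → Mat m n
M [ k ]≔ v = updateAt M k (λ _ → v)

swapRows : ∀ {m n} → Fin m → Fin m → Mat m n → Mat m n
swapRows i k M = (M [ i ]≔ M k) [ k ]≔ M i

module _ {m n} (M : Mat m n) (k : Fin m) (v : Fin n → ℤ) where
  set-at : ∀ j → (M [ k ]≔ v) k j ≡ v j
  set-at j = cong (λ w → w j) (updateAt-updates k M)
  set-off : ∀ i → i ≢ k → ∀ j → (M [ k ]≔ v) i j ≡ M i j
  set-off i ne j = cong (λ w → w j) (updateAt-minimal i k M ne)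

module _ {m n} {f : Mat m n → ℤ} (F : Alternating f) where
  open Alternating F

  -- Expand f at the matrix whose rows i and k both equal M i + M k.
  swap-neg : ∀ (i k : Fin m) → i ≢ k → (M : Mat m n) → f (swapRows i k M) ≡ - f M
  swap-neg i k ne M = l (f (swapRows i k M)) (f M)
      (trans (sym expand) (vanishes i k ne _ λ j → trans (at-i w w j) (sym (at-k w w j))))
    where
    w : Fin n → ℤ
    w j = M i j + M k j
    X : (Fin n → ℤ) → (Fin n → ℤ) → Mat m n
    X a b = (M [ i ]≔ a) [ k ]≔ b
    at-k : ∀ a b j → X a b k j ≡ b j
    at-k a b = set-at (M [ i ]≔ a) k b
    at-i : ∀ a b j → X a b i j ≡ a j
    at-i a b j = trans (set-off (M [ i ]≔ a) k b i ne j) (set-at M i a j)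
    off : ∀ a b l → l ≢ i → l ≢ k → ∀ j → X a b l j ≡ M l j
    off a b l li lk j = trans (set-off (M [ i ]≔ a) k b l lk j) (set-off M i a l li j)
    off-k : ∀ a b b' l → l ≢ k → ∀ j → X a b l j ≡ X a b' l j
    off-k a b b' l lk j = trans (set-off _ k b l lk j) (sym (set-off _ k b' l lk j))
    off-i : ∀ a a' b l → l ≢ i → ∀ j → X a b l j ≡ X a' b l j
    off-i a a' b l li j with l F.≟ k
    ... | yes refl = trans (at-k a b j) (sym (at-k a' b j))
    ... | no lk = trans (off a b l li lk j) (sym (off a' b l li lk j))
    one : ∀ x y → x + y ≡ + 1 * x + + 1 * y
    one = solve-∀
    lin-i : ∀ b → f (X w b) ≡ + 1 * f (X (M i) b) + + 1 * f (X (M k) b)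
    lin-i b = linear i (+ 1) (+ 1) _ _ _
      (λ j → trans (at-i w b j) (trans (one (M i j) (M k j))
        (cong₂ (λ x y → + 1 * x + + 1 * y) (sym (at-i (M i) b j)) (sym (at-i (M k) b j)))))
      (λ l li j → off-i _ _ b l li j) (λ l li j → off-i _ _ b l li j)
    lin-k : ∀ a → f (X a w) ≡ + 1 * f (X a (M i)) + + 1 * f (X a (M k))
    lin-k a = linear k (+ 1) (+ 1) _ _ _
      (λ j → trans (at-k a w j) (trans (one (M i j) (M k j))
        (cong₂ (λ x y → + 1 * x + + 1 * y) (sym (at-k a (M i) j)) (sym (at-k a (M k) j)))))
      (λ l lk j → off-k a _ _ l lk j) (λ l lk j → off-k a _ _ l lk j)
    same : X (M i) (M k) ≋ M
    same l j with l F.≟ k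
    ... | yes refl = at-k (M i) (M k) j
    ... | no lk with l F.≟ i
    ...   | yes refl = at-i (M i) (M k) j
    ...   | no li = off (M i) (M k) l li lk j
    zero-at : ∀ a → f (X a a) ≡ + 0
    zero-at a = vanishes i k ne _ λ j → trans (at-i a a j) (sym (at-k a a j))
    l₀ : ∀ x y → + 1 * (+ 1 * + 0 + + 1 * x) + + 1 * (+ 1 * y + + 1 * + 0) ≡ x + y
    l₀ = solve-∀
    expand : f (X w w) ≡ f M + f (X (M k) (M i))
    expand = trans (lin-i w) (trans (cong₂ (λ x y → + 1 * x + + 1 * y) (lin-k (M i)) (lin-k (M k)))
      (trans (cong₂ (λ x y → + 1 * (+ 1 * x + + 1 * f (X (M i) (M k))) + + 1 * (+ 1 * f (X (M k) (M i)) + + 1 * y))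
        (zero-at (M i)) (zero-at (M k)))
        (trans (l₀ (f (X (M i) (M k))) (f (X (M k) (M i)))) (cong (_+ f (X (M k) (M i))) (extens same)))))
    l : ∀ x y → y + x ≡ + 0 → x ≡ - y
    l x y e = trans (l' x y) (trans (cong (_+ - y) e) (+-identityˡ (- y)))
      where
      l' : ∀ x y → x ≡ (y + x) + - y
      l' = solve-∀

det-alternating : ∀ n → Alternating (det n)
det-vanishes : ∀ n → Vanishes (det n)
det-alternating n = record { extens = det-cong n ; linear = det-linear n ; vanishes = det-vanishes n }

-- Expanding along both rows gives a signed double sum over ordered pairs of columns, whose summand
-- is symmetric in the pair when the rows agree.
det-vanishes-01 : ∀ n (M : Mat (2 ℕ.+ n) (2 ℕ.+ n)) → (∀ j → M zero j ≡ M (suc zero) j) → det (2 ℕ.+ n) M ≡ + 0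
det-vanishes-01 n M e = trans
    (sumFin-cong (2 ℕ.+ n) {laplace (suc n) M} {λ j → sign (toℕ j) * sumFin (suc n) (λ k → sign (toℕ k) * f j k)}
      λ j → cong (sign (toℕ j) *_) (trans
        (sym (sumFin-* (suc n) (M zero j) (laplace n (minor M j))))
        (sumFin-cong (suc n) λ k → l (M zero j) (sign (toℕ k)) (M (suc zero) (punchIn j k)) (det n (minor (minor M j) k)))))
    (double-sum-cancels (suc n) f sym-f)
  where
  l : ∀ a s b d → a * (s * (b * d)) ≡ s * (a * b * d)
  l = solve-∀
  f : Fin (2 ℕ.+ n) → Fin (suc n) → ℤ
  f j k = M zero j * M (suc zero) (punchIn j k) * det n (minor (minor M j) k)
  sym-f : ∀ j k → j F.≤ k → f (inject₁ j) k ≡ f (suc k) j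
  sym-f j k p = cong₂ _*_
    (trans (*-comm (M zero (inject₁ j)) (M (suc zero) (punchIn (inject₁ j) k))) (cong₂ _*_
      (trans (sym (e (punchIn (inject₁ j) k))) (cong (M zero) (punchIn-above j k p)))
      (trans (e (inject₁ j)) (cong (M (suc zero)) (sym (punchIn-below j k p))))))
    (det-cong n λ i c → cong (M (suc (suc i))) (punchIn-punchIn j k c p))

minors-vanish : ∀ n (M : Mat (suc n) (suc n)) (i k : Fin n) → i ≢ k →
  (∀ j → M (suc i) j ≡ M (suc k) j) → det (suc n) M ≡ + 0
minors-vanish n M i k ne e = sumFin-zero (suc n) {laplace n M} λ j →
  trans (cong (λ x → sign (toℕ j) * (M zero j * x)) (det-vanishes n i k ne (minor M j) (λ l → e (punchIn j l))))
    (l (sign (toℕ j)) (M zero j))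
  where
  l : ∀ s x → s * (x * + 0) ≡ + 0
  l = solve-∀

-- The matching row is brought next to the first by a swap inside every minor, which is
-- antisymmetric by the smaller case. That case enters as an argument, so only `det-alternating` and
-- `det-vanishes` are mutually recursive.
det-vanishes-0 : ∀ n → Alternating (det n) → (M : Mat (suc n) (suc n)) (k : Fin n) → (∀ j → M zero j ≡ M (suc k) j) → det (suc n) M ≡ + 0
det-vanishes-0 (suc n) A M zero    e = det-vanishes-01 n M e
det-vanishes-0 (suc n) A M (suc k) e = begin
    det (2 ℕ.+ n) M         ≡⟨ neg-involutive (det (2 ℕ.+ n) M) ⟨
    - (- det (2 ℕ.+ n) M)   ≡⟨ cong -_ neg ⟨
    - det (2 ℕ.+ n) M'      ≡⟨ cong -_ (det-vanishes-01 n M' e) ⟩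
    + 0                     ∎
  where
  open ≡-Reasoning
  M' : Mat (2 ℕ.+ n) (2 ℕ.+ n)
  M' zero    = M zero
  M' (suc i) = swapRows zero (suc k) (M ∘ suc) i
  l' : ∀ s x y → s * (x * (- y)) ≡ - (+ 1) * (s * (x * y))
  l' = solve-∀
  perm : ∀ j → minor M' j ≋ swapRows zero (suc k) (minor M j)
  perm j zero    c = refl
  perm j (suc i) c with i F.≟ k
  ... | yes refl = trans (set-at ((M ∘ suc) [ zero ]≔ M (suc (suc k))) (suc k) (M (suc zero)) (punchIn j c))
                     (sym (set-at (minor M j [ zero ]≔ minor M j (suc k)) (suc k) (minor M j zero) c))
  ... | no ne = trans (set-off ((M ∘ suc) [ zero ]≔ M (suc (suc k))) (suc k) (M (suc zero)) (suc i) (ne ∘ F.suc-injective) (punchIn j c))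
                  (sym (set-off (minor M j [ zero ]≔ minor M j (suc k)) (suc k) (minor M j zero) (suc i) (ne ∘ F.suc-injective) c))
  neg : det (2 ℕ.+ n) M' ≡ - det (2 ℕ.+ n) M
  neg = trans (sumFin-cong (2 ℕ.+ n) {laplace (suc n) M'} {λ j → - (+ 1) * laplace (suc n) M j} λ j →
      trans (cong (λ x → sign (toℕ j) * (M zero j * x))
        (trans (det-cong (suc n) (perm j)) (swap-neg A zero (suc k) (λ ()) (minor M j))))
      (l' (sign (toℕ j)) (M zero j) (det (suc n) (minor M j))))
    (trans (sumFin-* (2 ℕ.+ n) (- (+ 1)) (laplace (suc n) M)) (-1*i≡-i (det (2 ℕ.+ n) M)))

det-vanishes (suc n) zero    zero    ne M e = ⊥-elim (ne refl)
det-vanishes (suc n) zero    (suc k) ne M e = det-vanishes-0 n (det-alternating n) M k e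
det-vanishes (suc n) (suc i) zero    ne M e = det-vanishes-0 n (det-alternating n) M i (sym ∘ e)
det-vanishes (suc n) (suc i) (suc k) ne M e = minors-vanish n M i k (ne ∘ cong suc) e

I : ∀ {n} → Mat n n
I = δ

infixr 5 _◂_
_◂_ : ∀ {m n} → (Fin n → ℤ) → Mat m n → Mat (suc m) n
(v ◂ M) zero    = v
(v ◂ M) (suc i) = M i

module _ {m n} {f : Mat (suc m) n → ℤ} (F : Alternating f) where
  open Alternating F

  expand-head : ∀ k (c : Fin k → ℤ) (v : Fin k → Fin n → ℤ) (M : Mat m n) →
    f ((λ j → sumFin k (λ l → c l * v l j)) ◂ M) ≡ sumFin k (λ l → c l * f (v l ◂ M))
  expand-head zero c v M = linear zero (+ 0) (+ 0) ((λ _ → + 0) ◂ M) ((λ _ → + 0) ◂ M) _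
    (λ j → refl) (λ { zero ne → ⊥-elim (ne refl) ; (suc i) ne j → refl }) (λ { zero ne → ⊥-elim (ne refl) ; (suc i) ne j → refl })
  expand-head (suc k) c v M = trans
    (linear zero (c zero) (+ 1) (v zero ◂ M) ((λ j → sumFin k (λ l → c (suc l) * v (suc l) j)) ◂ M) _
      (λ j → l (c zero * v zero j) (sumFin k (λ l → c (suc l) * v (suc l) j)))
      (λ { zero ne → ⊥-elim (ne refl) ; (suc i) ne j → refl }) (λ { zero ne → ⊥-elim (ne refl) ; (suc i) ne j → refl }))
    (trans (sym (l (c zero * f (v zero ◂ M)) (f ((λ j → sumFin k (λ l → c (suc l) * v (suc l) j)) ◂ M))))
      (cong (λ z → c zero * f (v zero ◂ M) + z) (expand-head k (c ∘ suc) (v ∘ suc) M)))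
    where
    l : ∀ x y → x + y ≡ x + + 1 * y
    l = solve-∀

  -- The rows are altered one at a time, `partial k` having the first `k` done. By linearity each
  -- step adds a multiple of `f` at a matrix in which `v` occurs twice.
  add-multiples : ∀ (v : Fin n → ℤ) (c : Fin m → ℤ) (M N : Mat m n) →
    (∀ i j → N i j ≡ M i j + c i * v j) → f (v ◂ N) ≡ f (v ◂ M)
  add-multiples v c M N e = trans (extens λ { zero j → refl ; (suc i) j → trans (e i j) (sym (full i j)) }) (go m ℕ.≤-refl)
    where
    partial : ℕ → Mat m n
    partial k i j with toℕ i ℕ.<? k
    ... | yes _ = M i j + c i * v j
    ... | no  _ = M i j
    full : ∀ i j → partial m i j ≡ M i j + c i * v j
    full i j with toℕ i ℕ.<? m
    ... | yes _ = refl
    ... | no ≮ = ⊥-elim (≮ (F.toℕ<n i))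
    off : ∀ k i → toℕ i ≢ k → ∀ j → partial k i j ≡ partial (suc k) i j
    off k i ne j with toℕ i ℕ.<? k | toℕ i ℕ.<? suc k
    ... | yes _ | yes _ = refl
    ... | no _  | no _  = refl
    ... | yes p | no q  = ⊥-elim (q (ℕ.m<n⇒m<1+n p))
    ... | no p  | yes q = ⊥-elim (ne (ℕ.≤-antisym (ℕ.≤-pred q) (ℕ.≮⇒≥ p)))
    at : ∀ i j → partial (suc (toℕ i)) i j ≡ M i j + c i * v j
    at i j with toℕ i ℕ.<? suc (toℕ i)
    ... | yes _ = refl
    ... | no ≮ = ⊥-elim (≮ ℕ.≤-refl)
    before : ∀ i j → partial (toℕ i) i j ≡ M i j
    before i j with toℕ i ℕ.<? toℕ i
    ... | yes p = ⊥-elim (ℕ.<-irrefl refl p)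
    ... | no _ = refl
    step : ∀ i → f (v ◂ partial (suc (toℕ i))) ≡ f (v ◂ partial (toℕ i))
    step i = trans (linear (suc i) (+ 1) (c i) (v ◂ partial (toℕ i)) (v ◂ (partial (toℕ i) [ i ]≔ v)) _
        (λ j → trans (at i j) (trans (cong (_+ c i * v j) (sym (*-identityˡ (M i j))))
          (cong₂ (λ x y → + 1 * x + c i * y) (sym (before i j)) (sym (set-at (partial (toℕ i)) i v j)))))
        (λ { zero ne j → refl ; (suc l) ne j → off (toℕ i) l (λ q → ne (cong suc (F.toℕ-injective q))) j })
        (λ { zero ne j → refl ; (suc l) ne j → trans (set-off (partial (toℕ i)) i v l (ne ∘ cong suc) j)
                                                 (off (toℕ i) l (λ q → ne (cong suc (F.toℕ-injective q))) j) }))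
      (trans (cong (λ z → + 1 * f (v ◂ partial (toℕ i)) + c i * z)
          (vanishes zero (suc i) (λ ()) (v ◂ (partial (toℕ i) [ i ]≔ v)) (λ j → sym (set-at (partial (toℕ i)) i v j))))
        (l (f (v ◂ partial (toℕ i))) (c i)))
      where
      l : ∀ x c → + 1 * x + c * + 0 ≡ x
      l = solve-∀
    go : ∀ k → k ℕ.≤ m → f (v ◂ partial k) ≡ f (v ◂ M)
    go zero p = extens λ { zero j → refl ; (suc i) j → refl }
    go (suc k) p = trans (subst (λ t → f (v ◂ partial (suc t)) ≡ f (v ◂ partial t)) (F.toℕ-fromℕ< p) (step (fromℕ< p)))
      (go k (ℕ.<⇒≤ p))

module _ {m n : ℕ} where
  embed : Fin (suc n) → Mat m n → Mat m (suc n)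
  embed j N i = insertAt (N i) j (+ 0)

  embed-at : ∀ j (N : Mat m n) i → embed j N i j ≡ + 0
  embed-at j N i = insertAt-lookup (N i) j (+ 0)

  embed-punchIn : ∀ j (N : Mat m n) i k → embed j N i (punchIn j k) ≡ N i k
  embed-punchIn j N i k = insertAt-punchIn (N i) j (+ 0) k

columnwise : ∀ {n} (j : Fin (suc n)) {P : Fin (suc n) → Set} → P j → (∀ k → P (punchIn j k)) → ∀ l → P l
columnwise j {P} pj pk l with j F.≟ l
... | yes refl = pj
... | no ne = subst P (F.punchIn-punchOut ne) (pk (F.punchOut ne))

-- Fixing the first row at a unit vector and inserting a zero column lowers the size by one; this is
-- the induction step of `alternating-unique`.
cofactor-alternating : ∀ {m n} {f : Mat (suc m) (suc n) → ℤ} → Alternating f →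
  ∀ j → Alternating (λ (N : Mat m n) → f (δ j ◂ embed j N))
cofactor-alternating {m} {n} {f} F j = record
  { extens = λ {M} {N} e → extens λ { zero l → refl ; (suc i) → columnwise j
      (trans (embed-at j M i) (sym (embed-at j N i)))
      (λ k → trans (embed-punchIn j M i k) (trans (e i k) (sym (embed-punchIn j N i k)))) }
  ; linear = λ k a b A B C ek eA eB → linear (suc k) a b _ _ _
      (columnwise j
        (trans (embed-at j C k) (trans (l a b)
          (cong₂ (λ x y → a * x + b * y) (sym (embed-at j A k)) (sym (embed-at j B k)))))
        (λ c → trans (embed-punchIn j C k c) (trans (ek c)
          (cong₂ (λ x y → a * x + b * y) (sym (embed-punchIn j A k c)) (sym (embed-punchIn j B k c))))))
      (λ { zero ne c → refl ; (suc i) ne → row A C i (eA i (ne ∘ cong suc)) })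
      (λ { zero ne c → refl ; (suc i) ne → row B C i (eB i (ne ∘ cong suc)) })
  ; vanishes = λ i k ne M e → vanishes (suc i) (suc k) (ne ∘ F.suc-injective) _
      (columnwise j (trans (embed-at j M i) (sym (embed-at j M k)))
        (λ c → trans (embed-punchIn j M i c) (trans (e c) (sym (embed-punchIn j M k c)))))
  }
  where
  open Alternating F
  l : ∀ a b → + 0 ≡ a * + 0 + b * + 0
  l = solve-∀
  row : ∀ (A C : Mat m n) i → (∀ c → A i c ≡ C i c) → ∀ c → embed j A i c ≡ embed j C i c
  row A C i e = columnwise j (trans (embed-at j A i) (sym (embed-at j C i)))
    (λ c → trans (embed-punchIn j A i c) (trans (e c) (sym (embed-punchIn j C i c))))

module _ {n} {f : Mat (suc n) (suc n) → ℤ} (F : Alternating f) where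
  open Alternating F

  -- The unit first row is subtracted from each row `i` with the factor `M i j`, which changes
  -- column `j` alone.
  clear-column : ∀ (M : Mat n (suc n)) j →
    f (δ j ◂ M) ≡ f (δ j ◂ embed j (λ i k → M i (punchIn j k)))
  clear-column M j = sym (add-multiples F (δ j) (λ i → - M i j) M _ λ i → columnwise j
    (trans (embed-at j (λ i k → M i (punchIn j k)) i) (trans (l (M i j)) (cong (λ x → M i j + - M i j * x) (sym (δ-refl j)))))
    (λ k → trans (embed-punchIn j (λ i k → M i (punchIn j k)) i k) (trans (l' (M i (punchIn j k)) (- M i j))
      (cong (λ x → M i (punchIn j k) + - M i j * x) (sym (δ-≢ (F.punchInᵢ≢i j k ∘ sym)))))))
    where
    l : ∀ x → + 0 ≡ x + - x * + 1
    l = solve-∀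
    l' : ∀ x y → x ≡ x + y * + 0
    l' = solve-∀

  -- Passing from j to j + 1 interchanges the rows 0 and j + 1.
  cycled-identity : ∀ k (j : Fin (suc n)) → toℕ j ≡ k → f (δ j ◂ (λ i → δ (punchIn j i))) ≡ sign k * f I
  cycled-identity zero zero refl = trans (extens λ { zero l → refl ; (suc i) l → refl }) (sym (*-identityˡ (f I)))
  cycled-identity (suc k) (suc j) q = trans (extens rows) (trans
      (swap-neg F zero (suc j) (λ ()) (δ (inject₁ j) ◂ (λ i → δ (punchIn (inject₁ j) i))))
      (trans (cong -_ (cycled-identity k (inject₁ j) (trans (F.toℕ-inject₁ j) (ℕ.suc-injective q))))
        (neg-distribˡ-* (sign k) (f I))))
    where
    B : Mat (suc n) (suc n)
    B = δ (inject₁ j) ◂ (λ i → δ (punchIn (inject₁ j) i))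
    at-j : ∀ {n} (j : Fin n) → punchIn (inject₁ j) j ≡ suc j
    at-j zero    = refl
    at-j (suc j) = cong suc (at-j j)
    at-j′ : ∀ {n} (j : Fin n) → punchIn (suc j) j ≡ inject₁ j
    at-j′ zero    = refl
    at-j′ (suc j) = cong suc (at-j′ j)
    off-j : ∀ {n} (i j : Fin n) → i ≢ j → punchIn (suc j) i ≡ punchIn (inject₁ j) i
    off-j zero    zero    ne = ⊥-elim (ne refl)
    off-j zero    (suc j) ne = refl
    off-j (suc i) zero    ne = refl
    off-j (suc i) (suc j) ne = cong suc (off-j i j (ne ∘ cong suc))
    rows : (δ (suc j) ◂ (λ i → δ (punchIn (suc j) i))) ≋ swapRows zero (suc j) B
    rows zero    l = cong (λ t → δ t l) (sym (at-j j))
    rows (suc i) l with i F.≟ j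
    ... | yes refl = trans (cong (λ t → δ t l) (at-j′ i)) (sym (set-at (B [ zero ]≔ B (suc i)) (suc i) (B zero) l))
    ... | no ne = trans (cong (λ t → δ t l) (off-j i j ne))
                    (sym (set-off (B [ zero ]≔ B (suc j)) (suc j) (B zero) (suc i) (ne ∘ F.suc-injective) l))

-- Multiplicativity of `det` is the case of `M ↦ det n (M ⊗ B)`. The first row is expanded in unit
-- vectors; each cofactor is again alternating, hence by induction a multiple of the minor, and
-- `cycled-identity` supplies the sign.
alternating-unique : ∀ n {f : Mat n n → ℤ} → Alternating f → ∀ M → f M ≡ f I * det n M
alternating-unique zero    {f} F M = trans (Alternating.extens F (λ ())) (sym (*-identityʳ (f I)))
alternating-unique (suc n) {f} F M = begin
    f M
      ≡⟨ extens (λ { zero j → trans (sym (sumFin-δ (suc n) (M zero) j)) (sumFin-cong (suc n) λ k → cong (M zero k *_) (δ-sym j k)) ; (suc i) j → refl }) ⟩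
    f ((λ j → sumFin (suc n) (λ k → M zero k * δ k j)) ◂ (λ i → M (suc i)))
      ≡⟨ expand-head F (suc n) (M zero) δ (λ i → M (suc i)) ⟩
    sumFin (suc n) (λ j → M zero j * f (δ j ◂ (λ i → M (suc i))))
      ≡⟨ sumFin-cong (suc n) {g = λ j → f I * laplace n M j} term ⟩
    sumFin (suc n) (λ j → f I * laplace n M j)
      ≡⟨ sumFin-* (suc n) (f I) (laplace n M) ⟩
    f I * det (suc n) M ∎
  where
  open ≡-Reasoning
  open Alternating F
  l : ∀ m s x d → m * (s * x * d) ≡ x * (s * (m * d))
  l = solve-∀
  embed-I : ∀ j → (δ j ◂ embed j I) ≋ (δ j ◂ (λ i → δ (punchIn j i)))
  embed-I j zero    = λ _ → refl
  embed-I j (suc i) = columnwise j (trans (embed-at j I i) (sym (δ-≢ (F.punchInᵢ≢i j i))))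
    (λ k → trans (embed-punchIn j I i k) (sym (δ-punchIn j i k)))
  term : ∀ j → M zero j * f (δ j ◂ (λ i → M (suc i))) ≡ f I * laplace n M j
  term j = begin
    M zero j * f (δ j ◂ (λ i → M (suc i)))
      ≡⟨ cong (M zero j *_) (clear-column F (λ i → M (suc i)) j) ⟩
    M zero j * f (δ j ◂ embed j (minor M j))
      ≡⟨ cong (M zero j *_) (alternating-unique n (cofactor-alternating F j) (minor M j)) ⟩
    M zero j * (f (δ j ◂ embed j I) * det n (minor M j))
      ≡⟨ cong (λ x → M zero j * (x * det n (minor M j))) (trans (extens (embed-I j)) (cycled-identity F (toℕ j) j refl)) ⟩
    M zero j * (sign (toℕ j) * f I * det n (minor M j))
      ≡⟨ l (M zero j) (sign (toℕ j)) (f I) (det n (minor M j)) ⟩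
    f I * laplace n M j ∎

infixl 7 _⊗_
_⊗_ : ∀ {l m n} → Mat l m → Mat m n → Mat l n
_⊗_ {m = m} A B i k = sumFin m (λ j → A i j * B j k)

det-⊗ : ∀ n (A B : Mat n n) → det n (A ⊗ B) ≡ det n A * det n B
det-⊗ n A B = trans (alternating-unique n F A)
    (trans (cong (_* det n A) (det-cong n I-⊗)) (*-comm (det n B) (det n A)))
  where
  open Alternating (det-alternating n)
  I-⊗ : (I ⊗ B) ≋ B
  I-⊗ i k = trans (sumFin-cong n λ j → *-comm (δ i j) (B j k)) (sumFin-δ n (λ j → B j k) i)
  l : ∀ a x b y z → (a * x + b * y) * z ≡ a * (x * z) + b * (y * z)
  l = solve-∀
  F : Alternating (λ M → det n (M ⊗ B))
  F = record
    { extens = λ e → extens λ i k → sumFin-cong n λ j → cong (_* B j k) (e i j)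
    ; linear = λ k a b M N P ek eM eN → linear k a b _ _ _
        (λ c → trans (sumFin-cong n λ j → trans (cong (_* B j c) (ek j)) (l a (M k j) b (N k j) (B j c)))
          (sumFin-lin n a b (λ j → M k j * B j c) (λ j → N k j * B j c)))
        (λ i ne c → sumFin-cong n λ j → cong (_* B j c) (eM i ne j))
        (λ i ne c → sumFin-cong n λ j → cong (_* B j c) (eN i ne j))
    ; vanishes = λ i k ne M e → vanishes i k ne _ λ c → sumFin-cong n λ j → cong (_* B j c) (e j)
    }

tail₁ : ∀ {n} → Mat (suc n) (suc n) → Mat n n
tail₁ M i j = M (suc i) (suc j)

tail₂ : ∀ {n} → Mat (suc (suc n)) (suc (suc n)) → Mat n n
tail₂ M i j = M (suc (suc i)) (suc (suc j))

det-head₁ : ∀ n (M : Mat (suc n) (suc n)) → (∀ j → M zero (suc j) ≡ + 0) →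
  det (suc n) M ≡ M zero zero * det n (tail₁ M)
det-head₁ n M e = trans
  (cong (λ z → + 1 * (M zero zero * R) + z) (sumFin-zero n {λ j → laplace n M (suc j)} λ j →
    trans (cong (λ x → sign (toℕ (suc j)) * (x * det n (minor M (suc j)))) (e j)) (l₀ (sign (toℕ (suc j))) (det n (minor M (suc j))))))
  (l (M zero zero * R))
  where
  R : ℤ
  R = det n (tail₁ M)
  l₀ : ∀ s d → s * (+ 0 * d) ≡ + 0
  l₀ = solve-∀
  l : ∀ x → + 1 * x + + 0 ≡ x
  l = solve-∀

det-head₂ : ∀ n (M : Mat (2 ℕ.+ n) (2 ℕ.+ n)) →
  (∀ j → M zero (suc (suc j)) ≡ + 0) → (∀ j → M (suc zero) (suc (suc j)) ≡ + 0) →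
  det (2 ℕ.+ n) M ≡ (M zero zero * M (suc zero) (suc zero) + - (M zero (suc zero) * M (suc zero) zero))
                    * det n (tail₂ M)
det-head₂ n M e₀ e₁ = trans
  (cong₂ (λ x z → + 1 * (M zero zero * det (suc n) (minor M zero)) + (- (+ 1) * (M zero (suc zero) * x) + z))
    (det-head₁ n (minor M (suc zero)) e₁)
    (sumFin-zero n {λ j → laplace (suc n) M (suc (suc j))} λ j →
      trans (cong (λ x → sign (toℕ (suc (suc j))) * (x * det (suc n) (minor M (suc (suc j))))) (e₀ j)) (l₀ (sign (toℕ (suc (suc j)))) (det (suc n) (minor M (suc (suc j)))))))
  (trans (cong (λ x → + 1 * (M zero zero * x) + (- (+ 1) * (M zero (suc zero) * (M (suc zero) zero * R)) + + 0)) (det-head₁ n (minor M zero) e₁))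
    (l (M zero zero) (M (suc zero) (suc zero)) (M zero (suc zero)) (M (suc zero) zero) R))
  where
  R : ℤ
  R = det n (tail₂ M)
  l₀ : ∀ s d → s * (+ 0 * d) ≡ + 0
  l₀ = solve-∀
  l : ∀ a d b c r → + 1 * (a * (d * r)) + (- (+ 1) * (b * (c * r)) + + 0) ≡ (a * d + - (b * c)) * r
  l = solve-∀

scalar : ∀ {n} → ℤ → Mat n n
scalar c i j = c * δ i j

det-scalar : ∀ n c → det n (scalar c) ≡ c ℤ.^ n
det-scalar zero    c = refl
det-scalar (suc n) c = trans (det-head₁ n (scalar c) (λ j → *-zeroʳ c))
  (cong₂ _*_ (*-identityʳ c) (det-scalar n c))

-- Linear forms as syntax, and matrices depending linearly on parameters

data Lin (n : ℕ) : Set where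
  O    : Lin n
  var  : Fin n → Lin n
  ⊝_   : Lin n → Lin n
  _·_  : ℤ → Lin n → Lin n
  _⊕_  : Lin n → Lin n → Lin n
infixl 6 _⊕_
infix 7 ⊝_ _·_

eval : ∀ {n} → Lin n → (Fin n → ℤ) → ℤ
eval O       w = + 0
eval (var l) w = w l
eval (⊝ e)   w = - eval e w
eval (c · e) w = c * eval e w
eval (e ⊕ f) w = eval e w + eval f w

-- A linear form is known from its values at unit vectors. Identities between the forms below are
-- therefore decided by computing with finitely many integers.
eval-linear : ∀ {n} (e : Lin n) w → eval e w ≡ sumFin n (λ m → w m * eval e (δ m))
eval-linear {n} O       w = sym (sumFin-zero n λ m → *-zeroʳ (w m))
eval-linear {n} (var l) w = sym (trans (sumFin-cong n λ m → cong (w m *_) (δ-sym m l)) (sumFin-δ n w l))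
eval-linear {n} (⊝ e)   w = trans (cong -_ (eval-linear e w)) (trans (sym (-1*i≡-i _))
  (trans (sym (sumFin-* n (- (+ 1)) (λ m → w m * eval e (δ m)))) (sumFin-cong n λ m → l (w m) (eval e (δ m)))))
  where
  l : ∀ x y → - (+ 1) * (x * y) ≡ x * - y
  l = solve-∀
eval-linear {n} (c · e) w = trans (cong (c *_) (eval-linear e w))
  (trans (sym (sumFin-* n c (λ m → w m * eval e (δ m)))) (sumFin-cong n λ m → l c (w m) (eval e (δ m))))
  where
  l : ∀ c x y → c * (x * y) ≡ x * (c * y)
  l = solve-∀
eval-linear {n} (e ⊕ f) w = trans (cong₂ _+_ (eval-linear e w) (eval-linear f w))
  (trans (sym (sumFin-+ n (λ m → w m * eval e (δ m)) (λ m → w m * eval f (δ m)))) (sumFin-cong n λ m → sym (*-distribˡ-+ (w m) (eval e (δ m)) (eval f (δ m)))))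

eval-∘ : ∀ {k n} (e : Lin k) (W : Fin k → Lin n) w →
  eval e (λ l → eval (W l) w) ≡ sumFin n (λ m → w m * eval e (λ l → eval (W l) (δ m)))
eval-∘ {k} {n} e W w = trans (sym (subst-eval e)) (trans (eval-linear (subs e) w) (sumFin-cong n λ m → cong (w m *_) (subst-eval e)))
  where
  subs : Lin k → Lin n
  subs O       = O
  subs (var l) = W l
  subs (⊝ e)   = ⊝ subs e
  subs (c · e) = c · subs e
  subs (e ⊕ f) = subs e ⊕ subs f
  subst-eval : ∀ (e : Lin k) {w} → eval (subs e) w ≡ eval e (λ l → eval (W l) w)
  subst-eval O       = refl
  subst-eval (var l) = refl
  subst-eval (⊝ e)   = cong -_ (subst-eval e)
  subst-eval (c · e) = cong (c *_) (subst-eval e)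
  subst-eval (e ⊕ f) = cong₂ _+_ (subst-eval e) (subst-eval f)

module _ {k n} (A : Fin k → Mat n n) (B : Fin k → Mat n n) (P : Mat n n) (AP≋PB : ∀ m → (A m ⊗ P) ≋ (P ⊗ B m)) where
  -- Both sides are linear in `w`, so it is enough that `P` intertwines the generators.
  intertwine : ∀ (w : Fin k → ℤ) →
    ((λ i j → sumFin k (λ m → w m * A m i j)) ⊗ P) ≋ (P ⊗ (λ i j → sumFin k (λ m → w m * B m i j)))
  intertwine w i j = begin
      sumFin n (λ l → sumFin k (λ m → w m * A m i l) * P l j)
        ≡⟨ sumFin-cong n (λ l → trans (*-comm (sumFin k λ m → w m * A m i l) (P l j)) (trans (sym (sumFin-* k (P l j) (λ m → w m * A m i l)))
             (sumFin-cong k λ m → l₁ (P l j) (w m) (A m i l)))) ⟩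
      sumFin n (λ l → sumFin k (λ m → w m * (A m i l * P l j)))
        ≡⟨ sumFin-swap n k (λ l m → w m * (A m i l * P l j)) ⟩
      sumFin k (λ m → sumFin n (λ l → w m * (A m i l * P l j)))
        ≡⟨ sumFin-cong k (λ m → trans (sumFin-* n (w m) (λ l → A m i l * P l j)) (trans (cong (w m *_) (AP≋PB m i j))
             (sym (sumFin-* n (w m) (λ l → P i l * B m l j))))) ⟩
      sumFin k (λ m → sumFin n (λ l → w m * (P i l * B m l j)))
        ≡⟨ sumFin-swap k n (λ m l → w m * (P i l * B m l j)) ⟩
      sumFin n (λ l → sumFin k (λ m → w m * (P i l * B m l j)))
        ≡⟨ sumFin-cong n (λ l → trans (sumFin-cong k λ m → l₂ (w m) (P i l) (B m l j)) (sumFin-* k (P i l) (λ m → w m * B m l j))) ⟩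
      sumFin n (λ l → P i l * sumFin k (λ m → w m * B m l j)) ∎
    where
    open ≡-Reasoning
    l₁ : ∀ p w a → p * (w * a) ≡ w * (a * p)
    l₁ = solve-∀
    l₂ : ∀ w p b → w * (p * b) ≡ p * (w * b)
    l₂ = solve-∀

-- The matrix `Q` is `c` times an inverse of `P`. It certifies that `det n P` is nonzero without
-- rational numbers, and this factor is then cancelled.
det-intertwine : ∀ n (A B P Q : Mat n n) c .{{_ : ℤ.NonZero c}} →
  (Q ⊗ P) ≋ scalar c → (A ⊗ P) ≋ (P ⊗ B) → det n A ≡ det n B
det-intertwine n A B P Q c QP AP = *-cancelʳ-≡ (det n A) (det n B) (det n P) {{ℤ.≢-nonZero detP≢0}} (begin
    det n A * det n P ≡⟨ det-⊗ n A P ⟨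
    det n (A ⊗ P)     ≡⟨ det-cong n AP ⟩
    det n (P ⊗ B)     ≡⟨ det-⊗ n P B ⟩
    det n P * det n B ≡⟨ *-comm (det n P) (det n B) ⟩
    det n B * det n P ∎)
  where
  open ≡-Reasoning
  power≢0 : ∀ n → c ℤ.^ n ≢ + 0
  power≢0 zero ()
  power≢0 (suc n) e = power≢0 n (*-cancelˡ-≡ c _ _ (trans e (sym (*-zeroʳ c))))
  detP≢0 : det n P ≢ + 0
  detP≢0 e = power≢0 n (begin
    c ℤ.^ n           ≡⟨ det-scalar n c ⟨
    det n (scalar c)  ≡⟨ det-cong n QP ⟨
    det n (Q ⊗ P)     ≡⟨ det-⊗ n Q P ⟩
    det n Q * det n P ≡⟨ cong (det n Q *_) e ⟩
    det n Q * + 0     ≡⟨ *-zeroʳ (det n Q) ⟩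
    + 0 ∎)

Lin₁₂ : Set
Lin₁₂ = Lin 12

-- Multiplication by (a , b , r + si , A , C , β) on ℤ × ℤ × ℤ[i] × ℤ[ω] × ℤ[ω] × ℤ[i, ω].
blocks : Vec (Vec Lin₁₂ 12) 12
blocks =
  (a ∷ O ∷ O ∷ O ∷ O ∷ O ∷ O ∷ O ∷ O ∷ O ∷ O ∷ O ∷ [])
  ∷ (O ∷ b ∷ O ∷ O ∷ O ∷ O ∷ O ∷ O ∷ O ∷ O ∷ O ∷ O ∷ [])
  ∷ (O ∷ O ∷ r ∷ ⊝ s ∷ O ∷ O ∷ O ∷ O ∷ O ∷ O ∷ O ∷ O ∷ [])
  ∷ (O ∷ O ∷ s ∷ r ∷ O ∷ O ∷ O ∷ O ∷ O ∷ O ∷ O ∷ O ∷ [])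
  ∷ (O ∷ O ∷ O ∷ O ∷ A₀ ∷ ⊝ A₁ ∷ O ∷ O ∷ O ∷ O ∷ O ∷ O ∷ [])
  ∷ (O ∷ O ∷ O ∷ O ∷ A₁ ∷ A₀ ⊕ ⊝ A₁ ∷ O ∷ O ∷ O ∷ O ∷ O ∷ O ∷ [])
  ∷ (O ∷ O ∷ O ∷ O ∷ O ∷ O ∷ C₀ ∷ ⊝ C₁ ∷ O ∷ O ∷ O ∷ O ∷ [])
  ∷ (O ∷ O ∷ O ∷ O ∷ O ∷ O ∷ C₁ ∷ C₀ ⊕ ⊝ C₁ ∷ O ∷ O ∷ O ∷ O ∷ [])
  ∷ (O ∷ O ∷ O ∷ O ∷ O ∷ O ∷ O ∷ O ∷ β₀ ∷ ⊝ β₁ ∷ ⊝ β₂ ∷ ⊝ (⊝ β₃) ∷ [])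
  ∷ (O ∷ O ∷ O ∷ O ∷ O ∷ O ∷ O ∷ O ∷ β₁ ∷ β₀ ⊕ ⊝ β₁ ∷ ⊝ β₃ ∷ ⊝ (β₂ ⊕ ⊝ β₃) ∷ [])
  ∷ (O ∷ O ∷ O ∷ O ∷ O ∷ O ∷ O ∷ O ∷ β₂ ∷ ⊝ β₃ ∷ β₀ ∷ ⊝ β₁ ∷ [])
  ∷ (O ∷ O ∷ O ∷ O ∷ O ∷ O ∷ O ∷ O ∷ β₃ ∷ β₂ ⊕ ⊝ β₃ ∷ β₁ ∷ β₀ ⊕ ⊝ β₁ ∷ [])
  ∷ []
  where
  a b r s A₀ A₁ C₀ C₁ β₀ β₁ β₂ β₃ : Lin₁₂
  a = var (# 0) ; b = var (# 1) ; r = var (# 2) ; s = var (# 3)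
  A₀ = var (# 4) ; A₁ = var (# 5) ; C₀ = var (# 6) ; C₁ = var (# 7)
  β₀ = var (# 8) ; β₁ = var (# 9) ; β₂ = var (# 10) ; β₃ = var (# 11)

blockMat : (Fin 12 → ℤ) → Mat 12 12
blockMat w i j = eval (lookup (lookup blocks i) j) w

offset : ∀ {n} k → Fin (n ℕ.∸ k) → Fin n
offset         zero    i = i
offset {suc n} (suc k) i = suc (offset k i)

isO : ∀ {k} → Lin k → Bool
isO O = true
isO _ = false

allO : ∀ {k} n → (Fin n → Lin k) → Bool
allO zero    f = true
allO (suc n) f = isO (f zero) ∧ allO n (f ∘ suc)

-- Zero entries are recognised by a boolean test on the syntax, so the block pattern is verified by
-- computation while `w` stays unknown.
eval-O : ∀ {k} n (f : Fin n → Lin k) → Bool.T (allO n f) → ∀ w j → eval (f j) w ≡ + 0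
eval-O (suc n) f p w zero with f zero
... | O = refl
eval-O (suc n) f p w (suc j) with f zero
... | O = eval-O n (f ∘ suc) p w j

d₂ : ℤ → ℤ → ℤ → ℤ → ℤ
d₂ a b c d = a * d + - (b * c)

d₃ : ℤ → ℤ → ℤ → ℤ → ℤ → ℤ → ℤ → ℤ → ℤ → ℤ
d₃ a b c a′ b′ c′ a″ b″ c″ = a * d₂ b′ c′ b″ c″ + - (b * d₂ a′ c′ a″ c″) + c * d₂ a′ b′ a″ b″

d₄ : ℤ → ℤ → ℤ → ℤ → ℤ → ℤ → ℤ → ℤ → ℤ → ℤ → ℤ → ℤ → ℤ → ℤ → ℤ → ℤ → ℤ
d₄ a b c d a′ b′ c′ d′ a″ b″ c″ d″ a‴ b‴ c‴ d‴ =
  a * d₃ b′ c′ d′ b″ c″ d″ b‴ c‴ d‴ + - (b * d₃ a′ c′ d′ a″ c″ d″ a‴ c‴ d‴)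
  + c * d₃ a′ b′ d′ a″ b″ d″ a‴ b‴ d‴ + - (d * d₃ a′ b′ c′ a″ b″ c″ a‴ b‴ c‴)

module _ {k : ℕ} where
  d₂ₑ : Expr ℤ k → Expr ℤ k → Expr ℤ k → Expr ℤ k → Expr ℤ k
  d₂ₑ a b c d = a ⊠ d ⊞ ⊟ (b ⊠ c)
  d₃ₑ : Expr ℤ k → Expr ℤ k → Expr ℤ k → Expr ℤ k → Expr ℤ k → Expr ℤ k → Expr ℤ k → Expr ℤ k → Expr ℤ k → Expr ℤ k
  d₃ₑ a b c a′ b′ c′ a″ b″ c″ = a ⊠ d₂ₑ b′ c′ b″ c″ ⊞ ⊟ (b ⊠ d₂ₑ a′ c′ a″ c″) ⊞ c ⊠ d₂ₑ a′ b′ a″ b″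
  d₄ₑ : Expr ℤ k → Expr ℤ k → Expr ℤ k → Expr ℤ k → Expr ℤ k → Expr ℤ k → Expr ℤ k → Expr ℤ k → Expr ℤ k → Expr ℤ k → Expr ℤ k → Expr ℤ k → Expr ℤ k → Expr ℤ k → Expr ℤ k → Expr ℤ k → Expr ℤ k
  d₄ₑ a b c d a′ b′ c′ d′ a″ b″ c″ d″ a‴ b‴ c‴ d‴ =
    a ⊠ d₃ₑ b′ c′ d′ b″ c″ d″ b‴ c‴ d‴ ⊞ ⊟ (b ⊠ d₃ₑ a′ c′ d′ a″ c″ d″ a‴ c‴ d‴)
    ⊞ c ⊠ d₃ₑ a′ b′ d′ a″ b″ d″ a‴ b‴ d‴ ⊞ ⊟ (d ⊠ d₃ₑ a′ b′ c′ a″ b″ c″ a‴ b‴ c‴)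

det-2 : ∀ M → det 2 M ≡ d₂ (M (# 0) (# 0)) (M (# 0) (# 1)) (M (# 1) (# 0)) (M (# 1) (# 1))
det-2 M = trans (det-head₂ 0 M (λ ()) (λ ())) (*-identityʳ (d₂ (M (# 0) (# 0)) (M (# 0) (# 1)) (M (# 1) (# 0)) (M (# 1) (# 1))))

det-3 : ∀ M → det 3 M ≡ d₃ (M (# 0) (# 0)) (M (# 0) (# 1)) (M (# 0) (# 2)) (M (# 1) (# 0)) (M (# 1) (# 1)) (M (# 1) (# 2))
  (M (# 2) (# 0)) (M (# 2) (# 1)) (M (# 2) (# 2))
det-3 M = trans (signs (M (# 0) (# 0) * det 2 (minor M (# 0))) (M (# 0) (# 1) * det 2 (minor M (# 1))) (M (# 0) (# 2) * det 2 (minor M (# 2))))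
  (cong₂ _+_ (cong₂ (λ x y → M (# 0) (# 0) * x + - (M (# 0) (# 1) * y)) (det-2 (minor M (# 0))) (det-2 (minor M (# 1))))
    (cong (M (# 0) (# 2) *_) (det-2 (minor M (# 2)))))
  where
  signs : ∀ x y z → + 1 * x + (- (+ 1) * y + (- - (+ 1) * z + + 0)) ≡ x + - y + z
  signs = solve-∀

det-4 : ∀ M → det 4 M ≡ d₄ (M (# 0) (# 0)) (M (# 0) (# 1)) (M (# 0) (# 2)) (M (# 0) (# 3))
  (M (# 1) (# 0)) (M (# 1) (# 1)) (M (# 1) (# 2)) (M (# 1) (# 3)) (M (# 2) (# 0)) (M (# 2) (# 1)) (M (# 2) (# 2)) (M (# 2) (# 3))
  (M (# 3) (# 0)) (M (# 3) (# 1)) (M (# 3) (# 2)) (M (# 3) (# 3))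
det-4 M = trans (signs (M (# 0) (# 0) * det 3 (minor M (# 0))) (M (# 0) (# 1) * det 3 (minor M (# 1))) (M (# 0) (# 2) * det 3 (minor M (# 2))) (M (# 0) (# 3) * det 3 (minor M (# 3))))
  (cong₂ _+_ (cong₂ _+_ (cong₂ (λ x y → M (# 0) (# 0) * x + - (M (# 0) (# 1) * y)) (det-3 (minor M (# 0))) (det-3 (minor M (# 1))))
    (cong (M (# 0) (# 2) *_) (det-3 (minor M (# 2))))) (cong (λ x → - (M (# 0) (# 3) * x)) (det-3 (minor M (# 3)))))
  where
  signs : ∀ x y z w → + 1 * x + (- (+ 1) * y + (- - (+ 1) * z + (- - - (+ 1) * w + + 0))) ≡ x + - y + z + - w
  signs = solve-∀

det-blockMat : ∀ w → det 12 (blockMat w) ≡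
  w (# 0) * (w (# 1) * (gauss (w (# 2)) (w (# 3)) * (eis (w (# 4)) (w (# 5)) * (eis (w (# 6)) (w (# 7))
    * norm₁₂ (w (# 8)) (w (# 9)) (w (# 10)) (w (# 11))))))
det-blockMat w = begin
    det 12 (blockMat w) ≡⟨ det-head₁ 11 (blockMat w) (zeros (# 0) 1) ⟩
    w (# 0) * det 11 (tail₁ (blockMat w))
      ≡⟨ cong (w (# 0) *_) (trans (det-cong 11 {tail₁ (blockMat w)} {corner 1} (λ i j → refl)) (det-head₁ 10 (corner 1) (zeros (# 1) 2))) ⟩
    w (# 0) * (w (# 1) * det 10 (tail₁ (corner 1)))
      ≡⟨ cong (λ x → w (# 0) * (w (# 1) * x)) rest ⟩
    w (# 0) * (w (# 1) * (gauss (w (# 2)) (w (# 3)) * (eis (w (# 4)) (w (# 5)) * (eis (w (# 6)) (w (# 7))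
      * norm₁₂ (w (# 8)) (w (# 9)) (w (# 10)) (w (# 11)))))) ∎
  where
  open ≡-Reasoning
  -- The tails left after peeling blocks are renamed to submatrices of `blockMat w` with explicit
  -- indices, where the zero pattern of `blocks` can be read off.
  corner : ∀ k → Mat (12 ℕ.∸ k) (12 ℕ.∸ k)
  corner k i j = blockMat w (offset k i) (offset k j)
  zeros : ∀ i k {p : Bool.T (allO (12 ℕ.∸ k) (λ j → lookup (lookup blocks i) (offset k j)))} →
    ∀ j → blockMat w i (offset k j) ≡ + 0
  zeros i k {p} = eval-O (12 ℕ.∸ k) (λ j → lookup (lookup blocks i) (offset k j)) p w
  g : ∀ x y → x * x + - (- y * y) ≡ gauss x y
  g = solve 2 (λ x y → x ⊠ x ⊞ ⊟ (⊟ y ⊠ y) ⊜ gaussₑ x y) refl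
  e : ∀ x y → x * (x + - y) + - (- y * y) ≡ eis x y
  e = solve 2 (λ x y → x ⊠ (x ⊞ ⊟ y) ⊞ ⊟ (⊟ y ⊠ y) ⊜ eisₑ x y) refl
  n : ∀ b₀ b₁ b₂ b₃ → d₄ b₀ (- b₁) (- b₂) (- - b₃) b₁ (b₀ + - b₁) (- b₃) (- (b₂ + - b₃)) b₂ (- b₃) b₀ (- b₁) b₃ (b₂ + - b₃) b₁ (b₀ + - b₁)
        ≡ norm₁₂ b₀ b₁ b₂ b₃
  n = solve 4 (λ b₀ b₁ b₂ b₃ → d₄ₑ b₀ (⊟ b₁) (⊟ b₂) (⊟ ⊟ b₃) b₁ (b₀ ⊞ ⊟ b₁) (⊟ b₃) (⊟ (b₂ ⊞ ⊟ b₃)) b₂ (⊟ b₃) b₀ (⊟ b₁) b₃ (b₂ ⊞ ⊟ b₃) b₁ (b₀ ⊞ ⊟ b₁)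
        ⊜ norm₁₂ₑ b₀ b₁ b₂ b₃) refl
  rest₈ : det 4 (tail₂ (corner 6)) ≡ norm₁₂ (w (# 8)) (w (# 9)) (w (# 10)) (w (# 11))
  rest₈ = trans (det-4 (tail₂ (corner 6))) (n (w (# 8)) (w (# 9)) (w (# 10)) (w (# 11)))
  rest₆ : det 6 (tail₂ (corner 4)) ≡ eis (w (# 6)) (w (# 7)) * norm₁₂ (w (# 8)) (w (# 9)) (w (# 10)) (w (# 11))
  rest₆ = trans (det-cong 6 {tail₂ (corner 4)} {corner 6} (λ i j → refl))
    (trans (det-head₂ 4 (corner 6) (zeros (# 6) 8) (zeros (# 7) 8)) (cong₂ _*_ (e (w (# 6)) (w (# 7))) rest₈))
  rest₄ : det 8 (tail₂ (corner 2)) ≡ eis (w (# 4)) (w (# 5)) * (eis (w (# 6)) (w (# 7)) * norm₁₂ (w (# 8)) (w (# 9)) (w (# 10)) (w (# 11)))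
  rest₄ = trans (det-cong 8 {tail₂ (corner 2)} {corner 4} (λ i j → refl))
    (trans (det-head₂ 6 (corner 4) (zeros (# 4) 6) (zeros (# 5) 6)) (cong₂ _*_ (e (w (# 4)) (w (# 5))) rest₆))
  rest : det 10 (tail₁ (corner 1)) ≡ gauss (w (# 2)) (w (# 3)) * (eis (w (# 4)) (w (# 5)) * (eis (w (# 6)) (w (# 7))
    * norm₁₂ (w (# 8)) (w (# 9)) (w (# 10)) (w (# 11))))
  rest = trans (det-cong 10 {tail₁ (corner 1)} {corner 2} (λ i j → refl))
    (trans (det-head₂ 8 (corner 2) (zeros (# 2) 4) (zeros (# 3) 4)) (cong₂ _*_ (g (w (# 2)) (w (# 3))) rest₄))

-- The determinant of ℤ₁₂

-- An element of ℤ[ℤ₁₂] = ℤ[ℤ₄][ℤ₃] is determined by its image Σ (pⱼ + qⱼω) xʲ in ℤ[ω][ℤ₄]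
-- together with the coefficients kⱼ of xʲω², so that its image in ℤ[ℤ₄] is Σ (pⱼ + qⱼ + 3kⱼ) xʲ.
-- The twelve coordinates are listed as p₀ … p₃, q₀ … q₃, k₀ … k₃.
𝐩 𝐪 𝐤 𝐡 : Fin 4 → Lin₁₂
𝐩 j = var (j F.↑ˡ 8)
𝐪 j = var (4 F.↑ʳ (j F.↑ˡ 4))
𝐤 j = var (8 F.↑ʳ j)
𝐡 j = 𝐩 j ⊕ 𝐪 j ⊕ (+ 3 · 𝐤 j)

coefficient : Fin 12 → Lin₁₂
coefficient g with toℕ g % 3
... | 0 = 𝐩 (toℕ g mod 4) ⊕ 𝐤 (toℕ g mod 4)
... | 1 = 𝐪 (toℕ g mod 4) ⊕ 𝐤 (toℕ g mod 4)
... | _ = 𝐤 (toℕ g mod 4)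

-- The values at 1, -1, i, ω, -ω and iω.
spectrum : Vec Lin₁₂ 12
spectrum =
    (𝐡 (# 0) ⊕ 𝐡 (# 1) ⊕ 𝐡 (# 2) ⊕ 𝐡 (# 3))
  ∷ (𝐡 (# 0) ⊕ ⊝ 𝐡 (# 1) ⊕ 𝐡 (# 2) ⊕ ⊝ 𝐡 (# 3))
  ∷ (𝐡 (# 0) ⊕ ⊝ 𝐡 (# 2))
  ∷ (𝐡 (# 1) ⊕ ⊝ 𝐡 (# 3))
  ∷ (𝐩 (# 0) ⊕ 𝐩 (# 1) ⊕ 𝐩 (# 2) ⊕ 𝐩 (# 3))
  ∷ (𝐪 (# 0) ⊕ 𝐪 (# 1) ⊕ 𝐪 (# 2) ⊕ 𝐪 (# 3))
  ∷ (𝐩 (# 0) ⊕ ⊝ 𝐩 (# 1) ⊕ 𝐩 (# 2) ⊕ ⊝ 𝐩 (# 3))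
  ∷ (𝐪 (# 0) ⊕ ⊝ 𝐪 (# 1) ⊕ 𝐪 (# 2) ⊕ ⊝ 𝐪 (# 3))
  ∷ (𝐩 (# 0) ⊕ ⊝ 𝐩 (# 2))
  ∷ (𝐪 (# 0) ⊕ ⊝ 𝐪 (# 2))
  ∷ (𝐩 (# 1) ⊕ ⊝ 𝐩 (# 3))
  ∷ (𝐪 (# 1) ⊕ ⊝ 𝐪 (# 3))
  ∷ []

_⟪_⟫ : ∀ {k n} → Vec (Lin k) n → (Fin k → ℤ) → Fin n → ℤ
(E ⟪ w ⟫) i = eval (lookup E i) w

Δ : (Fin 12 → ℤ) → ℤ
Δ w = w (# 0) * (w (# 1) * (gauss (w (# 2)) (w (# 3)) * (eis (w (# 4)) (w (# 5)) * (eis (w (# 6)) (w (# 7))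
    * norm₁₂ (w (# 8)) (w (# 9)) (w (# 10)) (w (# 11))))))

private
  -- Since ℤ₁₂ = ℤ₄ × ℤ₃, each basis vector is a product of one for either factor; `c₄` and `c₃` say
  -- which factors occur in column `c`.
  tensor : Vec (Vec ℤ 4) 4 → Vec (Vec ℤ 3) 3 → Fin 12 → Fin 12 → ℤ
  tensor V₄ V₃ g c = lookup (lookup V₄ (lookup c₄ c)) (toℕ g mod 4) * lookup (lookup V₃ (lookup c₃ c)) (toℕ g mod 3)
    where
    c₄ : Vec (Fin 4) 12
    c₄ = # 0 ∷ # 1 ∷ # 2 ∷ # 3 ∷ # 0 ∷ # 0 ∷ # 1 ∷ # 1 ∷ # 2 ∷ # 2 ∷ # 3 ∷ # 3 ∷ []
    c₃ : Vec (Fin 3) 12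
    c₃ = # 0 ∷ # 0 ∷ # 0 ∷ # 0 ∷ # 1 ∷ # 2 ∷ # 1 ∷ # 2 ∷ # 1 ∷ # 2 ∷ # 1 ∷ # 2 ∷ []

-- The columns of eigenbasis span the ideals of ℤ[ℤ₁₂] generated by the (x¹² - 1) / Φ_d.
eigenbasis dualBasis : Mat 12 12
eigenbasis = tensor
  ((+ 1 ∷ + 1 ∷ + 1 ∷ + 1 ∷ []) ∷ (+ 1 ∷ - + 1 ∷ + 1 ∷ - + 1 ∷ []) ∷ (+ 1 ∷ + 0 ∷ - + 1 ∷ + 0 ∷ []) ∷ (+ 0 ∷ + 1 ∷ + 0 ∷ - + 1 ∷ []) ∷ [])
  ((+ 1 ∷ + 1 ∷ + 1 ∷ []) ∷ (+ 1 ∷ - + 1 ∷ + 0 ∷ []) ∷ (+ 0 ∷ + 1 ∷ - + 1 ∷ []) ∷ [])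
dualBasis c g = tensor
  ((+ 1 ∷ + 1 ∷ + 1 ∷ + 1 ∷ []) ∷ (+ 1 ∷ - + 1 ∷ + 1 ∷ - + 1 ∷ []) ∷ (+ 2 ∷ + 0 ∷ - + 2 ∷ + 0 ∷ []) ∷ (+ 0 ∷ + 2 ∷ + 0 ∷ - + 2 ∷ []) ∷ [])
  ((+ 1 ∷ + 1 ∷ + 1 ∷ []) ∷ (+ 2 ∷ - + 1 ∷ - + 1 ∷ []) ∷ (+ 1 ∷ + 1 ∷ - + 2 ∷ []) ∷ [])
  g c

circulant : ∀ m → Mat 12 12
circulant m i j = eval (coefficient (subMod 12 i j)) (δ m)

blocksOf : ∀ m → Mat 12 12
blocksOf m = blockMat (spectrum ⟪ δ m ⟫)

_≋?_ : ∀ {m n} (M N : Mat m n) → Dec (M ≋ N)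
M ≋? N = F.all? λ i → F.all? λ j → M i j ℤ.≟ N i j

-- The ℤ₄ and ℤ₃ factors are dual to those of `eigenbasis` up to the scales 4 and 3.
dualBasis-inverse : (dualBasis ⊗ eigenbasis) ≋ scalar (+ 12)
dualBasis-inverse = toWitness {a? = (dualBasis ⊗ eigenbasis) ≋? scalar (+ 12)} _

-- Each ideal spanned by a group of columns is stable under multiplication, which acts on it through
-- the value at the corresponding character. For the twelve coordinate vectors this is a finite
-- computation.
circulant-blocks : ∀ m → (circulant m ⊗ eigenbasis) ≋ (eigenbasis ⊗ blocksOf m)
circulant-blocks = toWitness {a? = F.all? λ m → (circulant m ⊗ eigenbasis) ≋? (eigenbasis ⊗ blocksOf m)} _

groupDet-cong : ∀ n .{{_ : ℕ.NonZero n}} {x y : Fin n → ℤ} → (∀ g → x g ≡ y g) → groupDetCyclic n x ≡ groupDetCyclic n y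
groupDet-cong n {x} {y} e = det-cong n {λ i j → x (subMod n i j)} {λ i j → y (subMod n i j)} (λ i j → e (subMod n i j))

groupDet-spectrum : ∀ w → groupDetCyclic 12 (λ g → eval (coefficient g) w) ≡ Δ (spectrum ⟪ w ⟫)
groupDet-spectrum w = begin
    det 12 C             ≡⟨ det-cong 12 {C} {A} (λ i j → eval-linear (coefficient (subMod 12 i j)) w) ⟩
    det 12 A             ≡⟨ det-intertwine 12 A B eigenbasis dualBasis (+ 12)
                              dualBasis-inverse (intertwine circulant blocksOf eigenbasis circulant-blocks w) ⟩
    det 12 B             ≡⟨ det-cong 12 {blockMat v} {B} (λ i j → eval-∘ (lookup (lookup blocks i) j) (lookup spectrum) w) ⟨
    det 12 (blockMat v)  ≡⟨ det-blockMat v ⟩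
    Δ v                  ∎
  where
  open ≡-Reasoning
  v : Fin 12 → ℤ
  v = spectrum ⟪ w ⟫
  A B C : Mat 12 12
  A i j = sumFin 12 λ m → w m * circulant m i j
  B i j = sumFin 12 λ m → w m * blocksOf m i j
  C i j = eval (coefficient (subMod 12 i j)) w

-- The inverse of `coefficient`. The indices come from the Chinese remainder theorem: 8, 5, 2 and 11
-- are 2 modulo 3 and are 0, 1, 2 and 3 modulo 4, so they carry the `kⱼ`.
coordinates : Vec Lin₁₂ 12
coordinates =
    (x 0 ⊕ ⊝ x 8) ∷ (x 9 ⊕ ⊝ x 5) ∷ (x 6 ⊕ ⊝ x 2) ∷ (x 3 ⊕ ⊝ x 11)
  ∷ (x 4 ⊕ ⊝ x 8) ∷ (x 1 ⊕ ⊝ x 5) ∷ (x 10 ⊕ ⊝ x 2) ∷ (x 7 ⊕ ⊝ x 11)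
  ∷ x 8 ∷ x 5 ∷ x 2 ∷ x 11 ∷ []
  where
  x : ℕ → Lin₁₂
  x g = var (g mod 12)

coefficient-coordinates : ∀ x g → eval (coefficient g) (coordinates ⟪ x ⟫) ≡ x g
coefficient-coordinates x g = begin
    eval (coefficient g) (coordinates ⟪ x ⟫)
      ≡⟨ eval-∘ (coefficient g) (lookup coordinates) x ⟩
    sumFin 12 (λ m → x m * eval (coefficient g) (coordinates ⟪ δ m ⟫))
      ≡⟨ sumFin-cong 12 (λ m → cong (x m *_) (unit g m)) ⟩
    sumFin 12 (λ m → x m * δ g m)
      ≡⟨ sumFin-δ 12 x g ⟩
    x g ∎
  where
  open ≡-Reasoning
  unit : ∀ g m → eval (coefficient g) (coordinates ⟪ δ m ⟫) ≡ δ g m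
  unit = toWitness {a? = (λ g m → eval (coefficient g) (coordinates ⟪ δ m ⟫)) ≋? δ} _

InS⇒spectrum : ∀ {d} → InS 12 d → ∃ λ w → Δ (spectrum ⟪ w ⟫) ≡ d
InS⇒spectrum (x , e) = coordinates ⟪ x ⟫ , trans (sym (groupDet-spectrum (coordinates ⟪ x ⟫)))
  (trans (groupDet-cong 12 {λ g → eval (coefficient g) (coordinates ⟪ x ⟫)} {x} (coefficient-coordinates x)) e)

Δ-cong : ∀ v v′ → (∀ i → v i ≡ v′ i) → Δ v ≡ Δ v′
Δ-cong v v′ e = cong₂ _*_ (e (# 0)) (cong₂ _*_ (e (# 1)) (cong₂ _*_ (cong₂ gauss (e (# 2)) (e (# 3)))
  (cong₂ _*_ (cong₂ eis (e (# 4)) (e (# 5))) (cong₂ _*_ (cong₂ eis (e (# 6)) (e (# 7)))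
    (trans (cong₂ (λ a b → norm₁₂ a b (v (# 10)) (v (# 11))) (e (# 8)) (e (# 9)))
      (cong₂ (norm₁₂ (v′ (# 8)) (v′ (# 9))) (e (# 10)) (e (# 11))))))))

-- The coordinates w and the values v of a group ring element depend linearly on the parameters t.
family : ∀ {n} (w v : Vec (Lin n) 12) →
  {True ((λ m i → eval (lookup spectrum i) (w ⟪ δ m ⟫)) ≋? (λ m i → (v ⟪ δ m ⟫) i))} →
  ∀ t → InS 12 (Δ (v ⟪ t ⟫))
family {n} w v {ok} t = (λ g → eval (coefficient g) (w ⟪ t ⟫)) , trans (groupDet-spectrum (w ⟪ t ⟫)) (Δ-cong (spectrum ⟪ w ⟪ t ⟫ ⟫) (v ⟪ t ⟫) values)
  where
  values : ∀ i → (spectrum ⟪ w ⟪ t ⟫ ⟫) i ≡ (v ⟪ t ⟫) i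
  values i = trans (eval-∘ (lookup spectrum i) (lookup w) t)
    (trans (sumFin-cong n λ m → cong (t m *_) (toWitness ok m i)) (sym (eval-linear (lookup v i) t)))

-- Roots of unity modulo p

prime[2] : Prime 2
prime[2] = toWitness {a? = prime? 2} _
prime[3] : Prime 3
prime[3] = toWitness {a? = prime? 3} _

prime-∤! : ∀ {p} → Prime p → ∀ k → k ℕ.< p → ¬ (p ℕ.∣ k !)
prime-∤! pp zero    k<p d = ℕ.<-irrefl refl (ℕ.<-≤-trans (ℕ.nonTrivial⇒n>1 _ {{prime⇒nonTrivial pp}}) (ℕ.∣⇒≤ d))
prime-∤! pp (suc k) k<p d with euclidsLemma (suc k) (k !) pp d
... | inj₁ d′ = ℕ.<-irrefl refl (ℕ.<-≤-trans k<p (ℕ.∣⇒≤ d′))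
... | inj₂ d′ = prime-∤! pp k (ℕ.<-trans (ℕ.n<1+n k) k<p) d′

prime-∣C : ∀ {p} → Prime p → ∀ k → 0 ℕ.< k → k ℕ.< p → p ℕ.∣ p ℕ.C k
prime-∣C {p} pp k 0<k k<p with euclidsLemma (p ℕ.C k) (k ! ℕ.* (p ℕ.∸ k) !) pp (subst (p ℕ.∣_) (sym eq) (p∣p! p {{prime⇒nonZero pp}}))
  where
  instance _ = k ℕ.!* (p ℕ.∸ k) !≢0
  eq : (p ℕ.C k) ℕ.* (k ! ℕ.* (p ℕ.∸ k) !) ≡ p !
  eq = trans (cong (ℕ._* (k ! ℕ.* (p ℕ.∸ k) !)) (nCk≡n!/k![n-k]! (ℕ.<⇒≤ k<p))) (m/n*n≡m (k![n∸k]!∣n! (ℕ.<⇒≤ k<p)))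
  p∣p! : ∀ n .{{_ : ℕ.NonZero n}} → n ℕ.∣ n !
  p∣p! (suc n) = ℕ.m∣m*n (n !)
... | inj₁ d = d
... | inj₂ d with euclidsLemma (k !) ((p ℕ.∸ k) !) pp d
...   | inj₁ d′ = ⊥-elim (prime-∤! pp k k<p d′)
...   | inj₂ d′ = ⊥-elim (prime-∤! pp (p ℕ.∸ k) (ℕ.∸-monoʳ-< 0<k (ℕ.<⇒≤ k<p)) d′)

×≡* : ∀ n x → n Mult.× x ≡ n ℕ.* x
×≡* zero    x = refl
×≡* (suc n) x = cong (x ℕ.+_) (×≡* n x)

∣-sum : ∀ {d} n (f : Fin n → ℕ) → (∀ i → d ℕ.∣ f i) → d ℕ.∣ sum f
∣-sum zero    f e = ℕ._∣0 _
∣-sum (suc n) f e = ℕ.∣m∣n⇒∣m+n (e zero) (∣-sum n (f ∘ suc) (e ∘ suc))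

freshman : ∀ {p} → Prime p → ∀ a → ∃ λ c → (a ℕ.+ 1) ℕ.^ p ≡ 1 ℕ.+ (c ℕ.* p ℕ.+ a ℕ.^ p)
freshman {suc p} pp a with ∣-sum p middle middle-∣
  where
  term : Fin (2 ℕ.+ p) → ℕ
  term = Binomial.binomialTerm a 1 (suc p)
  middle : Fin p → ℕ
  middle i = term (suc (inject₁ i))
  middle-∣ : ∀ i → suc p ℕ.∣ middle i
  middle-∣ i = subst (suc p ℕ.∣_) (sym (×≡* (suc p ℕ.C suc (toℕ (inject₁ i))) _))
    (ℕ.∣m⇒∣m*n _ (prime-∣C pp (suc (toℕ (inject₁ i))) (s≤s z≤n) (s≤s (subst (ℕ._< p) (sym (F.toℕ-inject₁ i)) (F.toℕ<n i)))))
... | ℕ.divides c eq = c , (begin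
    (a ℕ.+ 1) ℕ.^ suc p            ≡⟨ ^≡^ (a ℕ.+ 1) (suc p) ⟨
    (a ℕ.+ 1) Exp.^ suc p          ≡⟨ Binomial.theorem (suc p) a 1 ⟩
    term zero ℕ.+ sum (term ∘ suc) ≡⟨ cong₂ ℕ._+_ first (trans (sum-init-last (term ∘ suc)) (cong₂ ℕ._+_ eq last)) ⟩
    1 ℕ.+ (c ℕ.* suc p ℕ.+ a ℕ.^ suc p) ∎)
  where
  open ≡-Reasoning
  ^≡^ : ∀ x n → x Exp.^ n ≡ x ℕ.^ n
  ^≡^ x zero    = refl
  ^≡^ x (suc n) = cong (x ℕ.*_) (^≡^ x n)
  1^ : ∀ n → 1 Exp.^ n ≡ 1
  1^ n = trans (^≡^ 1 n) (ℕ.^-zeroˡ n)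
  term : Fin (2 ℕ.+ p) → ℕ
  term = Binomial.binomialTerm a 1 (suc p)
  first : term zero ≡ 1
  first = trans (×≡* (suc p ℕ.C 0) (1 ℕ.* 1 Exp.^ suc p))
    (trans (cong ((suc p ℕ.C 0) ℕ.*_) (trans (ℕ.*-identityˡ _) (1^ (suc p)))) (ℕ.*-identityʳ (suc p ℕ.C 0)))
  last : term (suc (fromℕ p)) ≡ a ℕ.^ suc p
  last = trans (×≡* (suc p ℕ.C suc (toℕ (fromℕ p))) _)
    (trans (cong (λ t → (suc p ℕ.C suc t) ℕ.* (a Exp.^ suc t ℕ.* 1 Exp.^ (p ℕ.∸ t))) (F.toℕ-fromℕ p))
      (trans (cong₂ (λ u v → u ℕ.* (a Exp.^ suc p ℕ.* v)) (nCn≡1 (suc p)) (1^ (p ℕ.∸ p)))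
        (trans (ℕ.*-identityˡ _) (trans (ℕ.*-identityʳ _) (^≡^ a (suc p))))))

fermat : ∀ {p} → Prime p → ∀ a → ∃ λ c → a ℕ.^ p ≡ c ℕ.* p ℕ.+ a
fermat {suc p} pp zero = 0 , refl
fermat {p} pp (suc a) with fermat pp a | freshman pp a
... | c , e | c′ , e′ = c′ ℕ.+ c , (begin
    suc a ℕ.^ p                         ≡⟨ cong (ℕ._^ p) (ℕ.+-comm 1 a) ⟩
    (a ℕ.+ 1) ℕ.^ p                     ≡⟨ e′ ⟩
    suc (c′ ℕ.* p ℕ.+ a ℕ.^ p)          ≡⟨ cong (λ t → suc (c′ ℕ.* p ℕ.+ t)) e ⟩
    suc (c′ ℕ.* p ℕ.+ (c ℕ.* p ℕ.+ a))  ≡⟨ cong suc (ℕ.+-assoc (c′ ℕ.* p) (c ℕ.* p) a) ⟨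
    suc (c′ ℕ.* p ℕ.+ c ℕ.* p ℕ.+ a)    ≡⟨ cong (λ t → suc (t ℕ.+ a)) (ℕ.*-distribʳ-+ p c′ c) ⟨
    suc ((c′ ℕ.+ c) ℕ.* p ℕ.+ a)        ≡⟨ ℕ.+-suc ((c′ ℕ.+ c) ℕ.* p) a ⟨
    (c′ ℕ.+ c) ℕ.* p ℕ.+ suc a ∎)
  where open ≡-Reasoning

euclid : ∀ {p} → Prime p → ∀ {x y} → + p ∣ₛ x * y → + p ∣ₛ x ⊎ + p ∣ₛ y
euclid pp {x} {y} d with euclidsLemma ℤ.∣ x ∣ ℤ.∣ y ∣ pp (subst (_ ℕ.∣_) (abs-* x y) (∣⇒∣ᵤ d))
... | inj₁ e = inj₁ (∣ᵤ⇒∣ e)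
... | inj₂ e = inj₂ (∣ᵤ⇒∣ e)

pos-^ : ∀ a k → + (a ℕ.^ k) ≡ (+ a) ℤ.^ k
pos-^ a zero    = refl
pos-^ a (suc k) = trans (pos-* a (a ℕ.^ k)) (cong (+ a *_) (pos-^ a k))

little-fermat : ∀ {p} → Prime (suc p) → ∀ a → ¬ (+ suc p ∣ₛ + a) → + suc p ∣ₛ (+ a) ℤ.^ p + - (+ 1)
little-fermat {p} pp a ∤a with fermat pp a
... | c , e with euclid pp {+ a} {(+ a) ℤ.^ p + - (+ 1)} (divides (+ c) (begin
    + a * ((+ a) ℤ.^ p + - (+ 1)) ≡⟨ l (+ a) ((+ a) ℤ.^ p) ⟩
    (+ a) ℤ.^ suc p + - + a       ≡⟨ cong (_+ - + a) (pos-^ a (suc p)) ⟨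
    + (a ℕ.^ suc p) + - + a       ≡⟨ cong (λ t → + t + - + a) e ⟩
    + (c ℕ.* suc p ℕ.+ a) + - + a ≡⟨ cong (_+ - + a) (pos-+ (c ℕ.* suc p) a) ⟩
    + (c ℕ.* suc p) + + a + - + a ≡⟨ l′ (+ (c ℕ.* suc p)) (+ a) ⟩
    + (c ℕ.* suc p)               ≡⟨ pos-* c (suc p) ⟩
    + c * + suc p ∎))
  where
  open ≡-Reasoning
  l : ∀ a x → a * (x + - (+ 1)) ≡ a * x + - a
  l = solve-∀
  l′ : ∀ x a → x + a + - a ≡ x
  l′ = solve-∀
... | inj₁ d = ⊥-elim (∤a d)
... | inj₂ d = d

-- Forward differences take the place of counting roots of xᵏ - 1 over a finite field.
difference : (ℕ → ℤ) → ℕ → ℤ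
difference f x = f (suc x) + - f x

differences : ℕ → (ℕ → ℤ) → ℕ → ℤ
differences zero    f = f
differences (suc n) f = differences n (difference f)

differences-cong : ∀ n {f g : ℕ → ℤ} → (∀ x → f x ≡ g x) → ∀ x → differences n f x ≡ differences n g x
differences-cong zero    e x = e x
differences-cong (suc n) e x = differences-cong n (λ x → cong₂ (λ u v → u + - v) (e (suc x)) (e x)) x

differences-+ : ∀ n (f g : ℕ → ℤ) x → differences n (λ x → f x + g x) x ≡ differences n f x + differences n g x
differences-+ zero    f g x = refl
differences-+ (suc n) f g x = trans
  (differences-cong n (λ x → l (f (suc x)) (g (suc x)) (f x) (g x)) x)
  (differences-+ n (difference f) (difference g) x)
  where
  l : ∀ a b c d → a + b + - (c + d) ≡ (a + - c) + (b + - d)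
  l = solve-∀

differences-shift : ∀ n f x → differences n (f ∘ suc) x ≡ differences n f (suc x)
differences-shift zero    f x = refl
differences-shift (suc n) f x = differences-shift n (difference f) x

differences-suc : ∀ n f x → differences (suc n) f x ≡ differences n f (suc x) + - differences n f x
differences-suc zero    f x = refl
differences-suc (suc n) f x = differences-suc n (difference f) x

-- The discrete product rule: x has constant difference 1, so only two terms survive. By induction
-- it evaluates the k-th difference of xᵏ.
differences-leibniz : ∀ n (g : ℕ → ℤ) x →
  differences (suc n) (λ x → + x * g x) x ≡ + x * differences (suc n) g x + + suc n * differences n g (suc x)
differences-leibniz zero g x = l (+ x) (g (suc x)) (g x)
  where
  l : ∀ x a b → (+ 1 + x) * a + - (x * b) ≡ x * (a + - b) + + 1 * a
  l = solve-∀
differences-leibniz (suc n) g x = begin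
    differences (suc n) (difference (λ x → + x * g x)) x
      ≡⟨ differences-cong (suc n) (λ x → l (+ x) (g (suc x)) (g x)) x ⟩
    differences (suc n) (λ x → + x * difference g x + g (suc x)) x
      ≡⟨ differences-+ (suc n) (λ x → + x * difference g x) (g ∘ suc) x ⟩
    differences (suc n) (λ x → + x * difference g x) x + differences (suc n) (g ∘ suc) x
      ≡⟨ cong₂ _+_ (differences-leibniz n (difference g) x) (differences-shift (suc n) g x) ⟩
    + x * D₂ + + suc n * D₁ + D₁
      ≡⟨ l′ (+ x) D₂ D₁ (+ suc n) ⟩
    + x * D₂ + + suc (suc n) * D₁ ∎
  where
  open ≡-Reasoning
  D₂ D₁ : ℤ
  D₂ = differences (suc (suc n)) g x
  D₁ = differences (suc n) g (suc x)
  l : ∀ x a b → (+ 1 + x) * a + - (x * b) ≡ x * (a + - b) + a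
  l = solve-∀
  l′ : ∀ x d e n → x * d + n * e + e ≡ x * d + (+ 1 + n) * e
  l′ = solve-∀

differences-power : ∀ k x → differences k (λ x → (+ x) ℤ.^ k) x ≡ + (k !)
differences-power zero    x = refl
differences-power (suc k) x = begin
    differences (suc k) (λ x → + x * (+ x) ℤ.^ k) x
      ≡⟨ differences-leibniz k f x ⟩
    + x * differences (suc k) f x + + suc k * differences k f (suc x)
      ≡⟨ cong₂ (λ u v → + x * u + + suc k * v) (differences-suc k f x) (differences-power k (suc x)) ⟩
    + x * (differences k f (suc x) + - differences k f x) + + suc k * + (k !)
      ≡⟨ cong₂ (λ u v → + x * (u + - v) + + suc k * + (k !)) (differences-power k (suc x)) (differences-power k x) ⟩
    + x * (+ (k !) + - + (k !)) + + suc k * + (k !)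
      ≡⟨ l (+ x) (+ (k !)) (+ suc k * + (k !)) ⟩
    + suc k * + (k !)
      ≡⟨ pos-* (suc k) (k !) ⟨
    + (suc k !) ∎
  where
  open ≡-Reasoning
  f : ℕ → ℤ
  f x = (+ x) ℤ.^ k
  l : ∀ x a b → x * (a + - a) + b ≡ b
  l = solve-∀

differences-∣ : ∀ {d} n (f : ℕ → ℤ) a → (∀ i → i ℕ.≤ n → d ∣ₛ f (i ℕ.+ a)) → d ∣ₛ differences n f a
differences-∣ zero    f a e = e 0 z≤n
differences-∣ (suc n) f a e = differences-∣ n (difference f) a λ i p → ∣m∣n⇒∣m-n (e (suc i) (s≤s p)) (e i (ℕ.m≤n⇒m≤1+n p))

not-constant : ∀ {d} n (f : ℕ → ℤ) → ¬ (d ∣ₛ differences (suc n) f 1) →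
  ∃ λ (i : Fin (2 ℕ.+ n)) → ¬ (d ∣ₛ f (suc (toℕ i)) + - (+ 1))
not-constant {d} n f ∤D = F.¬∀⟶∃¬ (2 ℕ.+ n) P (λ i → d ∣? f (suc (toℕ i)) + - (+ 1)) λ e →
  ∤D (differences-∣ n (difference f) 1 (step e))
  where
  P : Fin (2 ℕ.+ n) → Set
  P i = d ∣ₛ f (suc (toℕ i)) + - (+ 1)
  module _ (e : ∀ i → P i) where
    at : ∀ i → i ℕ.< 2 ℕ.+ n → d ∣ₛ f (suc i) + - (+ 1)
    at i lt = subst (λ t → d ∣ₛ f (suc t) + - (+ 1)) (F.toℕ-fromℕ< lt) (e (fromℕ< lt))
    l : ∀ x y → (x + - (+ 1)) + - (y + - (+ 1)) ≡ x + - y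
    l = solve-∀
    step : ∀ i → i ℕ.≤ n → d ∣ₛ difference f (i ℕ.+ 1)
    step i le = subst (λ t → d ∣ₛ difference f t) (ℕ.+-comm 1 i)
      (subst (d ∣ₛ_) (l (f (suc (suc i))) (f (suc i))) (∣m∣n⇒∣m-n (at (suc i) (s≤s (s≤s le))) (at i (s≤s (ℕ.m≤n⇒m≤1+n le)))))

-- If xᵏ ≡ 1 for x = 1, …, k + 1, then the k-th difference k! of xᵏ vanishes modulo p.
power-≢1 : ∀ {p} → Prime p → ∀ k → 0 ℕ.< k → suc k ℕ.< p →
  ∃ λ a → ¬ (+ p ∣ₛ + a) × ¬ (+ p ∣ₛ (+ a) ℤ.^ k + - (+ 1))
power-≢1 {p} pp (suc k) _ k<p = suc (toℕ i) , ∤i , proj₂ found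
  where
  f : ℕ → ℤ
  f x = (+ x) ℤ.^ suc k
  ∤k! : ¬ (+ p ∣ₛ + (suc k !))
  ∤k! d = prime-∤! pp (suc k) (ℕ.<-trans (ℕ.n<1+n (suc k)) k<p) (∣⇒∣ᵤ d)
  found : ∃ λ (i : Fin (2 ℕ.+ k)) → ¬ (+ p ∣ₛ f (suc (toℕ i)) + - (+ 1))
  found = not-constant k f (∤k! ∘ subst (+ p ∣ₛ_) (differences-power (suc k) 1))
  i : Fin (2 ℕ.+ k)
  i = proj₁ found
  ∤i : ¬ (+ p ∣ₛ + suc (toℕ i))
  ∤i d = ℕ.<-irrefl refl (ℕ.<-≤-trans k<p (ℕ.≤-trans (ℕ.∣⇒≤ (∣⇒∣ᵤ d)) (F.toℕ<n i)))

private
  one+multiple : ∀ p n .{{_ : ℕ.NonZero n}} → p % n ≡ 1 → p ≡ suc (p / n ℕ.* n)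
  one+multiple p n r = trans (m≡m%n+[m/n]*n p n) (cong (ℕ._+ p / n ℕ.* n) r)

  positive-quotient : ∀ {p} → Prime p → ∀ j n → p ≡ suc (j ℕ.* n) → 0 ℕ.< j
  positive-quotient pp zero    n refl = ⊥-elim (ℕ.<-irrefl refl (ℕ.nonTrivial⇒n>1 1 {{prime⇒nonTrivial pp}}))
  positive-quotient pp (suc j) n e    = s≤s z≤n

-- A power a^((p-1)/n) which is not 1 is a nontrivial n-th root of unity.
root-of-unity : ∀ {p} → Prime p → ∀ j n → 1 ℕ.< n → p ≡ suc (j ℕ.* n) →
  ∃ λ a → + p ∣ₛ ((+ a) ℤ.^ j) ℤ.^ n + - (+ 1) × ¬ (+ p ∣ₛ (+ a) ℤ.^ j + - (+ 1))
root-of-unity {p} pp j n 1<n e = proj₁ found , subst (λ x → + p ∣ₛ x + - (+ 1)) (sym (^-*-assoc (+ proj₁ found) j n)) power , proj₂ (proj₂ found)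
  where
  0<j : 0 ℕ.< j
  0<j = positive-quotient pp j n e
  j<jn : j ℕ.< j ℕ.* n
  j<jn = ℕ.m<m*n j n {{ℕ.>-nonZero 0<j}} 1<n
  found : ∃ λ a → ¬ (+ p ∣ₛ + a) × ¬ (+ p ∣ₛ (+ a) ℤ.^ j + - (+ 1))
  found = power-≢1 pp j 0<j (subst (suc j ℕ.<_) (sym e) (s≤s j<jn))
  power : + p ∣ₛ (+ proj₁ found) ℤ.^ (j ℕ.* n) + - (+ 1)
  power = subst (λ q → + q ∣ₛ (+ proj₁ found) ℤ.^ (j ℕ.* n) + - (+ 1)) (sym e)
    (little-fermat (subst Prime e pp) (proj₁ found) (proj₁ (proj₂ found) ∘ subst (λ q → + q ∣ₛ + proj₁ found) (sym e)))

cbrt-1 : ∀ {p} → Prime p → p % 3 ≡ 1 → ∃ λ t → + p ∣ₛ t * t + t + + 1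
cbrt-1 {p} pp r = t , [ ⊥-elim ∘ proj₂ (proj₂ found) , (λ d → d) ]′ (euclid pp {t + - (+ 1)} {t * t + t + + 1}
    (subst (+ p ∣ₛ_) (l t) (proj₁ (proj₂ found))))
  where
  found : ∃ λ a → + p ∣ₛ ((+ a) ℤ.^ (p / 3)) ℤ.^ 3 + - (+ 1) × ¬ (+ p ∣ₛ (+ a) ℤ.^ (p / 3) + - (+ 1))
  found = root-of-unity pp (p / 3) 3 (s≤s (s≤s z≤n)) (one+multiple p 3 r)
  t : ℤ
  t = (+ proj₁ found) ℤ.^ (p / 3)
  l : ∀ x → x * (x * (x * + 1)) + - (+ 1) ≡ (x + - (+ 1)) * (x * x + x + + 1)
  l = solve-∀

sqrt-1 : ∀ {p} → Prime p → p % 4 ≡ 1 → ∃ λ t → + p ∣ₛ t * t + + 1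
sqrt-1 {p} pp r = (+ proj₁ found) ℤ.^ j , subst (λ x → + p ∣ₛ x + + 1) (trans (sym (^-*-assoc (+ proj₁ found) j 2)) (l′ ((+ proj₁ found) ℤ.^ j)))
    ([ ⊥-elim ∘ proj₂ (proj₂ found) , (λ d → d) ]′ (euclid pp {t + - (+ 1)} {t + + 1} (subst (+ p ∣ₛ_) (l t) (proj₁ (proj₂ found)))))
  where
  j : ℕ
  j = p / 4
  -- With p - 1 = 4j, the power a²ʲ is a square root of 1 other than 1, hence -1, and aʲ is a square
  -- root of it.
  found : ∃ λ a → + p ∣ₛ ((+ a) ℤ.^ (j ℕ.* 2)) ℤ.^ 2 + - (+ 1) × ¬ (+ p ∣ₛ (+ a) ℤ.^ (j ℕ.* 2) + - (+ 1))
  found = root-of-unity pp (j ℕ.* 2) 2 (s≤s (s≤s z≤n)) (trans (one+multiple p 4 r) (cong suc (sym (ℕ.*-assoc j 2 2))))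
  t : ℤ
  t = (+ proj₁ found) ℤ.^ (j ℕ.* 2)
  l : ∀ x → x * (x * + 1) + - (+ 1) ≡ (x + - (+ 1)) * (x + + 1)
  l = solve-∀
  l′ : ∀ x → x * (x * + 1) ≡ x * x
  l′ = solve-∀

-- Fermat's descent

-- The operations are parameters so that the same formulas can be read in ℤ, in ℤ[ω] and in the
-- syntax of the ring solver.
module Forms {A : Set} (_⊹_ _∙_ : A → A → A) (neg : A → A) (ε : A) where
  form : A → A → A
  form x y = ((x ∙ x) ⊹ (ε ∙ (x ∙ y))) ⊹ (y ∙ y)

  cross : A → A → A → A → A
  cross x y a b = ((x ∙ a) ⊹ (x ∙ a)) ⊹ ((ε ∙ ((x ∙ b) ⊹ (y ∙ a))) ⊹ ((y ∙ b) ⊹ (y ∙ b)))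

  shift : A → A → A → A
  shift m x a = x ⊹ (m ∙ a)

  -- If the form takes the value zm at (x , y), then it takes the value m (quotient z m x y a b)
  -- at (x + ma , y + mb).
  quotient : A → A → A → A → A → A → A
  quotient z m x y a b = (z ⊹ cross x y a b) ⊹ (m ∙ form a b)

  nextX nextY : A → A → A → A → A → A
  nextX m x y a b = m ⊹ neg (((a ∙ x) ⊹ (ε ∙ (a ∙ y))) ⊹ (b ∙ y))
  nextY m x y a b = (a ∙ y) ⊹ neg (b ∙ x)

-- These identities are a hypothesis of the descent because the ring solver needs a concrete ring, in which
-- it can recognise zero coefficients.
module _ {A : Set} (_⊹_ _∙_ : A → A → A) (neg : A → A) where
  private module Form (ε : A) = Forms _⊹_ _∙_ neg ε

  record Identities : Set where
    field
      shift-form : ∀ x y a b m ε → Form.form ε (Form.shift ε m x a) (Form.shift ε m y b)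
        ≡ Form.form ε x y ⊹ ((m ∙ Form.cross ε x y a b) ⊹ (m ∙ (m ∙ Form.form ε a b)))
      factor : ∀ z m t f → (z ∙ m) ⊹ ((m ∙ t) ⊹ (m ∙ (m ∙ f))) ≡ m ∙ ((z ⊹ t) ⊹ (m ∙ f))
      next-form : ∀ m x y a b ε → Form.form ε (Form.nextX ε m x y a b) (Form.nextY ε m x y a b)
        ≡ (m ∙ (m ⊹ neg (Form.cross ε x y a b))) ⊹ (Form.form ε a b ∙ Form.form ε x y)
      next-quotient : ∀ z m x y a b ε →
        (Form.quotient ε z m x y a b ∙ (Form.quotient ε z m x y a b ⊹ neg (Form.cross ε (Form.shift ε m x a) (Form.shift ε m y b) a b)))
          ⊹ (Form.form ε a b ∙ (m ∙ Form.quotient ε z m x y a b)) ≡ z ∙ Form.quotient ε z m x y a b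
      unshift : ∀ m x a → x ≡ Form.shift m m x a ⊹ (m ∙ neg a)
      multiple-form : ∀ m a b ε → Form.form ε (m ∙ neg a) (m ∙ neg b) ≡ m ∙ (Form.form ε a b ∙ m)

module _ {A : Set} {n : ℕ} where
  private
    E : Set
    E = Expr A n
    module Form (ε : E) = Forms {E} _⊞_ _⊠_ ⊟_ ε

  shift-formₑ next-formₑ : (x y a b m ε : E) → E × E
  shift-formₑ x y a b m ε = Form.form ε (Form.shift ε m x a) (Form.shift ε m y b) ,
    Form.form ε x y ⊞ ((m ⊠ Form.cross ε x y a b) ⊞ (m ⊠ (m ⊠ Form.form ε a b)))
  next-formₑ m x y a b ε = Form.form ε (Form.nextX ε m x y a b) (Form.nextY ε m x y a b) ,
    (m ⊠ (m ⊞ ⊟ (Form.cross ε x y a b))) ⊞ (Form.form ε a b ⊠ Form.form ε x y)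
  factorₑ multiple-formₑ : (z m t f : E) → E × E
  factorₑ z m t f = (z ⊠ m) ⊞ ((m ⊠ t) ⊞ (m ⊠ (m ⊠ f))) , m ⊠ ((z ⊞ t) ⊞ (m ⊠ f))
  multiple-formₑ m a b ε = Form.form ε (m ⊠ ⊟ a) (m ⊠ ⊟ b) , m ⊠ (Form.form ε a b ⊠ m)
  next-quotientₑ : (z m x y a b ε : E) → E × E
  next-quotientₑ z m x y a b ε =
    (Form.quotient ε z m x y a b ⊠ (Form.quotient ε z m x y a b ⊞ ⊟ (Form.cross ε (Form.shift ε m x a) (Form.shift ε m y b) a b)))
      ⊞ (Form.form ε a b ⊠ (m ⊠ Form.quotient ε z m x y a b)) , z ⊠ Form.quotient ε z m x y a b
  unshiftₑ : (m x a : E) → E × E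
  unshiftₑ m x a = x , Form.shift m m x a ⊞ (m ⊠ ⊟ a)

-- Fermat's descent for the form x² + εxy + y² over a ring in which division with remainder
-- makes the form small.
module Descent {A : Set} {_⊹_ _∙_ : A → A → A} {neg : A → A} {0# 1# : A}
  (isRing : IsCommutativeRing _≡_ _⊹_ _∙_ neg 0# 1#) (identities : Identities _⊹_ _∙_ neg) (ε : A)
  (∥_∥ : A → ℕ) (∥∙∥ : ∀ x y → ∥ x ∙ y ∥ ≡ ∥ x ∥ ℕ.* ∥ y ∥)
  where

  open Forms _⊹_ _∙_ neg ε public
  open Identities identities
  private
    module R = IsCommutativeRing isRing

    form-shift : ∀ z m x y a b → form x y ≡ z ∙ m → form (shift m x a) (shift m y b) ≡ m ∙ quotient z m x y a b
    form-shift z m x y a b e = trans (shift-form x y a b m ε)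
      (trans (cong (λ t → t ⊹ ((m ∙ cross x y a b) ⊹ (m ∙ (m ∙ form a b)))) e) (factor z m (cross x y a b) (form a b)))

    -- (x + yθ) times the conjugate of (x′ + y′θ), divided by m.
    form-next : ∀ z m x y a b → form x y ≡ z ∙ m →
      let x′ = shift m x a ; y′ = shift m y b ; m′ = quotient z m x y a b in
      form (nextX m′ x′ y′ a b) (nextY m′ x′ y′ a b) ≡ z ∙ m′
    form-next z m x y a b e = trans (next-form m′ x′ y′ a b ε)
        (trans (cong (λ t → (m′ ∙ (m′ ⊹ neg (cross x′ y′ a b))) ⊹ (form a b ∙ t)) (form-shift z m x y a b e))
          (next-quotient z m x y a b ε))
      where
      x′ y′ m′ : A
      x′ = shift m x a
      y′ = shift m y b
      m′ = quotient z m x y a b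

  module _
    (definite : ∀ x → ∥ x ∥ ≡ 0 → x ≡ 0#)
    (anisotropic : ∀ x y → form x y ≡ 0# → x ≡ 0# × y ≡ 0#)
    (reduce : ∀ m x y → 0 ℕ.< ∥ m ∥ → ∃₂ λ a b → ∥ form (x ⊹ (m ∙ a)) (y ⊹ (m ∙ b)) ∥ ℕ.< ∥ m ∥ ℕ.* ∥ m ∥)
    where

    private
      shift≡0 : ∀ m x a → shift m x a ≡ 0# → x ≡ m ∙ neg a
      shift≡0 m x a e = trans (unshift m x a) (trans (cong (_⊹ (m ∙ neg a)) e) (R.+-identityˡ _))

      quotient-small : ∀ z m x y a b → 0 ℕ.< ∥ m ∥ → form x y ≡ z ∙ m →
        ∥ form (shift m x a) (shift m y b) ∥ ℕ.< ∥ m ∥ ℕ.* ∥ m ∥ → ∥ quotient z m x y a b ∥ ℕ.< ∥ m ∥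
      quotient-small z m x y a b 0<m e lt = ℕ.*-cancelˡ-< ∥ m ∥ _ _
        (subst (ℕ._< ∥ m ∥ ℕ.* ∥ m ∥) (trans (cong ∥_∥ (form-shift z m x y a b e)) (∥∙∥ m _)) lt)

    descend : ∀ {p} → Prime p → ∀ z → ∥ z ∥ ≡ p → ∀ m x y → Acc ℕ._<_ ∥ m ∥ → 0 ℕ.< ∥ m ∥ → ∥ m ∥ ℕ.< p →
      form x y ≡ z ∙ m → ∃₂ λ x y → ∥ form x y ∥ ≡ p
    descend {p} pp z ∥z∥ m x y (acc rec) 0<m m<p e = [ done , step ]′ (Sum.swap (Sum.map₂ sym (ℕ.m≤n⇒m<n∨m≡n 0<m)))
      where
      done : ∥ m ∥ ≡ 1 → ∃₂ λ x y → ∥ form x y ∥ ≡ p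
      done 1≡ = x , y , trans (cong ∥_∥ e) (trans (∥∙∥ z m) (trans (cong₂ ℕ._*_ ∥z∥ 1≡) (ℕ.*-identityʳ p)))
      step : 1 ℕ.< ∥ m ∥ → ∃₂ λ x y → ∥ form x y ∥ ≡ p
      step 1<m with reduce m x y 0<m
      ... | a , b , small = descend pp z ∥z∥ m′ (nextX m′ (shift m x a) (shift m y b) a b) (nextY m′ (shift m x a) (shift m y b) a b)
          (rec m′<m) (ℕ.n≢0⇒n>0 m′≢0) (ℕ.<-trans m′<m m<p) (form-next z m x y a b e)
        where
        m′ : A
        m′ = quotient z m x y a b
        m′<m : ∥ m′ ∥ ℕ.< ∥ m ∥
        m′<m = quotient-small z m x y a b 0<m e small
        -- If `m′` were zero, anisotropy would make `x` and `y` multiples of `m`, and ∥ m ∥ would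
        -- divide `p`; but it lies strictly between 1 and `p`.
        m′≢0 : ∥ m′ ∥ ≢ 0
        m′≢0 m′≡0 with anisotropic (shift m x a) (shift m y b) (trans (form-shift z m x y a b e) (trans (cong (m ∙_) (definite m′ m′≡0)) (R.zeroʳ m)))
        ... | x≡ , y≡ = [ (λ 1≡ → ℕ.<-irrefl (sym 1≡) 1<m) , (λ p≡ → ℕ.<-irrefl p≡ m<p) ]′
              (prime⇒irreducible pp (ℕ.divides ∥ form a b ∥ (ℕ.*-cancelˡ-≡ p _ ∥ m ∥ {{ℕ.>-nonZero 0<m}} (begin
                ∥ m ∥ ℕ.* p        ≡⟨ ℕ.*-comm ∥ m ∥ p ⟩
                p ℕ.* ∥ m ∥        ≡⟨ cong (ℕ._* ∥ m ∥) ∥z∥ ⟨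
                ∥ z ∥ ℕ.* ∥ m ∥    ≡⟨ ∥∙∥ z m ⟨
                ∥ z ∙ m ∥          ≡⟨ cong ∥_∥ e ⟨
                ∥ form x y ∥       ≡⟨ cong₂ (λ u v → ∥ form u v ∥) (shift≡0 m x a x≡) (shift≡0 m y b y≡) ⟩
                ∥ form (m ∙ neg a) (m ∙ neg b) ∥ ≡⟨ cong ∥_∥ (multiple-form m a b ε) ⟩
                ∥ m ∙ (form a b ∙ m) ∥ ≡⟨ trans (∥∙∥ m _) (cong (∥ m ∥ ℕ.*_) (∥∙∥ (form a b) m)) ⟩
                ∥ m ∥ ℕ.* (∥ form a b ∥ ℕ.* ∥ m ∥) ∎))))
          where open ≡-Reasoning

    -- One reduction modulo `z` itself brings the cofactor below `p`. It is nonzero because `z` does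
    -- not divide both coordinates, and `descend` takes over.
    represent : ∀ {p} → Prime p → ∀ z → ∥ z ∥ ≡ p → ∀ w x y → form x y ≡ z ∙ w →
      ¬ ((∃ λ a → x ≡ z ∙ a) × (∃ λ b → y ≡ z ∙ b)) → ∃₂ λ x y → ∥ form x y ∥ ≡ p
    represent {p} pp z ∥z∥ w x y e ∤ with reduce z x y 0<z
      where
      0<z : 0 ℕ.< ∥ z ∥
      0<z = subst (0 ℕ.<_) (sym ∥z∥) (ℕ.>-nonZero⁻¹ p {{prime⇒nonZero pp}})
    ... | a , b , small = descend pp z ∥z∥ m (shift z x a) (shift z y b) (<-wellFounded _) (ℕ.n≢0⇒n>0 m≢0)
        (subst (∥ m ∥ ℕ.<_) ∥z∥ (quotient-small w z x y a b 0<z e′ small)) (form-shift w z x y a b e′)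
      where
      0<z : 0 ℕ.< ∥ z ∥
      0<z = subst (0 ℕ.<_) (sym ∥z∥) (ℕ.>-nonZero⁻¹ p {{prime⇒nonZero pp}})
      e′ : form x y ≡ w ∙ z
      e′ = trans e (R.*-comm z w)
      m : A
      m = quotient w z x y a b
      m≢0 : ∥ m ∥ ≢ 0
      m≢0 m≡0 with anisotropic (shift z x a) (shift z y b) (trans (form-shift w z x y a b e′) (trans (cong (z ∙_) (definite m m≡0)) (R.zeroʳ z)))
      ... | x≡ , y≡ = ∤ ((neg a , shift≡0 z x a x≡) , (neg b , shift≡0 z y b y≡))

-- Division with remainder in ℤ and ℤ[ω], and the three instances of the descent

ℤ-identities : Identities _+_ _*_ -_
ℤ-identities = record
  { shift-form = solve 6 shift-formₑ refl ; factor = solve 4 factorₑ refl ; next-form = solve 6 next-formₑ refl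
  ; next-quotient = solve 7 next-quotientₑ refl ; unshift = solve 3 unshiftₑ refl ; multiple-form = solve 4 multiple-formₑ refl }

-- In the hexagonal lattice x² + xy + y² is the squared distance to the vertex of weight `z`. The
-- sharp constant is one third, but one half is what `𝔼-reduce` needs: the norms of two remainders
-- must add up to less than that of the divisor.
hexagon : ∀ x y z → x ℕ.≤ z → y ℕ.≤ z → 0 ℕ.< x ℕ.+ y ℕ.+ z →
  2 ℕ.* (x ℕ.* x ℕ.+ x ℕ.* y ℕ.+ y ℕ.* y) ℕ.< (x ℕ.+ y ℕ.+ z) ℕ.* (x ℕ.+ y ℕ.+ z)
hexagon x y z x≤z y≤z 0< = begin-strict
    2 ℕ.* (x ℕ.* x ℕ.+ x ℕ.* y ℕ.+ y ℕ.* y)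
      ≤⟨ ℕ.*-monoʳ-≤ 2 (ℕ.+-mono-≤ (ℕ.+-monoˡ-≤ (x ℕ.* y) (ℕ.*-monoʳ-≤ x x≤z)) (ℕ.*-monoʳ-≤ y y≤z)) ⟩
    2 ℕ.* (x ℕ.* z ℕ.+ x ℕ.* y ℕ.+ y ℕ.* z)
      <⟨ ℕ.m<m+n _ (ℕ.<-≤-trans (0<z² z x≤z y≤z 0<) (ℕ.m≤n+m (z ℕ.* z) (x ℕ.* x ℕ.+ y ℕ.* y))) ⟩
    2 ℕ.* (x ℕ.* z ℕ.+ x ℕ.* y ℕ.+ y ℕ.* z) ℕ.+ (x ℕ.* x ℕ.+ y ℕ.* y ℕ.+ z ℕ.* z)
      ≡⟨ expand x y z ⟩
    (x ℕ.+ y ℕ.+ z) ℕ.* (x ℕ.+ y ℕ.+ z) ∎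
  where
  open ℕ.≤-Reasoning
  expand : ∀ x y z → 2 ℕ.* (x ℕ.* z ℕ.+ x ℕ.* y ℕ.+ y ℕ.* z) ℕ.+ (x ℕ.* x ℕ.+ y ℕ.* y ℕ.+ z ℕ.* z) ≡ (x ℕ.+ y ℕ.+ z) ℕ.* (x ℕ.+ y ℕ.+ z)
  expand = ℕ-Solver.solve-∀
  0<z² : ∀ {x y} z → x ℕ.≤ z → y ℕ.≤ z → 0 ℕ.< x ℕ.+ y ℕ.+ z → 0 ℕ.< z ℕ.* z
  0<z² zero    z≤n z≤n ()
  0<z² (suc z) _   _   _ = s≤s z≤n

largest : ∀ x y z → (x ℕ.≤ z × y ℕ.≤ z) ⊎ (x ℕ.≤ y × z ℕ.≤ y) ⊎ (y ℕ.≤ x × z ℕ.≤ x)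
largest x y z with ℕ.≤-total x y | ℕ.≤-total y z | ℕ.≤-total x z
... | inj₁ x≤y | inj₁ y≤z | _        = inj₁ (ℕ.≤-trans x≤y y≤z , y≤z)
... | inj₁ x≤y | inj₂ z≤y | _        = inj₂ (inj₁ (x≤y , z≤y))
... | inj₂ y≤x | _        | inj₁ x≤z = inj₁ (x≤z , ℕ.≤-trans y≤x x≤z)
... | inj₂ y≤x | _        | inj₂ z≤x = inj₂ (inj₂ (y≤x , z≤x))

-- (l₁ + l₂ , l₂) lies in the triangle with vertices (0 , 0), (N , 0), (N , N), with barycentric
-- coordinates l₀, l₁, l₂; the vertex of largest weight is close.
hexagon-round : ∀ l₀ l₁ l₂ → 0 ℕ.< l₀ ℕ.+ l₁ ℕ.+ l₂ → let N = l₀ ℕ.+ l₁ ℕ.+ l₂ in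
  ∃₂ λ a b → 2 ℕ.* ℤ.∣ eis (+ (l₁ ℕ.+ l₂) + + N * a) (+ l₂ + + N * b) ∣ ℕ.< N ℕ.* N
hexagon-round l₀ l₁ l₂ 0<N = [ third , [ second , first ]′ ]′ (largest l₀ l₁ l₂)
  where
  N : ℕ
  N = l₀ ℕ.+ l₁ ℕ.+ l₂
  Rounding : Set
  Rounding = ∃₂ λ a b → 2 ℕ.* ℤ.∣ eis (+ (l₁ ℕ.+ l₂) + + N * a) (+ l₂ + + N * b) ∣ ℕ.< N ℕ.* N
  vertex : ∀ a b x y z → x ℕ.≤ z × y ℕ.≤ z → x ℕ.+ y ℕ.+ z ≡ N →
    eis (+ l₁ + + l₂ + (+ l₀ + + l₁ + + l₂) * a) (+ l₂ + (+ l₀ + + l₁ + + l₂) * b) ≡ + x * + x + + x * + y + + y * + y → Rounding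
  vertex a b x y z (x≤z , y≤z) eq e = a , b , subst₂ (λ t M → 2 ℕ.* ℤ.∣ t ∣ ℕ.< M ℕ.* M)
    (trans (trans (cong₂ _+_ (cong₂ _+_ (pos-* x x) (pos-* x y)) (pos-* y y)) (sym e))
      (cong₂ (λ P M → eis (P + M * a) (+ l₂ + M * b)) (sym (pos-+ l₁ l₂)) (sym (trans (pos-+ (l₀ ℕ.+ l₁) l₂) (cong (_+ + l₂) (pos-+ l₀ l₁))))))
    eq (hexagon x y z x≤z y≤z (subst (0 ℕ.<_) (sym eq) 0<N))
  third : l₀ ℕ.≤ l₂ × l₁ ℕ.≤ l₂ → Rounding
  third le = vertex (- + 1) (- + 1) l₀ l₁ l₂ le refl (l (+ l₀) (+ l₁) (+ l₂))
    where
    l : ∀ x y z → eis (y + z + (x + y + z) * - + 1) (z + (x + y + z) * - + 1) ≡ x * x + x * y + y * y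
    l = solve 3 (λ x y z → eisₑ (y ⊞ z ⊞ (x ⊞ y ⊞ z) ⊠ Κ (- + 1)) (z ⊞ (x ⊞ y ⊞ z) ⊠ Κ (- + 1)) ⊜ x ⊠ x ⊞ x ⊠ y ⊞ y ⊠ y) refl
  second : l₀ ℕ.≤ l₁ × l₂ ℕ.≤ l₁ → Rounding
  second le = vertex (- + 1) (+ 0) l₀ l₂ l₁ le (comm l₀ l₁ l₂) (l (+ l₀) (+ l₁) (+ l₂))
    where
    comm : ∀ x y z → x ℕ.+ z ℕ.+ y ≡ x ℕ.+ y ℕ.+ z
    comm = ℕ-Solver.solve-∀
    l : ∀ x y z → eis (y + z + (x + y + z) * - + 1) (z + (x + y + z) * + 0) ≡ x * x + x * z + z * z
    l = solve 3 (λ x y z → eisₑ (y ⊞ z ⊞ (x ⊞ y ⊞ z) ⊠ Κ (- + 1)) (z ⊞ (x ⊞ y ⊞ z) ⊠ Κ (+ 0)) ⊜ x ⊠ x ⊞ x ⊠ z ⊞ z ⊠ z) refl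
  first : l₁ ℕ.≤ l₀ × l₂ ℕ.≤ l₀ → Rounding
  first le = vertex (+ 0) (+ 0) l₁ l₂ l₀ le (comm l₀ l₁ l₂) (l (+ l₀) (+ l₁) (+ l₂))
    where
    comm : ∀ x y z → y ℕ.+ z ℕ.+ x ≡ x ℕ.+ y ℕ.+ z
    comm = ℕ-Solver.solve-∀
    l : ∀ x y z → eis (y + z + (x + y + z) * + 0) (z + (x + y + z) * + 0) ≡ y * y + y * z + z * z
    l = solve 3 (λ x y z → eisₑ (y ⊞ z ⊞ (x ⊞ y ⊞ z) ⊠ Κ (+ 0)) (z ⊞ (x ⊞ y ⊞ z) ⊠ Κ (+ 0)) ⊜ y ⊠ y ⊞ y ⊠ z ⊞ z ⊠ z) refl

multiple-of-abs : ∀ m → ∃ λ s → m * s ≡ + ℤ.∣ m ∣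
multiple-of-abs (+ n)      = + 1 , *-identityʳ (+ n)
multiple-of-abs -[1+ n ]   = - + 1 , trans (*-comm -[1+ n ] (- + 1)) (-1*i≡-i -[1+ n ])

residue : ∀ m .{{_ : ℤ.NonZero m}} x → ∃ λ a → ∃ λ u → x + m * a ≡ + u × u ℕ.< ℤ.∣ m ∣
residue m x = - (x ℤ./ m) , x ℤ.% m , trans (cong (_+ m * - (x ℤ./ m)) (a≡a%n+[a/n]*n x m)) (l (+ (x ℤ.% m)) (x ℤ./ m) m) , n%d<d x m
  where
  l : ∀ u q m → u + q * m + m * - q ≡ u
  l = solve-∀

eis-comm : ∀ x y → eis x y ≡ eis y x
eis-comm = solve 2 (λ x y → eisₑ x y ⊜ eisₑ y x) refl

module _ (m : ℤ) where
  EisSmall : ℤ → ℤ → Set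
  EisSmall x y = 2 ℕ.* ℤ.∣ eis x y ∣ ℕ.< ℤ.∣ m ∣ ℕ.* ℤ.∣ m ∣

  EisRounding : ℤ → ℤ → Set
  EisRounding x y = ∃₂ λ a b → EisSmall (x + m * a) (y + m * b)

  -- Residues 0 ≤ v ≤ u < |m| lie in the triangle of `hexagon-round`, with weights |m| - u, u - v
  -- and v. The other half of the parallelogram is reached by exchanging the coordinates.
  eis-round-≥ : ∀ x y a b u v → x + m * a ≡ + u → y + m * b ≡ + v → u ℕ.< ℤ.∣ m ∣ → v ℕ.≤ u → EisRounding x y
  eis-round-≥ x y a b u v eu ev u<m v≤u = a + s * i , b + s * j , subst₂ (λ P Q → 2 ℕ.* ℤ.∣ eis P Q ∣ ℕ.< ℤ.∣ m ∣ ℕ.* ℤ.∣ m ∣)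
      (trans (cong (λ P → + P + + ℤ.∣ m ∣ * i) (ℕ.m∸n+n≡m v≤u)) (moved x a u i eu)) (moved y b v j ev)
      (subst (λ M → 2 ℕ.* ℤ.∣ eis (+ ((u ℕ.∸ v) ℕ.+ v) + + M * i) (+ v + + M * j) ∣ ℕ.< M ℕ.* M) total (proj₂ (proj₂ rounded)))
    where
    total : (ℤ.∣ m ∣ ℕ.∸ u) ℕ.+ (u ℕ.∸ v) ℕ.+ v ≡ ℤ.∣ m ∣
    total = trans (ℕ.+-assoc (ℤ.∣ m ∣ ℕ.∸ u) (u ℕ.∸ v) v) (trans (cong ((ℤ.∣ m ∣ ℕ.∸ u) ℕ.+_) (ℕ.m∸n+n≡m v≤u)) (ℕ.m∸n+n≡m (ℕ.<⇒≤ u<m)))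
    rounded = hexagon-round (ℤ.∣ m ∣ ℕ.∸ u) (u ℕ.∸ v) v (subst (0 ℕ.<_) (sym total) (ℕ.≤-<-trans z≤n u<m))
    s i j : ℤ
    s = proj₁ (multiple-of-abs m)
    i = proj₁ rounded
    j = proj₁ (proj₂ rounded)
    l : ∀ x m a s i → x + m * a + m * s * i ≡ x + m * (a + s * i)
    l = solve-∀
    moved : ∀ x a u i → x + m * a ≡ + u → + u + + ℤ.∣ m ∣ * i ≡ x + m * (a + s * i)
    moved x a u i e = trans (cong₂ (λ P N → P + N * i) (sym e) (sym (proj₂ (multiple-of-abs m)))) (l x m a s i)

  eis-round : ∀ x y → 0 ℕ.< ℤ.∣ m ∣ → EisRounding x y
  eis-round x y 0<m = round (residue m x) (residue m y)
    where
    instance _ = ℕ.>-nonZero 0<m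
    round : (∃ λ a → ∃ λ u → x + m * a ≡ + u × u ℕ.< ℤ.∣ m ∣) → (∃ λ b → ∃ λ v → y + m * b ≡ + v × v ℕ.< ℤ.∣ m ∣) → EisRounding x y
    round (a , u , eu , u<m) (b , v , ev , v<m) with ℕ.≤-total v u
    ... | inj₁ v≤u = eis-round-≥ x y a b u v eu ev u<m v≤u
    ... | inj₂ u≤v = flip (eis-round-≥ y x b a v u ev eu v<m u≤v)
      where
      flip : EisRounding y x → EisRounding x y
      flip (b , a , lt) = a , b , subst (λ t → 2 ℕ.* ℤ.∣ t ∣ ℕ.< ℤ.∣ m ∣ ℕ.* ℤ.∣ m ∣) (eis-comm (y + m * b) (x + m * a)) lt

square-abs : ∀ x → x * x ≡ + (ℤ.∣ x ∣ ℕ.* ℤ.∣ x ∣)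
square-abs (+ n)    = sym (pos-* n n)
square-abs -[1+ n ] = refl

gauss-abs : ∀ x y → gauss x y ≡ + (ℤ.∣ x ∣ ℕ.* ℤ.∣ x ∣ ℕ.+ ℤ.∣ y ∣ ℕ.* ℤ.∣ y ∣)
gauss-abs x y = cong₂ _+_ (square-abs x) (square-abs y)

gauss≡0 : ∀ x y → gauss x y ≡ + 0 → x ≡ + 0 × y ≡ + 0
gauss≡0 x y e = zero-of x (ℕ.m+n≡0⇒m≡0 _ sum≡0) , zero-of y (ℕ.m+n≡0⇒n≡0 (ℤ.∣ x ∣ ℕ.* ℤ.∣ x ∣) sum≡0)
  where
  sum≡0 : ℤ.∣ x ∣ ℕ.* ℤ.∣ x ∣ ℕ.+ ℤ.∣ y ∣ ℕ.* ℤ.∣ y ∣ ≡ 0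
  sum≡0 = +-injective (trans (sym (gauss-abs x y)) e)
  zero-of : ∀ x → ℤ.∣ x ∣ ℕ.* ℤ.∣ x ∣ ≡ 0 → x ≡ + 0
  zero-of x e = ∣i∣≡0⇒i≡0 ([ (λ z → z) , (λ z → z) ]′ (ℕ.m*n≡0⇒m≡0∨n≡0 ℤ.∣ x ∣ e))

4eis : ∀ x y → + 4 * eis x y ≡ gauss (+ 2 * x + - y) y + + 2 * (y * y)
4eis = solve 2 (λ x y → Κ (+ 4) ⊠ eisₑ x y ⊜ gaussₑ (Κ (+ 2) ⊠ x ⊞ ⊟ y) y ⊞ Κ (+ 2) ⊠ (y ⊠ y)) refl

4eis-abs : ∀ x y → ∃ λ n → + 4 * eis x y ≡ + n × n ≡ ℤ.∣ + 2 * x + - y ∣ ℕ.* ℤ.∣ + 2 * x + - y ∣ ℕ.+ ℤ.∣ y ∣ ℕ.* ℤ.∣ y ∣ ℕ.+ 2 ℕ.* (ℤ.∣ y ∣ ℕ.* ℤ.∣ y ∣)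
4eis-abs x y = _ , trans (4eis x y) (trans (cong₂ _+_ (gauss-abs (+ 2 * x + - y) y) (trans (cong (+ 2 *_) (square-abs y)) (sym (pos-* 2 (ℤ.∣ y ∣ ℕ.* ℤ.∣ y ∣)))))
  (sym (pos-+ (ℤ.∣ + 2 * x + - y ∣ ℕ.* ℤ.∣ + 2 * x + - y ∣ ℕ.+ ℤ.∣ y ∣ ℕ.* ℤ.∣ y ∣) (2 ℕ.* (ℤ.∣ y ∣ ℕ.* ℤ.∣ y ∣))))) , refl

eis-abs : ∀ x y → eis x y ≡ + ℤ.∣ eis x y ∣
eis-abs x y = nonneg (eis x y) (proj₁ (4eis-abs x y)) (proj₁ (proj₂ (4eis-abs x y)))
  where
  nonneg : ∀ v n → + 4 * v ≡ + n → v ≡ + ℤ.∣ v ∣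
  nonneg (+ v)    n e = refl
  nonneg -[1+ v ] n ()

eis≡0 : ∀ x y → eis x y ≡ + 0 → x ≡ + 0 × y ≡ + 0
eis≡0 x y e = x≡0 , y≡0
  where
  sum≡0 : ℤ.∣ + 2 * x + - y ∣ ℕ.* ℤ.∣ + 2 * x + - y ∣ ℕ.+ ℤ.∣ y ∣ ℕ.* ℤ.∣ y ∣ ℕ.+ 2 ℕ.* (ℤ.∣ y ∣ ℕ.* ℤ.∣ y ∣) ≡ 0
  sum≡0 = trans (sym (proj₂ (proj₂ (4eis-abs x y)))) (+-injective (trans (sym (proj₁ (proj₂ (4eis-abs x y)))) (cong (+ 4 *_) e)))
  g≡0 : gauss (+ 2 * x + - y) y ≡ + 0
  g≡0 = trans (gauss-abs (+ 2 * x + - y) y) (cong +_ (ℕ.m+n≡0⇒m≡0 _ sum≡0))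
  y≡0 : y ≡ + 0
  y≡0 = proj₂ (gauss≡0 (+ 2 * x + - y) y g≡0)
  l : ∀ x y → + 2 * x ≡ (+ 2 * x + - y) + y
  l = solve-∀
  x≡0 : x ≡ + 0
  x≡0 = *-cancelˡ-≡ (+ 2) x (+ 0) (trans (l x y) (cong₂ _+_ (proj₁ (gauss≡0 (+ 2 * x + - y) y g≡0)) y≡0))

-- ℤ[ω], with a + bω represented by (a , b).
𝔼 : Set
𝔼 = ℤ × ℤ

infixl 6 _⊹_
infixl 7 _∙_
_⊹_ _∙_ : 𝔼 → 𝔼 → 𝔼
(a , b) ⊹ (c , d) = a + c , b + d
(a , b) ∙ (c , d) = a * c + - (b * d) , a * d + b * c + - (b * d)

neg conj : 𝔼 → 𝔼
neg (a , b) = - a , - b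
conj (a , b) = a + - b , - b

∥_∥ : 𝔼 → ℕ
∥ a , b ∥ = ℤ.∣ eis a b ∣

∥_∥ℤ : 𝔼 → ℤ
∥ a , b ∥ℤ = eis a b

𝔼-isCommutativeRing : IsCommutativeRing _≡_ _⊹_ _∙_ neg (+ 0 , + 0) (+ 1 , + 0)
𝔼-isCommutativeRing = record
  { isRing = record
    { +-isAbelianGroup = record
      { isGroup = record
        { isMonoid = record
          { isSemigroup = record
            { isMagma = record { isEquivalence = isEquivalence ; ∙-cong = cong₂ _⊹_ }
            ; assoc = λ { (a , b) (c , d) (e , f) → cong₂ _,_ (+-assoc a c e) (+-assoc b d f) } }
          ; identity = (λ { (a , b) → cong₂ _,_ (+-identityˡ a) (+-identityˡ b) }) , (λ { (a , b) → cong₂ _,_ (+-identityʳ a) (+-identityʳ b) }) }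
        ; inverse = (λ { (a , b) → cong₂ _,_ (+-inverseˡ a) (+-inverseˡ b) }) , (λ { (a , b) → cong₂ _,_ (+-inverseʳ a) (+-inverseʳ b) })
        ; ⁻¹-cong = cong neg }
      ; comm = λ { (a , b) (c , d) → cong₂ _,_ (+-comm a c) (+-comm b d) } }
    ; *-cong = cong₂ _∙_
    ; *-assoc = λ { (a , b) (c , d) (e , f) → cong₂ _,_ (assoc₁ a b c d e f) (assoc₂ a b c d e f) }
    ; *-identity = (λ { (a , b) → cong₂ _,_ (idˡ₁ a b) (idˡ₂ a b) }) , (λ { (a , b) → cong₂ _,_ (idʳ₁ a b) (idʳ₂ a b) })
    ; distrib = (λ { (a , b) (c , d) (e , f) → cong₂ _,_ (distˡ₁ a b c d e f) (distˡ₂ a b c d e f) })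
      , (λ { (a , b) (c , d) (e , f) → cong₂ _,_ (distʳ₁ a b c d e f) (distʳ₂ a b c d e f) }) }
  ; *-comm = λ { (a , b) (c , d) → cong₂ _,_ (comm₁ a b c d) (comm₂ a b c d) }
  }
  where
  assoc₁ : ∀ a b c d e f → (a * c + - (b * d)) * e + - ((a * d + b * c + - (b * d)) * f) ≡ a * (c * e + - (d * f)) + - (b * (c * f + d * e + - (d * f)))
  assoc₁ = solve-∀
  assoc₂ : ∀ a b c d e f → (a * c + - (b * d)) * f + (a * d + b * c + - (b * d)) * e + - ((a * d + b * c + - (b * d)) * f)
    ≡ a * (c * f + d * e + - (d * f)) + b * (c * e + - (d * f)) + - (b * (c * f + d * e + - (d * f)))
  assoc₂ = solve-∀
  idˡ₁ : ∀ a b → + 1 * a + - (+ 0 * b) ≡ a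
  idˡ₁ = solve-∀
  idˡ₂ : ∀ a b → + 1 * b + + 0 * a + - (+ 0 * b) ≡ b
  idˡ₂ = solve-∀
  idʳ₁ : ∀ a b → a * + 1 + - (b * + 0) ≡ a
  idʳ₁ = solve-∀
  idʳ₂ : ∀ a b → a * + 0 + b * + 1 + - (b * + 0) ≡ b
  idʳ₂ = solve-∀
  distˡ₁ : ∀ a b c d e f → a * (c + e) + - (b * (d + f)) ≡ a * c + - (b * d) + (a * e + - (b * f))
  distˡ₁ = solve-∀
  distˡ₂ : ∀ a b c d e f → a * (d + f) + b * (c + e) + - (b * (d + f)) ≡ a * d + b * c + - (b * d) + (a * f + b * e + - (b * f))
  distˡ₂ = solve-∀
  distʳ₁ : ∀ a b c d e f → (c + e) * a + - ((d + f) * b) ≡ c * a + - (d * b) + (e * a + - (f * b))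
  distʳ₁ = solve-∀
  distʳ₂ : ∀ a b c d e f → (c + e) * b + (d + f) * a + - ((d + f) * b) ≡ c * b + d * a + - (d * b) + (e * b + f * a + - (f * b))
  distʳ₂ = solve-∀
  comm₁ : ∀ a b c d → a * c + - (b * d) ≡ c * a + - (d * b)
  comm₁ = solve-∀
  comm₂ : ∀ a b c d → a * d + b * c + - (b * d) ≡ c * b + d * a + - (d * b)
  comm₂ = solve-∀

𝔼-ring : CommutativeRing 0ℓ 0ℓ
𝔼-ring = record { isCommutativeRing = 𝔼-isCommutativeRing }

𝔼-almostCommutativeRing : ACR.AlmostCommutativeRing 0ℓ 0ℓ
𝔼-almostCommutativeRing = ACR.fromCommutativeRing 𝔼-ring λ { (+ 0 , + 0) → just refl ; _ → nothing }

module 𝔼-Solver = RingSolver 𝔼-almostCommutativeRing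

𝔼-identities : Identities _⊹_ _∙_ neg
𝔼-identities = record
  { shift-form = 𝔼-Solver.solve 6 shift-formₑ refl ; factor = 𝔼-Solver.solve 4 factorₑ refl ; next-form = 𝔼-Solver.solve 6 next-formₑ refl
  ; next-quotient = 𝔼-Solver.solve 7 next-quotientₑ refl ; unshift = 𝔼-Solver.solve 3 unshiftₑ refl ; multiple-form = 𝔼-Solver.solve 4 multiple-formₑ refl }

eis-mul : ∀ a b c d → eis (a * c + - (b * d)) (a * d + b * c + - (b * d)) ≡ eis a b * eis c d
eis-mul = solve 4 (λ a b c d → eisₑ (a ⊠ c ⊞ ⊟ (b ⊠ d)) (a ⊠ d ⊞ b ⊠ c ⊞ ⊟ (b ⊠ d)) ⊜ eisₑ a b ⊠ eisₑ c d) refl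

∥∙∥ : ∀ x y → ∥ x ∙ y ∥ ≡ ∥ x ∥ ℕ.* ∥ y ∥
∥∙∥ (a , b) (c , d) = trans (cong ℤ.∣_∣ (eis-mul a b c d)) (abs-* (eis a b) (eis c d))

squares<4squares : ∀ X Y n → 0 ℕ.< n → 2 ℕ.* X ℕ.≤ n → 2 ℕ.* Y ℕ.≤ n → X ℕ.* X ℕ.+ Y ℕ.* Y ℕ.< n ℕ.* n
squares<4squares X Y n@(suc _) 0<n 2X≤n 2Y≤n = ℕ.*-cancelˡ-< 4 _ _ (begin-strict
    4 ℕ.* (X ℕ.* X ℕ.+ Y ℕ.* Y)                              ≡⟨ l X Y ⟩
    (2 ℕ.* X) ℕ.* (2 ℕ.* X) ℕ.+ (2 ℕ.* Y) ℕ.* (2 ℕ.* Y)      ≤⟨ ℕ.+-mono-≤ (ℕ.*-mono-≤ 2X≤n 2X≤n) (ℕ.*-mono-≤ 2Y≤n 2Y≤n) ⟩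
    n ℕ.* n ℕ.+ n ℕ.* n                                      <⟨ ℕ.m<m+n _ (s≤s z≤n) ⟩
    n ℕ.* n ℕ.+ n ℕ.* n ℕ.+ 2 ℕ.* (n ℕ.* n)                  ≡⟨ l′ n ⟩
    4 ℕ.* (n ℕ.* n) ∎)
  where
  open ℕ.≤-Reasoning
  l : ∀ X Y → 4 ℕ.* (X ℕ.* X ℕ.+ Y ℕ.* Y) ≡ (2 ℕ.* X) ℕ.* (2 ℕ.* X) ℕ.+ (2 ℕ.* Y) ℕ.* (2 ℕ.* Y)
  l = ℕ-Solver.solve-∀
  l′ : ∀ n → n ℕ.* n ℕ.+ n ℕ.* n ℕ.+ 2 ℕ.* (n ℕ.* n) ≡ 4 ℕ.* (n ℕ.* n)
  l′ = ℕ-Solver.solve-∀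

balanced-residue : ∀ m x → 0 ℕ.< ℤ.∣ m ∣ → ∃ λ a → 2 ℕ.* ℤ.∣ x + m * a ∣ ℕ.≤ ℤ.∣ m ∣
balanced-residue m x 0<m = balance (residue m x)
  where
  instance _ = ℕ.>-nonZero 0<m
  s : ℤ
  s = proj₁ (multiple-of-abs m)
  double : ∀ n → n ℕ.+ n ≡ 2 ℕ.* n
  double = ℕ-Solver.solve-∀
  balance : (∃ λ a → ∃ λ u → x + m * a ≡ + u × u ℕ.< ℤ.∣ m ∣) → ∃ λ a → 2 ℕ.* ℤ.∣ x + m * a ∣ ℕ.≤ ℤ.∣ m ∣
  balance (a , u , e , u<m) with ℕ.≤-total (2 ℕ.* u) ℤ.∣ m ∣
  ... | inj₁ le = a , subst (λ t → 2 ℕ.* ℤ.∣ t ∣ ℕ.≤ ℤ.∣ m ∣) (sym e) le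
  ... | inj₂ ge = a + - s , subst (λ t → 2 ℕ.* t ℕ.≤ ℤ.∣ m ∣) (sym abs) (ℕ.≤-trans (ℕ.≤-reflexive (ℕ.*-distribˡ-∸ 2 ℤ.∣ m ∣ u))
      (ℕ.≤-trans (ℕ.∸-monoʳ-≤ (2 ℕ.* ℤ.∣ m ∣) ge) (ℕ.≤-reflexive (trans (cong (ℕ._∸ ℤ.∣ m ∣) (sym (double ℤ.∣ m ∣))) (ℕ.m+n∸n≡m ℤ.∣ m ∣ ℤ.∣ m ∣)))))
    where
    l : ∀ x m a s → x + m * (a + - s) ≡ (x + m * a) + - (m * s)
    l = solve-∀
    abs : ℤ.∣ x + m * (a + - s) ∣ ≡ ℤ.∣ m ∣ ℕ.∸ u
    abs = trans (cong ℤ.∣_∣ (trans (l x m a s) (cong₂ (λ P Q → P + - Q) e (proj₂ (multiple-of-abs m)))))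
      (trans (cong ℤ.∣_∣ (m-n≡m⊖n u ℤ.∣ m ∣)) (trans (∣m⊖n∣≡∣n⊖m∣ u ℤ.∣ m ∣) (cong ℤ.∣_∣ (⊖-≥ (ℕ.<⇒≤ u<m)))))

gauss-reduce : ∀ m x y → 0 ℕ.< ℤ.∣ m ∣ → ∃₂ λ a b → ℤ.∣ gauss (x + m * a) (y + m * b) ∣ ℕ.< ℤ.∣ m ∣ ℕ.* ℤ.∣ m ∣
gauss-reduce m x y 0<m = proj₁ rx , proj₁ ry , subst (λ t → ℤ.∣ t ∣ ℕ.< ℤ.∣ m ∣ ℕ.* ℤ.∣ m ∣) (sym (gauss-abs (x + m * proj₁ rx) (y + m * proj₁ ry)))
    (squares<4squares ℤ.∣ x + m * proj₁ rx ∣ ℤ.∣ y + m * proj₁ ry ∣ ℤ.∣ m ∣ 0<m (proj₂ rx) (proj₂ ry))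
  where
  rx = balanced-residue m x 0<m
  ry = balanced-residue m y 0<m

module Gauss = Descent +-*-isCommutativeRing ℤ-identities (+ 0) ℤ.∣_∣ abs-*
module Eis = Descent +-*-isCommutativeRing ℤ-identities (- + 1) ℤ.∣_∣ abs-*
module GaussEis = Descent 𝔼-isCommutativeRing 𝔼-identities (+ 0 , + 0) ∥_∥ ∥∙∥

gauss-form : ∀ x y → (x * x + + 0 * (x * y)) + y * y ≡ gauss x y
gauss-form = solve 2 (λ x y → (x ⊠ x ⊞ Κ (+ 0) ⊠ (x ⊠ y)) ⊞ y ⊠ y ⊜ gaussₑ x y) refl

eis-form : ∀ x y → (x * x + - + 1 * (x * y)) + y * y ≡ eis x y
eis-form = solve 2 (λ x y → (x ⊠ x ⊞ Κ (- + 1) ⊠ (x ⊠ y)) ⊞ y ⊠ y ⊜ eisₑ x y) refl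

multiple⇒∣ : ∀ {p x} → (∃ λ a → x ≡ + p * a) → + p ∣ₛ x
multiple⇒∣ {p} (a , e) = divides a (trans e (*-comm (+ p) a))

gauss-represents : ∀ {p} → Prime p → ∀ x y → + p ∣ₛ gauss x y → ¬ (+ p ∣ₛ x × + p ∣ₛ y) → ∃₂ λ s t → gauss s t ≡ + p
gauss-represents {p} pp x y (divides w e) ∤ = s , t , trans (gauss-abs s t) (cong +_ (trans (cong ℤ.∣_∣ (sym (gauss-abs s t))) (trans (cong ℤ.∣_∣ (sym (gauss-form s t))) (proj₂ (proj₂ rep)))))
  where
  rep : ∃₂ λ s t → ℤ.∣ (s * s + + 0 * (s * t)) + t * t ∣ ≡ p
  rep = Gauss.represent (λ x → ∣i∣≡0⇒i≡0) (λ x y e → gauss≡0 x y (trans (sym (gauss-form x y)) e))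
    (λ m x y 0<m → let a , b , lt = gauss-reduce m x y 0<m in a , b , subst (λ t → ℤ.∣ t ∣ ℕ.< ℤ.∣ m ∣ ℕ.* ℤ.∣ m ∣) (sym (gauss-form (x + m * a) (y + m * b))) lt)
    pp (+ p) refl w x y (trans (gauss-form x y) (trans e (*-comm w (+ p)))) (λ { (dx , dy) → ∤ (multiple⇒∣ dx , multiple⇒∣ dy) })
  s t : ℤ
  s = proj₁ rep
  t = proj₁ (proj₂ rep)

eis-reduce : ∀ m x y → 0 ℕ.< ℤ.∣ m ∣ → ∃₂ λ a b → ℤ.∣ eis (x + m * a) (y + m * b) ∣ ℕ.< ℤ.∣ m ∣ ℕ.* ℤ.∣ m ∣
eis-reduce m x y 0<m = proj₁ r , proj₁ (proj₂ r) , ℕ.≤-<-trans (ℕ.m≤n*m _ 2) (proj₂ (proj₂ r))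
  where
  r : EisRounding m x y
  r = eis-round m x y 0<m

eis-represents : ∀ {p} → Prime p → ∀ x y → + p ∣ₛ eis x y → ¬ (+ p ∣ₛ x × + p ∣ₛ y) → ∃₂ λ s t → eis s t ≡ + p
eis-represents {p} pp x y (divides w e) ∤ = s , t , trans (eis-abs s t) (cong +_ (trans (cong ℤ.∣_∣ (sym (eis-form s t))) (proj₂ (proj₂ rep))))
  where
  rep : ∃₂ λ s t → ℤ.∣ (s * s + - + 1 * (s * t)) + t * t ∣ ≡ p
  rep = Eis.represent (λ x → ∣i∣≡0⇒i≡0) (λ x y e → eis≡0 x y (trans (sym (eis-form x y)) e))
    (λ m x y 0<m → let a , b , lt = eis-reduce m x y 0<m in a , b , subst (λ t → ℤ.∣ t ∣ ℕ.< ℤ.∣ m ∣ ℕ.* ℤ.∣ m ∣) (sym (eis-form (x + m * a) (y + m * b))) lt)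
    pp (+ p) refl w x y (trans (eis-form x y) (trans e (*-comm w (+ p)))) (λ { (dx , dy) → ∤ (multiple⇒∣ dx , multiple⇒∣ dy) })
  s t : ℤ
  s = proj₁ rep
  t = proj₁ (proj₂ rep)

-- Needed for the anisotropy of X² + Y² over ℤ[ω]: at a zero, `norm₁₂-defect` makes (∥ X ∥ + ∥ Y ∥)²
-- three times a square. The proof is infinite descent by the factor 3.
√3-irrational : ∀ a k → a ℕ.* a ≡ 3 ℕ.* (k ℕ.* k) → a ≡ 0
√3-irrational a k = go a k (<-wellFounded a)
  where
  root : ∀ a n → a ℕ.* a ≡ 3 ℕ.* n → ∃ λ b → a ≡ 3 ℕ.* b
  root a n e = root′ ([ (λ z → z) , (λ z → z) ]′ (euclidsLemma a a prime[3] (ℕ.divides n (trans e (ℕ.*-comm 3 n)))))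
    where
    root′ : 3 ℕ.∣ a → ∃ λ b → a ≡ 3 ℕ.* b
    root′ (ℕ.divides b eq) = b , trans eq (ℕ.*-comm b 3)
  third : ∀ a n b → a ℕ.* a ≡ 3 ℕ.* n → a ≡ 3 ℕ.* b → n ≡ 3 ℕ.* (b ℕ.* b)
  third a n b e eq = ℕ.*-cancelˡ-≡ n _ 3 (trans (sym e) (trans (cong₂ ℕ._*_ eq eq) (l b)))
    where
    l : ∀ b → (3 ℕ.* b) ℕ.* (3 ℕ.* b) ≡ 3 ℕ.* (3 ℕ.* (b ℕ.* b))
    l = ℕ-Solver.solve-∀
  go : ∀ a k → Acc ℕ._<_ a → a ℕ.* a ≡ 3 ℕ.* (k ℕ.* k) → a ≡ 0
  descent : ∀ a b k → Acc ℕ._<_ a → a ≡ 3 ℕ.* b → b ℕ.* b ≡ 3 ℕ.* (k ℕ.* k) → a ≡ 0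
  go a k ac e = descent a b j ac a≡3b (third k (b ℕ.* b) j k²≡3b² k≡3j)
    where
    b = proj₁ (root a (k ℕ.* k) e)
    a≡3b = proj₂ (root a (k ℕ.* k) e)
    k²≡3b² = third a (k ℕ.* k) b e a≡3b
    j = proj₁ (root k (b ℕ.* b) k²≡3b²)
    k≡3j = proj₂ (root k (b ℕ.* b) k²≡3b²)
  descent a zero    k _         eq e = eq
  descent a (suc b) k (acc rec) eq e = ⊥-elim (ℕ.1+n≢0 (go (suc b) k (rec (subst (suc b ℕ.<_) (trans (ℕ.*-comm (suc b) 3) (sym eq)) (ℕ.m<m*n (suc b) 3 (s≤s (s≤s z≤n))))) e))

private
  sumOfSquares : 𝔼 → 𝔼 → 𝔼
  sumOfSquares X Y = X ∙ X ⊹ Y ∙ Y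

  form-sumOfSquares : ∀ X Y → GaussEis.form X Y ≡ sumOfSquares X Y
  form-sumOfSquares = 𝔼-Solver.solve 2 (λ X Y → (X ⊠ X ⊞ Κ (+ 0 , + 0) ⊠ (X ⊠ Y) ⊞ Y ⊠ Y) , (X ⊠ X ⊞ Y ⊠ Y)) refl

  ∥sumOfSquares∥ : ∀ a b c d → eis (a * a + - (b * b) + (c * c + - (d * d))) (a * b + b * a + - (b * b) + (c * d + d * c + - (d * d))) ≡ norm₁₂ a b c d
  ∥sumOfSquares∥ = solve 4 (λ a b c d →
    eisₑ (a ⊠ a ⊞ ⊟ (b ⊠ b) ⊞ (c ⊠ c ⊞ ⊟ (d ⊠ d))) (a ⊠ b ⊞ b ⊠ a ⊞ ⊟ (b ⊠ b) ⊞ (c ⊠ d ⊞ d ⊠ c ⊞ ⊟ (d ⊠ d))) ⊜ norm₁₂ₑ a b c d) refl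

form-norm₁₂ : ∀ a b c d → ∥ GaussEis.form (a , b) (c , d) ∥ℤ ≡ norm₁₂ a b c d
form-norm₁₂ a b c d = trans (cong ∥_∥ℤ (form-sumOfSquares (a , b) (c , d))) (∥sumOfSquares∥ a b c d)

-- |X|² + |Y|² dominates |X² + Y²|, the defect being the square of 2 Im (X Ȳ).
norm₁₂-defect : ∀ a b c d → (eis a b + eis c d) * (eis a b + eis c d) ≡ norm₁₂ a b c d + + 3 * ((a * d + - (b * c)) * (a * d + - (b * c)))
norm₁₂-defect = solve 4 (λ a b c d → (eisₑ a b ⊞ eisₑ c d) ⊠ (eisₑ a b ⊞ eisₑ c d)
  ⊜ norm₁₂ₑ a b c d ⊞ Κ (+ 3) ⊠ ((a ⊠ d ⊞ ⊟ (b ⊠ c)) ⊠ (a ⊠ d ⊞ ⊟ (b ⊠ c)))) refl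

norm₁₂-abs : ∀ a b c d → norm₁₂ a b c d ≡ + ℤ.∣ norm₁₂ a b c d ∣
norm₁₂-abs a b c d = trans g (cong +_ (cong ℤ.∣_∣ (sym g)))
  where
  g = gauss-abs (re₁₂ a b c d) (tr a b c d)

norm₁₂-defect-ℕ : ∀ a b c d → (∥ a , b ∥ ℕ.+ ∥ c , d ∥) ℕ.* (∥ a , b ∥ ℕ.+ ∥ c , d ∥)
  ≡ ℤ.∣ norm₁₂ a b c d ∣ ℕ.+ 3 ℕ.* (ℤ.∣ a * d + - (b * c) ∣ ℕ.* ℤ.∣ a * d + - (b * c) ∣)
norm₁₂-defect-ℕ a b c d = +-injective (begin
    + ((A ℕ.+ B) ℕ.* (A ℕ.+ B))        ≡⟨ pos-* (A ℕ.+ B) (A ℕ.+ B) ⟩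
    + (A ℕ.+ B) * + (A ℕ.+ B)          ≡⟨ cong (λ t → t * t) (pos-+ A B) ⟩
    (+ A + + B) * (+ A + + B)          ≡⟨ cong₂ (λ s t → (s + t) * (s + t)) (eis-abs a b) (eis-abs c d) ⟨
    (eis a b + eis c d) * (eis a b + eis c d) ≡⟨ norm₁₂-defect a b c d ⟩
    norm₁₂ a b c d + + 3 * (k * k)     ≡⟨ cong₂ (λ s t → s + + 3 * t) (norm₁₂-abs a b c d) (square-abs k) ⟩
    + N + + 3 * + K                    ≡⟨ cong (λ t → + N + t) (pos-* 3 K) ⟨
    + N + + (3 ℕ.* K)                  ≡⟨ pos-+ N (3 ℕ.* K) ⟨
    + (N ℕ.+ 3 ℕ.* K)                  ∎)
  where
  open ≡-Reasoning
  k : ℤ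
  k = a * d + - (b * c)
  A B N K : ℕ
  A = ∥ a , b ∥
  B = ∥ c , d ∥
  N = ℤ.∣ norm₁₂ a b c d ∣
  K = ℤ.∣ k ∣ ℕ.* ℤ.∣ k ∣

norm₁₂≡0 : ∀ a b c d → norm₁₂ a b c d ≡ + 0 → ∥ a , b ∥ ≡ 0 × ∥ c , d ∥ ≡ 0
norm₁₂≡0 a b c d e = ℕ.m+n≡0⇒m≡0 _ sum≡0 , ℕ.m+n≡0⇒n≡0 ∥ a , b ∥ sum≡0
  where
  sum≡0 : ∥ a , b ∥ ℕ.+ ∥ c , d ∥ ≡ 0
  sum≡0 = √3-irrational _ ℤ.∣ a * d + - (b * c) ∣ (trans (norm₁₂-defect-ℕ a b c d) (cong (ℕ._+ 3 ℕ.* (ℤ.∣ a * d + - (b * c) ∣ ℕ.* ℤ.∣ a * d + - (b * c) ∣)) (cong ℤ.∣_∣ e)))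

𝔼-definite : ∀ X → ∥ X ∥ ≡ 0 → X ≡ (+ 0 , + 0)
𝔼-definite (a , b) e = cong₂ _,_ (proj₁ zeros) (proj₂ zeros)
  where
  zeros : a ≡ + 0 × b ≡ + 0
  zeros = eis≡0 a b (∣i∣≡0⇒i≡0 e)

𝔼-anisotropic : ∀ X Y → GaussEis.form X Y ≡ (+ 0 , + 0) → X ≡ (+ 0 , + 0) × Y ≡ (+ 0 , + 0)
𝔼-anisotropic (a , b) (c , d) e = 𝔼-definite (a , b) (proj₁ zeros) , 𝔼-definite (c , d) (proj₂ zeros)
  where
  zeros : ∥ a , b ∥ ≡ 0 × ∥ c , d ∥ ≡ 0
  zeros = norm₁₂≡0 a b c d (trans (sym (form-norm₁₂ a b c d)) (cong ∥_∥ℤ e))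

conj-∙ : ∀ m x a → conj m ∙ (x ⊹ m ∙ a) ≡ (proj₁ (conj m ∙ x) + ∥ m ∥ℤ * proj₁ a , proj₂ (conj m ∙ x) + ∥ m ∥ℤ * proj₂ a)
conj-∙ (m₀ , m₁) (x₀ , x₁) (a₀ , a₁) = cong₂ _,_ (l₁ m₀ m₁ x₀ x₁ a₀ a₁) (l₂ m₀ m₁ x₀ x₁ a₀ a₁)
  where
  l₁ : ∀ m₀ m₁ x₀ x₁ a₀ a₁ → (m₀ + - m₁) * (x₀ + (m₀ * a₀ + - (m₁ * a₁))) + - (- m₁ * (x₁ + (m₀ * a₁ + m₁ * a₀ + - (m₁ * a₁))))
    ≡ ((m₀ + - m₁) * x₀ + - (- m₁ * x₁)) + (m₀ * m₀ + - (m₀ * m₁) + m₁ * m₁) * a₀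
  l₁ = solve-∀
  l₂ : ∀ m₀ m₁ x₀ x₁ a₀ a₁ → (m₀ + - m₁) * (x₁ + (m₀ * a₁ + m₁ * a₀ + - (m₁ * a₁))) + - m₁ * (x₀ + (m₀ * a₀ + - (m₁ * a₁))) + - (- m₁ * (x₁ + (m₀ * a₁ + m₁ * a₀ + - (m₁ * a₁))))
    ≡ ((m₀ + - m₁) * x₁ + - m₁ * x₀ + - (- m₁ * x₁)) + (m₀ * m₀ + - (m₀ * m₁) + m₁ * m₁) * a₁
  l₂ = solve-∀

∥conj∥ : ∀ m → ∥ conj m ∥ ≡ ∥ m ∥
∥conj∥ (a , b) = cong ℤ.∣_∣ (l a b)
  where
  l : ∀ a b → (a + - b) * (a + - b) + - ((a + - b) * - b) + - b * - b ≡ a * a + - (a * b) + b * b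
  l = solve-∀

-- Multiplication by `conj m` replaces the modulus `m` by the integer ∥ m ∥, for which coordinates
-- are rounded in ℤ; the factor ∥ m ∥ is then cancelled from the bound.
𝔼-round : ∀ m x → 0 ℕ.< ∥ m ∥ → ∃ λ a → 2 ℕ.* ∥ x ⊹ m ∙ a ∥ ℕ.< ∥ m ∥
𝔼-round m x 0<m = a , ℕ.*-cancelˡ-< ∥ m ∥ _ _ (subst (ℕ._< ∥ m ∥ ℕ.* ∥ m ∥) eq (proj₂ (proj₂ r)))
  where
  r : EisRounding (+ ∥ m ∥) (proj₁ (conj m ∙ x)) (proj₂ (conj m ∙ x))
  r = eis-round (+ ∥ m ∥) (proj₁ (conj m ∙ x)) (proj₂ (conj m ∙ x)) 0<m
  a : 𝔼
  a = proj₁ r , proj₁ (proj₂ r)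
  l : ∀ x y → 2 ℕ.* (x ℕ.* y) ≡ x ℕ.* (2 ℕ.* y)
  l = ℕ-Solver.solve-∀
  eq : 2 ℕ.* ∥ proj₁ (conj m ∙ x) + + ∥ m ∥ * proj₁ a , proj₂ (conj m ∙ x) + + ∥ m ∥ * proj₂ a ∥ ≡ ∥ m ∥ ℕ.* (2 ℕ.* ∥ x ⊹ m ∙ a ∥)
  eq = begin
    2 ℕ.* ∥ proj₁ (conj m ∙ x) + + ∥ m ∥ * proj₁ a , proj₂ (conj m ∙ x) + + ∥ m ∥ * proj₂ a ∥
      ≡⟨ cong (λ n → 2 ℕ.* ∥ proj₁ (conj m ∙ x) + n * proj₁ a , proj₂ (conj m ∙ x) + n * proj₂ a ∥) (eis-abs (proj₁ m) (proj₂ m)) ⟨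
    2 ℕ.* ∥ proj₁ (conj m ∙ x) + ∥ m ∥ℤ * proj₁ a , proj₂ (conj m ∙ x) + ∥ m ∥ℤ * proj₂ a ∥
      ≡⟨ cong (λ z → 2 ℕ.* ∥ z ∥) (conj-∙ m x a) ⟨
    2 ℕ.* ∥ conj m ∙ (x ⊹ m ∙ a) ∥
      ≡⟨ cong (2 ℕ.*_) (trans (∥∙∥ (conj m) (x ⊹ m ∙ a)) (cong (ℕ._* ∥ x ⊹ m ∙ a ∥) (∥conj∥ m))) ⟩
    2 ℕ.* (∥ m ∥ ℕ.* ∥ x ⊹ m ∙ a ∥)
      ≡⟨ l ∥ m ∥ ∥ x ⊹ m ∙ a ∥ ⟩
    ∥ m ∥ ℕ.* (2 ℕ.* ∥ x ⊹ m ∙ a ∥) ∎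
    where open ≡-Reasoning

∥form∥≤ : ∀ X Y → ∥ GaussEis.form X Y ∥ ℕ.≤ (∥ X ∥ ℕ.+ ∥ Y ∥) ℕ.* (∥ X ∥ ℕ.+ ∥ Y ∥)
∥form∥≤ (a , b) (c , d) = subst₂ ℕ._≤_ (cong ℤ.∣_∣ (sym (form-norm₁₂ a b c d))) (sym (norm₁₂-defect-ℕ a b c d)) (ℕ.m≤m+n _ _)

𝔼-reduce : ∀ m x y → 0 ℕ.< ∥ m ∥ → ∃₂ λ a b → ∥ GaussEis.form (x ⊹ m ∙ a) (y ⊹ m ∙ b) ∥ ℕ.< ∥ m ∥ ℕ.* ∥ m ∥
𝔼-reduce m x y 0<m = a , b , ℕ.≤-<-trans (∥form∥≤ (x ⊹ m ∙ a) (y ⊹ m ∙ b)) (ℕ.*-mono-< small small)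
  where
  a b : 𝔼
  a = proj₁ (𝔼-round m x 0<m)
  b = proj₁ (𝔼-round m y 0<m)
  X Y : ℕ
  X = ∥ x ⊹ m ∙ a ∥
  Y = ∥ y ⊹ m ∙ b ∥
  double : ∀ n → n ℕ.+ n ≡ 2 ℕ.* n
  double = ℕ-Solver.solve-∀
  small : X ℕ.+ Y ℕ.< ∥ m ∥
  small = ℕ.*-cancelˡ-< 2 _ _ (subst₂ ℕ._<_ (sym (ℕ.*-distribˡ-+ 2 X Y)) (double ∥ m ∥)
    (ℕ.+-mono-< (proj₂ (𝔼-round m x 0<m)) (proj₂ (𝔼-round m y 0<m))))

-- Primes as norms from ℤ[i], ℤ[ω] and ℤ[i, ω]

≡1-mod-12 : ∀ p → p % 12 ≡ 1 → p % 4 ≡ 1 × p % 3 ≡ 1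
≡1-mod-12 p r = trans (sym (ℕ.m∣n⇒o%n%m≡o%m 4 12 p (ℕ.divides 3 refl))) (cong (_% 4) r)
  , trans (sym (ℕ.m∣n⇒o%n%m≡o%m 3 12 p (ℕ.divides 4 refl))) (cong (_% 3) r)

private
  not-unit : ∀ {p} → Prime p → ∀ {n} → + p ∣ₛ n → ℤ.∣ n ∣ ≢ 1
  not-unit {p} pp d e = ℕ.<-irrefl refl (subst (1 ℕ.<_) (ℕ.∣1⇒≡1 (subst (p ℕ.∣_) e (∣⇒∣ᵤ d)))
    (ℕ.nonTrivial⇒n>1 p {{prime⇒nonTrivial pp}}))

  form-root : ∀ r → GaussEis.form (r , + 0) (+ 1 , + 0) ≡ (r * r + + 1 , + 0)
  form-root r = trans (form-sumOfSquares (r , + 0) (+ 1 , + 0)) (cong₂ _,_ (l r) (l′ r))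
    where
    l : ∀ r → r * r + - (+ 0 * + 0) + + 1 ≡ r * r + + 1
    l = solve-∀
    l′ : ∀ r → r * + 0 + + 0 * r + - (+ 0 * + 0) + + 0 ≡ + 0
    l′ = solve-∀

  norm-multiple : ∀ s t q → (q * eis s t , + 0) ≡ (s , t) ∙ (q * (s + - t) , q * - t)
  norm-multiple s t q = cong₂ _,_ (l s t q) (l′ s t q)
    where
    l : ∀ s t q → q * (s * s + - (s * t) + t * t) ≡ s * (q * (s + - t)) + - (t * (q * - t))
    l = solve-∀
    l′ : ∀ s t q → + 0 ≡ s * (q * - t) + t * (q * (s + - t)) + - (t * (q * - t))
    l′ = solve-∀

  represented : ∀ {p} → (∃₂ λ X Y → ∥ GaussEis.form X Y ∥ ≡ p) → ∃ λ a → ∃ λ b → ∃ λ c → ∃ λ d → norm₁₂ a b c d ≡ + p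
  represented ((a , b) , (c , d) , e) = a , b , c , d , trans (norm₁₂-abs a b c d) (cong +_ (trans (cong ℤ.∣_∣ (sym (form-norm₁₂ a b c d))) e))

  -- The descent runs over a prime π = s + tω above p, which divides r² + 1.
  represent-over : ∀ {p} → Prime p → (∃₂ λ s t → eis s t ≡ + p) → (∃ λ r → + p ∣ₛ r * r + + 1) →
    ∃₂ λ X Y → ∥ GaussEis.form X Y ∥ ≡ p
  represent-over {p} pp (s , t , e) (r , divides q d) =
      GaussEis.represent 𝔼-definite 𝔼-anisotropic 𝔼-reduce pp (s , t) (cong ℤ.∣_∣ e) (q * (s + - t) , q * - t) (r , + 0) (+ 1 , + 0) eq ∤1
    where
    eq : GaussEis.form (r , + 0) (+ 1 , + 0) ≡ (s , t) ∙ (q * (s + - t) , q * - t)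
    eq = trans (form-root r) (trans (cong (_, + 0) (trans d (cong (q *_) (sym e)))) (norm-multiple s t q))
    p*n≡1 : ∀ n → 1 ≢ n ℕ.* p
    p*n≡1 n e = not-unit pp {+ 1} (∣ᵤ⇒∣ (ℕ.divides n e)) refl
    ∤1 : ¬ ((∃ λ z → (r , + 0) ≡ (s , t) ∙ z) × (∃ λ z → (+ 1 , + 0) ≡ (s , t) ∙ z))
    ∤1 (_ , (z , ez)) = p*n≡1 ∥ z ∥ (trans (cong ∥_∥ ez) (trans (∥∙∥ (s , t) z) (trans (cong (ℕ._* ∥ z ∥) (cong ℤ.∣_∣ e)) (ℕ.*-comm p ∥ z ∥))))

eis-represents-1-mod-3 : ∀ {p} → Prime p → p % 3 ≡ 1 → ∃₂ λ s t → eis s t ≡ + p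
eis-represents-1-mod-3 {p} pp r = from-root (cbrt-1 pp r)
  where
  l : ∀ t → t * t + t + + 1 ≡ eis t (- + 1)
  l = solve 1 (λ t → t ⊠ t ⊞ t ⊞ Κ (+ 1) ⊜ eisₑ t (Κ (- + 1))) refl
  from-root : (∃ λ t → + p ∣ₛ t * t + t + + 1) → ∃₂ λ s t → eis s t ≡ + p
  from-root (t , d) = eis-represents pp t (- + 1) (subst (+ p ∣ₛ_) (l t) d) (λ { (_ , d) → not-unit pp { - + 1} d refl })

gauss-represents-1-mod-4 : ∀ {p} → Prime p → p % 4 ≡ 1 → ∃₂ λ s t → gauss s t ≡ + p
gauss-represents-1-mod-4 {p} pp r = from-root (sqrt-1 pp r)
  where
  from-root : (∃ λ t → + p ∣ₛ t * t + + 1) → ∃₂ λ s t → gauss s t ≡ + p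
  from-root (t , d) = gauss-represents pp t (+ 1) d (λ { (_ , d) → not-unit pp {+ 1} d refl })

norm₁₂-represents : ∀ {p} → Prime p → p % 12 ≡ 1 → ∃ λ a → ∃ λ b → ∃ λ c → ∃ λ d → norm₁₂ a b c d ≡ + p
norm₁₂-represents {p} pp r = represented (represent-over pp (eis-represents-1-mod-3 pp (proj₂ (≡1-mod-12 p r))) (sqrt-1 pp (proj₁ (≡1-mod-12 p r))))

-- Prime factors of values of the forms

Residue : ℕ → ℤ → Set
Residue n x = ∃ λ (i : Fin n) → ∃ λ a → x ≡ + toℕ i + a * + n

fin-residue : ∀ n .{{_ : ℕ.NonZero n}} x → Residue n x
fin-residue n x = fromℕ< (n%ℕd<d x n) , x ℤ./ℕ n ,
  trans (a≡a%ℕn+[a/ℕn]*n x n) (cong (λ t → + t + x ℤ./ℕ n * + n) (sym (F.toℕ-fromℕ< (n%ℕd<d x n))))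

%-cong : ∀ n .{{_ : ℕ.NonZero n}} a b w → + a ≡ + b + w * + n → a % n ≡ b % n
%-cong n a b (+ k) e = trans (cong (_% n) (+-injective (trans e (trans (cong (λ t → + b + t) (sym (pos-* k n))) (sym (pos-+ b (k ℕ.* n))))))) (ℕ.[m+kn]%n≡m%n b k n)
%-cong n a b -[1+ k ] e = sym (trans (cong (_% n) (+-injective (trans (trans (l (+ b) (-[1+ k ] * + n)) (cong (_+ - (-[1+ k ] * + n)) (sym e)))
    (trans (cong (λ t → + a + t) (trans (neg-distribˡ-* -[1+ k ] (+ n)) (sym (pos-* (suc k) n)))) (sym (pos-+ a (suc k ℕ.* n))))))) (ℕ.[m+kn]%n≡m%n a (suc k) n))
  where
  l : ∀ b w → b ≡ b + w + - w
  l = solve-∀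

∤⇒%≢0 : ∀ {n d} .{{_ : ℕ.NonZero d}} → ¬ (d ℕ.∣ n) → n % d ≢ 0
∤⇒%≢0 {n} {d} ∤ e = ∤ (ℕ.m%n≡0⇒n∣m n d e)

coprime-mod-12 : ∀ n → ¬ (2 ℕ.∣ n) → ¬ (3 ℕ.∣ n) → n % 12 ≡ 1 ⊎ n % 12 ≡ 5 ⊎ n % 12 ≡ 7 ⊎ n % 12 ≡ 11
coprime-mod-12 n ∤2 ∤3 = subst (λ r → r ≡ 1 ⊎ r ≡ 5 ⊎ r ≡ 7 ⊎ r ≡ 11) toℕ-r
    (table (fromℕ< (ℕ.m%n<n n 12)) (∤⇒%≢0 ∤2 ∘ trans (trans (sym (ℕ.m∣n⇒o%n%m≡o%m 2 12 n (ℕ.divides 6 refl))) (cong (_% 2) (sym toℕ-r))))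
      (∤⇒%≢0 ∤3 ∘ trans (trans (sym (ℕ.m∣n⇒o%n%m≡o%m 3 12 n (ℕ.divides 4 refl))) (cong (_% 3) (sym toℕ-r)))))
  where
  toℕ-r : toℕ (fromℕ< (ℕ.m%n<n n 12)) ≡ n % 12
  toℕ-r = F.toℕ-fromℕ< (ℕ.m%n<n n 12)
  table : ∀ (r : Fin 12) → toℕ r % 2 ≢ 0 → toℕ r % 3 ≢ 0 → toℕ r ≡ 1 ⊎ toℕ r ≡ 5 ⊎ toℕ r ≡ 7 ⊎ toℕ r ≡ 11
  table = toWitness {a? = F.all? λ r → ¬? (toℕ r % 2 ℕ.≟ 0) →-dec (¬? (toℕ r % 3 ℕ.≟ 0) →-dec
    (toℕ r ℕ.≟ 1 ⊎-dec toℕ r ℕ.≟ 5 ⊎-dec toℕ r ℕ.≟ 7 ⊎-dec toℕ r ℕ.≟ 11))} _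

prime-divisor : ∀ n → 1 ℕ.< n → ∃ λ p → Prime p × p ℕ.∣ n
prime-divisor n@(suc _) 1<n with factorise n
... | record { factors = []     ; isFactorisation = e } = ⊥-elim (ℕ.<-irrefl (sym e) 1<n)
... | record { factors = p ∷ ps ; isFactorisation = e ; factorsPrime = pp ∷ _ } = p , pp , ℕ.divides (product ps) (trans e (ℕ.*-comm p (product ps)))

Good : ℕ → Set
Good n = ∃ λ p → GoodPrime p × p ℕ.∣ n

Good-∣ : ∀ {m n} → m ℕ.∣ n → Good m → Good n
Good-∣ d (p , good , p∣m) = p , good , ℕ.∣-trans p∣m d

private
  gauss-carry : (n i a j b : ℤ) → ℤ
  gauss-carry n i a j b = + 2 * i * a + a * a * n + + 2 * j * b + b * b * n

  pos-gauss : ∀ i j → gauss (+ i) (+ j) ≡ + (i ℕ.* i ℕ.+ j ℕ.* j)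
  pos-gauss i j = sym (trans (pos-+ (i ℕ.* i) (j ℕ.* j)) (cong₂ _+_ (pos-* i i) (pos-* j j)))

-- The arguments and the value have separate moduli because a square modulo 12 depends only on its
-- root modulo 6.
GaussResidues : (n k : ℕ) .{{_ : ℕ.NonZero k}} → ℕ → ℤ → ℤ → Set
GaussResidues n k m s t = ∃₂ λ (i j : Fin n) → ∃₂ λ a b →
  s ≡ + toℕ i + a * + n × t ≡ + toℕ j + b * + n × (toℕ i ℕ.* toℕ i ℕ.+ toℕ j ℕ.* toℕ j) % k ≡ m % k

gauss-residue : ∀ n i a j b → gauss (+ i + a * n) (+ j + b * n) ≡ + (i ℕ.* i ℕ.+ j ℕ.* j) + gauss-carry n (+ i) a (+ j) b * n
gauss-residue n i a j b = trans (l n (+ i) a (+ j) b) (cong (_+ gauss-carry n (+ i) a (+ j) b * n) (pos-gauss i j))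
  where
  l : ∀ n i a j b → gauss (i + a * n) (j + b * n) ≡ gauss i j + gauss-carry n i a j b * n
  l = solve 5 (λ n i a j b → gaussₑ (i ⊞ a ⊠ n) (j ⊞ b ⊠ n)
    ⊜ gaussₑ i j ⊞ (Κ (+ 2) ⊠ i ⊠ a ⊞ a ⊠ a ⊠ n ⊞ Κ (+ 2) ⊠ j ⊠ b ⊞ b ⊠ b ⊠ n) ⊠ n) refl

gauss-% : ∀ n .{{_ : ℕ.NonZero n}} m s t → gauss s t ≡ + m → GaussResidues n n m s t
gauss-% n m s t e = combine (fin-residue n s) (fin-residue n t)
  where
  combine : Residue n s → Residue n t → _
  combine (i , a , ea) (j , b , eb) = i , j , a , b , ea , eb , sym (%-cong n m (toℕ i ℕ.* toℕ i ℕ.+ toℕ j ℕ.* toℕ j)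
    (gauss-carry (+ n) (+ toℕ i) a (+ toℕ j) b) (trans (sym e) (trans (cong₂ gauss ea eb) (gauss-residue (+ n) (toℕ i) a (toℕ j) b))))

gauss-mod-4 : ∀ {p} s t → gauss s t ≡ + p → p % 4 ≢ 3
gauss-mod-4 {p} s t e r = contradict (gauss-% 4 p s t e)
  where
  table : ∀ (i j : Fin 4) → (toℕ i ℕ.* toℕ i ℕ.+ toℕ j ℕ.* toℕ j) % 4 ≢ 3
  table = toWitness {a? = F.all? λ i → F.all? λ j → ¬? ((toℕ i ℕ.* toℕ i ℕ.+ toℕ j ℕ.* toℕ j) % 4 ℕ.≟ 3)} _
  contradict : GaussResidues 4 4 p s t → ⊥
  contradict (i , j , _ , _ , _ , _ , m) = table i j (trans m r)

-- eis s t is congruent to the square of s + t modulo 3.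
eis-mod-3 : ∀ {p} s t → eis s t ≡ + p → p % 3 ≢ 2
eis-mod-3 {p} s t e r = contradict (fin-residue 3 (s + t))
  where
  l : ∀ s t i a → (i + a * + 3) * (i + a * + 3) + - (+ 3 * (s * t)) ≡ i * i + (+ 2 * i * a + + 3 * a * a + - (s * t)) * + 3
  l = solve-∀
  l′ : ∀ s t → eis s t ≡ (s + t) * (s + t) + - (+ 3 * (s * t))
  l′ = solve 2 (λ s t → eisₑ s t ⊜ (s ⊞ t) ⊠ (s ⊞ t) ⊞ ⊟ (Κ (+ 3) ⊠ (s ⊠ t))) refl
  table : ∀ (i : Fin 3) → (toℕ i ℕ.* toℕ i) % 3 ≢ 2
  table = toWitness {a? = F.all? λ i → ¬? ((toℕ i ℕ.* toℕ i) % 3 ℕ.≟ 2)} _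
  contradict : Residue 3 (s + t) → ⊥
  contradict (i , a , ea) = table i (trans (sym (%-cong 3 p (toℕ i ℕ.* toℕ i) (+ 2 * + toℕ i * a + + 3 * a * a + - (s * t))
    (trans (sym e) (trans (l′ s t) (trans (cong (λ u → u * u + - (+ 3 * (s * t))) ea) (trans (l s t (+ toℕ i) a)
      (cong (_+ (+ 2 * + toℕ i * a + + 3 * a * a + - (s * t)) * + 3) (sym (pos-* (toℕ i) (toℕ i)))))))))) r)

private
  6∣ : ∀ a → + 6 ∣ₛ + 0 + a * + 6
  6∣ a = divides a (+-identityˡ _)

gauss-residues-6 : ∀ m s t → gauss s t ≡ + m → GaussResidues 6 12 m s t
gauss-residues-6 m s t e = combine (fin-residue 6 s) (fin-residue 6 t)
  where
  l : ∀ i a j b → gauss (i + a * + 6) (j + b * + 6) ≡ gauss i j + (i * a + + 3 * (a * a) + j * b + + 3 * (b * b)) * + 12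
  l = solve 4 (λ i a j b → gaussₑ (i ⊞ a ⊠ Κ (+ 6)) (j ⊞ b ⊠ Κ (+ 6))
    ⊜ gaussₑ i j ⊞ (i ⊠ a ⊞ Κ (+ 3) ⊠ (a ⊠ a) ⊞ j ⊠ b ⊞ Κ (+ 3) ⊠ (b ⊠ b)) ⊠ Κ (+ 12)) refl
  combine : Residue 6 s → Residue 6 t → _
  combine (i , a , ea) (j , b , eb) = i , j , a , b , ea , eb , sym (%-cong 12 m (toℕ i ℕ.* toℕ i ℕ.+ toℕ j ℕ.* toℕ j)
    (+ toℕ i * a + + 3 * (a * a) + + toℕ j * b + + 3 * (b * b))
    (trans (sym e) (trans (cong₂ gauss ea eb) (trans (l (+ toℕ i) a (+ toℕ j) b)
      (cong (_+ (+ toℕ i * a + + 3 * (a * a) + + toℕ j * b + + 3 * (b * b)) * + 12) (pos-gauss (toℕ i) (toℕ j)))))))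

-- For a sum of two squares that is 1 modulo 12, either one root is 0 modulo 6, or the roots are ±2
-- and 3 in some order; the latter is the representation defining P₁, up to sign.
gauss-prime-classify : ∀ {p} → Prime p → p % 12 ≡ 1 → ∀ s t → gauss s t ≡ + p → GoodPrime p ⊎ + 6 ∣ₛ s ⊎ + 6 ∣ₛ t
gauss-prime-classify {p} pp r s t e = classify (gauss-residues-6 p s t e)
  where
  Outcome : Set
  Outcome = GoodPrime p ⊎ + 6 ∣ₛ s ⊎ + 6 ∣ₛ t
  table : ∀ (i j : Fin 6) → (toℕ i ℕ.* toℕ i ℕ.+ toℕ j ℕ.* toℕ j) % 12 ≡ 1 →
    i ≡ # 0 ⊎ j ≡ # 0 ⊎ (i ≡ # 2 × j ≡ # 3) ⊎ (i ≡ # 4 × j ≡ # 3) ⊎ (i ≡ # 3 × j ≡ # 2) ⊎ (i ≡ # 3 × j ≡ # 4)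
  table = toWitness {a? = F.all? λ i → F.all? λ j → ((toℕ i ℕ.* toℕ i ℕ.+ toℕ j ℕ.* toℕ j) % 12 ℕ.≟ 1) →-dec
    (i F.≟ # 0 ⊎-dec j F.≟ # 0 ⊎-dec (i F.≟ # 2 ×-dec j F.≟ # 3) ⊎-dec (i F.≟ # 4 ×-dec j F.≟ # 3)
      ⊎-dec (i F.≟ # 3 ×-dec j F.≟ # 2) ⊎-dec (i F.≟ # 3 ×-dec j F.≟ # 4))} _
  in-P₁ : ∀ k u → + p ≡ gauss (+ 6 * k + + 2) (+ 6 * u + + 3) → Outcome
  in-P₁ k u e = inj₁ (inj₂ (inj₂ (pp , r , k , u , e)))
  l₂₃ : ∀ a b → gauss (+ 2 + a * + 6) (+ 3 + b * + 6) ≡ gauss (+ 6 * a + + 2) (+ 6 * b + + 3)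
  l₂₃ = solve 2 (λ a b → gaussₑ (Κ (+ 2) ⊞ a ⊠ Κ (+ 6)) (Κ (+ 3) ⊞ b ⊠ Κ (+ 6)) ⊜ gaussₑ (Κ (+ 6) ⊠ a ⊞ Κ (+ 2)) (Κ (+ 6) ⊠ b ⊞ Κ (+ 3))) refl
  l₄₃ : ∀ a b → gauss (+ 4 + a * + 6) (+ 3 + b * + 6) ≡ gauss (+ 6 * (- a + - + 1) + + 2) (+ 6 * b + + 3)
  l₄₃ = solve 2 (λ a b → gaussₑ (Κ (+ 4) ⊞ a ⊠ Κ (+ 6)) (Κ (+ 3) ⊞ b ⊠ Κ (+ 6)) ⊜ gaussₑ (Κ (+ 6) ⊠ (⊟ a ⊞ Κ (- + 1)) ⊞ Κ (+ 2)) (Κ (+ 6) ⊠ b ⊞ Κ (+ 3))) refl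
  flip : ∀ x y → gauss x y ≡ gauss y x
  flip x y = +-comm (x * x) (y * y)
  outcome : ∀ i a j b → s ≡ + toℕ i + a * + 6 → t ≡ + toℕ j + b * + 6 →
    i ≡ # 0 ⊎ j ≡ # 0 ⊎ (i ≡ # 2 × j ≡ # 3) ⊎ (i ≡ # 4 × j ≡ # 3) ⊎ (i ≡ # 3 × j ≡ # 2) ⊎ (i ≡ # 3 × j ≡ # 4) → Outcome
  outcome i a j b ea eb (inj₁ refl) = inj₂ (inj₁ (subst (+ 6 ∣ₛ_) (sym ea) (6∣ a)))
  outcome i a j b ea eb (inj₂ (inj₁ refl)) = inj₂ (inj₂ (subst (+ 6 ∣ₛ_) (sym eb) (6∣ b)))
  outcome i a j b ea eb (inj₂ (inj₂ (inj₁ (refl , refl)))) = in-P₁ a b (trans (sym e) (trans (cong₂ gauss ea eb) (l₂₃ a b)))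
  outcome i a j b ea eb (inj₂ (inj₂ (inj₂ (inj₁ (refl , refl))))) = in-P₁ (- a + - + 1) b (trans (sym e) (trans (cong₂ gauss ea eb) (l₄₃ a b)))
  outcome i a j b ea eb (inj₂ (inj₂ (inj₂ (inj₂ (inj₁ (refl , refl)))))) = in-P₁ b a (trans (sym e) (trans (flip s t) (trans (cong₂ gauss eb ea) (l₂₃ b a))))
  outcome i a j b ea eb (inj₂ (inj₂ (inj₂ (inj₂ (inj₂ (refl , refl)))))) = in-P₁ (- b + - + 1) a (trans (sym e) (trans (flip s t) (trans (cong₂ gauss eb ea) (l₄₃ b a))))
  classify : GaussResidues 6 12 p s t → Outcome
  classify (i , j , a , b , ea , eb , m) = outcome i a j b ea eb (table i j (trans m r))

module _ {p : ℕ} (pp : Prime p) where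
  private
    instance _ = prime⇒nonZero pp

    square-root : ∀ x → + p ∣ₛ x * x → + p ∣ₛ x
    square-root x d = [ (λ z → z) , (λ z → z) ]′ (euclid pp {x} {x} d)

    p-cancel : ∀ {x y} → x * + p ≡ y * + p → x ≡ y
    p-cancel {x} {y} = *-cancelʳ-≡ x y (+ p)

  GaussQuotient : ℤ → ℤ → ℤ → ℤ → Set
  GaussQuotient s t x y = ∃₂ λ u v → ∃ λ t′ → (t′ ≡ t ⊎ t′ ≡ - t) × x ≡ s * u + - (t′ * v) × y ≡ s * v + t′ * u

  -- Either x + iy or its conjugate is divisible by s + it.
  gauss-divide : ∀ s t → gauss s t ≡ + p → ∀ x y → + p ∣ₛ gauss x y → GaussQuotient s t x y
  gauss-divide s t e x y d = [ (λ d → by t (inj₁ refl) e d) , (λ d → by (- t) (inj₂ refl) (trans (sign-irrelevant s t) e) d) ]′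
      (euclid pp {s * y + - (t * x)} {s * y + - (- t * x)} (subst (+ p ∣ₛ_) (sym (l s t x y)) (∣m∣n⇒∣m-n (∣n⇒∣m*n (s * s) d) (∣n⇒∣m*n (x * x) (divides (+ 1) (trans e (sym (*-identityˡ (+ p)))))))))
    where
    sign-irrelevant : ∀ s t → gauss s (- t) ≡ gauss s t
    sign-irrelevant = solve 2 (λ s t → gaussₑ s (⊟ t) ⊜ gaussₑ s t) refl
    l : ∀ s t x y → (s * y + - (t * x)) * (s * y + - (- t * x)) ≡ s * s * gauss x y + - (x * x * gauss s t)
    l = solve 4 (λ s t x y → (s ⊠ y ⊞ ⊟ (t ⊠ x)) ⊠ (s ⊠ y ⊞ ⊟ (⊟ t ⊠ x)) ⊜ s ⊠ s ⊠ gaussₑ x y ⊞ ⊟ (x ⊠ x ⊠ gaussₑ s t)) refl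
    by : ∀ t′ → t′ ≡ t ⊎ t′ ≡ - t → gauss s t′ ≡ + p → + p ∣ₛ s * y + - (t′ * x) → GaussQuotient s t x y
    by t′ t′-is e′ (divides v ev) = finish (square-root (s * x + t′ * y) (subst (+ p ∣ₛ_) (sym (l₁ s t′ x y))
        (∣m∣n⇒∣m-n (∣m⇒∣m*n (gauss x y) (divides (+ 1) (trans e′ (sym (*-identityˡ (+ p)))))) (∣n⇒∣m*n (s * y + - (t′ * x)) (divides v ev)))))
      where
      l₁ : ∀ s t x y → (s * x + t * y) * (s * x + t * y) ≡ gauss s t * gauss x y + - ((s * y + - (t * x)) * (s * y + - (t * x)))
      l₁ = solve 4 (λ s t x y → (s ⊠ x ⊞ t ⊠ y) ⊠ (s ⊠ x ⊞ t ⊠ y) ⊜ gaussₑ s t ⊠ gaussₑ x y ⊞ ⊟ ((s ⊠ y ⊞ ⊟ (t ⊠ x)) ⊠ (s ⊠ y ⊞ ⊟ (t ⊠ x)))) refl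
      l₂ : ∀ s t x y → x * gauss s t ≡ s * (s * x + t * y) + - (t * (s * y + - (t * x)))
      l₂ = solve 4 (λ s t x y → x ⊠ gaussₑ s t ⊜ s ⊠ (s ⊠ x ⊞ t ⊠ y) ⊞ ⊟ (t ⊠ (s ⊠ y ⊞ ⊟ (t ⊠ x)))) refl
      l₃ : ∀ s t x y → y * gauss s t ≡ s * (s * y + - (t * x)) + t * (s * x + t * y)
      l₃ = solve 4 (λ s t x y → y ⊠ gaussₑ s t ⊜ s ⊠ (s ⊠ y ⊞ ⊟ (t ⊠ x)) ⊞ t ⊠ (s ⊠ x ⊞ t ⊠ y)) refl
      l₄ : ∀ s t u v p → s * (u * p) + - (t * (v * p)) ≡ (s * u + - (t * v)) * p
      l₄ = solve-∀
      l₅ : ∀ s t u v p → s * (v * p) + t * (u * p) ≡ (s * v + t * u) * p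
      l₅ = solve-∀
      finish : + p ∣ₛ s * x + t′ * y → GaussQuotient s t x y
      finish (divides u eu) = u , v , t′ , t′-is ,
        p-cancel (trans (cong (x *_) (sym e′)) (trans (l₂ s t′ x y) (trans (cong₂ (λ a b → s * a + - (t′ * b)) eu ev) (l₄ s t′ u v (+ p))))) ,
        p-cancel (trans (cong (y *_) (sym e′)) (trans (l₃ s t′ x y) (trans (cong₂ (λ a b → s * a + t′ * b) ev eu) (l₅ s t′ u v (+ p)))))

  -- Only the norm of the quotient is kept: `eis-good` follows norms modulo 4, whereas `gauss-good`
  -- must follow coordinates modulo 6.
  eis-divide : ∀ s t → eis s t ≡ + p → ∀ x y → + p ∣ₛ eis x y → ∃₂ λ u v → eis x y ≡ + p * eis u v
  eis-divide s t e x y d = [ by (s + - t) (- t) (trans (conjugate s t) e) ∘ subst (+ p ∣ₛ_) (l₀ s t x y) , by s t e ]′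
      (euclid pp {y * s + - (x * t)} {x * t + y * s + - (y * t)} (subst (+ p ∣ₛ_) (sym (l s t x y)) (∣m∣n⇒∣m-n (∣n⇒∣m*n (y * y) (divides (+ 1) (trans e (sym (*-identityˡ (+ p)))))) (∣n⇒∣m*n (t * t) d))))
    where
    conjugate : ∀ s t → eis (s + - t) (- t) ≡ eis s t
    conjugate = solve 2 (λ s t → eisₑ (s ⊞ ⊟ t) (⊟ t) ⊜ eisₑ s t) refl
    l₀ : ∀ s t x y → y * s + - (x * t) ≡ x * - t + y * (s + - t) + - (y * - t)
    l₀ = solve-∀
    l : ∀ s t x y → (y * s + - (x * t)) * (x * t + y * s + - (y * t)) ≡ y * y * eis s t + - (t * t * eis x y)
    l = solve 4 (λ s t x y → (y ⊠ s ⊞ ⊟ (x ⊠ t)) ⊠ (x ⊠ t ⊞ y ⊠ s ⊞ ⊟ (y ⊠ t)) ⊜ y ⊠ y ⊠ eisₑ s t ⊞ ⊟ (t ⊠ t ⊠ eisₑ x y)) refl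
    by : ∀ s t → eis s t ≡ + p → + p ∣ₛ x * t + y * s + - (y * t) → ∃₂ λ u v → eis x y ≡ + p * eis u v
    by s t e (divides v ev) = finish (square-root (x * s + - (y * t)) (subst (+ p ∣ₛ_) (sym (l₁ s t x y))
        (∣m∣n⇒∣m+n (∣m⇒∣m*n (eis x y) (divides (+ 1) (trans e (sym (*-identityˡ (+ p)))))) (∣n⇒∣m*n ((x * s + - (y * t)) + - (x * t + y * s + - (y * t))) (divides v ev)))))
      where
      l₁ : ∀ s t x y → (x * s + - (y * t)) * (x * s + - (y * t)) ≡ eis s t * eis x y + ((x * s + - (y * t)) + - (x * t + y * s + - (y * t))) * (x * t + y * s + - (y * t))
      l₁ = solve 4 (λ s t x y → (x ⊠ s ⊞ ⊟ (y ⊠ t)) ⊠ (x ⊠ s ⊞ ⊟ (y ⊠ t)) ⊜ eisₑ s t ⊠ eisₑ x y ⊞ ((x ⊠ s ⊞ ⊟ (y ⊠ t)) ⊞ ⊟ (x ⊠ t ⊞ y ⊠ s ⊞ ⊟ (y ⊠ t))) ⊠ (x ⊠ t ⊞ y ⊠ s ⊞ ⊟ (y ⊠ t))) refl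
      l₂ : ∀ u v p → eis (u * p) (v * p) ≡ (p * eis u v) * p
      l₂ = solve 3 (λ u v p → eisₑ (u ⊠ p) (v ⊠ p) ⊜ (p ⊠ eisₑ u v) ⊠ p) refl
      finish : + p ∣ₛ x * s + - (y * t) → ∃₂ λ u v → eis x y ≡ + p * eis u v
      finish (divides u eu) = u , v , p-cancel (trans (cong (eis x y *_) (sym e)) (trans (sym (eis-mul x y s t)) (trans (cong₂ eis eu ev) (l₂ u v (+ p)))))

gauss-pos : ∀ x y → gauss x y ≡ + ℤ.∣ gauss x y ∣
gauss-pos x y = trans (gauss-abs x y) (cong (λ t → + ℤ.∣ t ∣) (sym (gauss-abs x y)))

∤-divisor : ∀ {d m n} → m ℕ.∣ n → ¬ (d ℕ.∣ n) → ¬ (d ℕ.∣ m)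
∤-divisor m∣n ∤n d∣m = ∤n (ℕ.∣-trans d∣m m∣n)

odd⇒nonZero : ∀ n → ¬ (2 ℕ.∣ n) → ℕ.NonZero n
odd⇒nonZero zero    ∤2 = ⊥-elim (∤2 (2 ℕ.∣0))
odd⇒nonZero (suc n) ∤2 = _

prime⇒1< : ∀ {p} → Prime p → 1 ℕ.< p
prime⇒1< {p} pp = ℕ.nonTrivial⇒n>1 p {{prime⇒nonTrivial pp}}

cofactor-< : ∀ {n n′} k → 1 ℕ.< k → ¬ (2 ℕ.∣ n) → n ≡ k ℕ.* n′ → n′ ℕ.< n
cofactor-< {n} {n′} k 1<k ∤2 e = subst (n′ ℕ.<_) (trans (ℕ.*-comm n′ k) (sym e))
  (ℕ.m<m*n n′ k {{odd⇒nonZero n′ (∤-divisor (ℕ.divides k e) ∤2)}} 1<k)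

scaled-factor : ∀ {n k v} → + n ≡ + k * v → v ≡ + ℤ.∣ v ∣ → n ≡ k ℕ.* ℤ.∣ v ∣
scaled-factor {n} {k} {v} e v≥0 = +-injective (trans e (trans (cong (+ k *_) v≥0) (sym (pos-* k ℤ.∣ v ∣))))

private
  1<p² : ∀ {p} → Prime p → 1 ℕ.< p ℕ.* p
  1<p² {p} pp = ℕ.<-≤-trans (prime⇒1< pp) (ℕ.m≤m*n p p {{prime⇒nonZero pp}})

  11-mod-12 : ∀ {p} → p % 12 ≡ 11 → p % 4 ≡ 3 × p % 3 ≡ 2
  11-mod-12 {p} r = trans (sym (ℕ.m∣n⇒o%n%m≡o%m 4 12 p (ℕ.divides 3 refl))) (cong (_% 4) r)
    , trans (sym (ℕ.m∣n⇒o%n%m≡o%m 3 12 p (ℕ.divides 4 refl))) (cong (_% 3) r)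

-- A prime dividing a norm but not the element would, by the descent, be a norm itself, against its
-- residue modulo 4. The prime 3 is included.
gauss-inert : ∀ {p} → Prime p → p % 4 ≡ 3 → ∀ x y → + p ∣ₛ gauss x y → + p ∣ₛ x × + p ∣ₛ y
gauss-inert {p} pp r x y d with + p ∣? x ×-dec + p ∣? y
... | yes both = both
... | no  ∤    = ⊥-elim (contradict (gauss-represents pp x y d ∤))
  where
  contradict : (∃₂ λ s t → gauss s t ≡ + p) → ⊥
  contradict (s , t , e) = gauss-mod-4 s t e r

eis-inert : ∀ {p} → Prime p → p % 3 ≡ 2 → ∀ x y → + p ∣ₛ eis x y → + p ∣ₛ x × + p ∣ₛ y
eis-inert {p} pp r x y d with + p ∣? x ×-dec + p ∣? y
... | yes both = both
... | no  ∤    = ⊥-elim (contradict (eis-represents pp x y d ∤))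
  where
  contradict : (∃₂ λ s t → eis s t ≡ + p) → ⊥
  contradict (s , t , e) = eis-mod-3 s t e r

-- Prime factors 11 mod 12 divide both coordinates, and those 1 mod 12 outside P₁ are, up to a unit,
-- congruent to 1 modulo 6 in ℤ[i].
GaussOutcome : ℕ → ℤ → ℤ → Set
GaussOutcome n x y = Good n ⊎ + 6 ∣ₛ x ⊎ + 6 ∣ₛ y

-- For an element of norm prime to 6, having a coordinate divisible by 6 means being ±1 or ±i modulo
-- 6. This property is multiplicative, so the induction removes one prime factor of the norm at a
-- time.
gauss-good : ∀ n x y → gauss x y ≡ + n → ¬ (2 ℕ.∣ n) → ¬ (3 ℕ.∣ n) → GaussOutcome n x y
gauss-good n = go n (<-wellFounded n)
  where
  go : ∀ n → Acc ℕ._<_ n → ∀ x y → gauss x y ≡ + n → ¬ (2 ℕ.∣ n) → ¬ (3 ℕ.∣ n) → GaussOutcome n x y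
  by-prime : ∀ n → Acc ℕ._<_ n → ∀ x y → gauss x y ≡ + n → ¬ (2 ℕ.∣ n) → ¬ (3 ℕ.∣ n) → ∀ p → Prime p → p ℕ.∣ n →
    p % 12 ≡ 1 ⊎ p % 12 ≡ 5 ⊎ p % 12 ≡ 7 ⊎ p % 12 ≡ 11 → GaussOutcome n x y
  go zero          _  x y e ∤2 ∤3 = ⊥-elim (∤2 (2 ℕ.∣0))
  go (suc zero)    _  x y e ∤2 ∤3 = inj₂ (one (ℕ.m*n≡0⇒m≡0∨n≡0 ℤ.∣ x ∣ (both (ℤ.∣ x ∣ ℕ.* ℤ.∣ x ∣) (ℤ.∣ y ∣ ℕ.* ℤ.∣ y ∣) ℤ.∣ x ∣ ℤ.∣ y ∣ refl refl (+-injective (trans (sym (gauss-abs x y)) e)))))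
    where
    both : ∀ X Y a b → X ≡ a ℕ.* a → Y ≡ b ℕ.* b → X ℕ.+ Y ≡ 1 → a ℕ.* b ≡ 0
    both zero    Y zero    b _ _ _ = refl
    both (suc X) zero a zero    _ _ _ = ℕ.*-zeroʳ a
    both (suc X) (suc Y) a b _ _ e = ⊥-elim (ℕ.1+n≢0 (trans (sym (ℕ.+-suc X Y)) (ℕ.suc-injective e)))
    0∣ : ∀ x → ℤ.∣ x ∣ ≡ 0 → + 6 ∣ₛ x
    0∣ x e = subst (+ 6 ∣ₛ_) (sym (∣i∣≡0⇒i≡0 e)) (divides (+ 0) refl)
    one : ℤ.∣ x ∣ ≡ 0 ⊎ ℤ.∣ y ∣ ≡ 0 → + 6 ∣ₛ x ⊎ + 6 ∣ₛ y
    one = Sum.map (0∣ x) (0∣ y)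
  go n@(suc (suc _)) ac x y e ∤2 ∤3 = let p , pp , p∣n = prime-divisor n (s≤s (s≤s z≤n)) in
    by-prime n ac x y e ∤2 ∤3 p pp p∣n (coprime-mod-12 p (∤-divisor p∣n ∤2) (∤-divisor p∣n ∤3))
  by-prime n _ x y e ∤2 ∤3 p pp p∣n (inj₂ (inj₁ r))        = inj₁ (p , inj₁ (pp , r) , p∣n)
  by-prime n _ x y e ∤2 ∤3 p pp p∣n (inj₂ (inj₂ (inj₁ r))) = inj₁ (p , inj₂ (inj₁ (pp , r)) , p∣n)
  by-prime n (acc rec) x y e ∤2 ∤3 p pp p∣n (inj₂ (inj₂ (inj₂ r))) =
      descend (gauss-inert pp (proj₁ (11-mod-12 {p} r)) x y (subst (+ p ∣ₛ_) (sym e) (∣ᵤ⇒∣ p∣n)))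
    where
    l : ∀ u v p → gauss (u * p) (v * p) ≡ (p * p) * gauss u v
    l = solve 3 (λ u v p → gaussₑ (u ⊠ p) (v ⊠ p) ⊜ (p ⊠ p) ⊠ gaussₑ u v) refl
    descend : + p ∣ₛ x × + p ∣ₛ y → GaussOutcome n x y
    descend (divides u eu , divides v ev) = Sum.map (Good-∣ n′∣n) (Sum.map (scale u eu) (scale v ev))
        (go n′ (rec (cofactor-< (p ℕ.* p) (1<p² pp) ∤2 n≡)) u v (gauss-pos u v) (∤-divisor n′∣n ∤2) (∤-divisor n′∣n ∤3))
      where
      n′ : ℕ
      n′ = ℤ.∣ gauss u v ∣
      n≡ : n ≡ (p ℕ.* p) ℕ.* n′
      n≡ = scaled-factor {k = p ℕ.* p} (trans (sym e) (trans (cong₂ gauss eu ev) (trans (l u v (+ p)) (cong (_* gauss u v) (sym (pos-* p p)))))) (gauss-pos u v)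
      n′∣n : n′ ℕ.∣ n
      n′∣n = ℕ.divides (p ℕ.* p) n≡
      scale : ∀ {x} u → x ≡ u * + p → + 6 ∣ₛ u → + 6 ∣ₛ x
      scale u eu d = subst (+ 6 ∣ₛ_) (sym eu) (∣m⇒∣m*n (+ p) d)
  by-prime n (acc rec) x y e ∤2 ∤3 p pp p∣n (inj₁ r) = split (gauss-represents-1-mod-4 pp (proj₁ (≡1-mod-12 p r)))
    where
    l : ∀ s t u v → gauss (s * u + - (t * v)) (s * v + t * u) ≡ gauss s t * gauss u v
    l = solve 4 (λ s t u v → gaussₑ (s ⊠ u ⊞ ⊟ (t ⊠ v)) (s ⊠ v ⊞ t ⊠ u) ⊜ gaussₑ s t ⊠ gaussₑ u v) refl
    module _ (s t : ℤ) (est : gauss s t ≡ + p) (s∨t : + 6 ∣ₛ s ⊎ + 6 ∣ₛ t) where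
      combine : ∀ t′ u v → t′ ≡ t ⊎ t′ ≡ - t → x ≡ s * u + - (t′ * v) → y ≡ s * v + t′ * u → + 6 ∣ₛ s ⊎ + 6 ∣ₛ t′ →
        + 6 ∣ₛ u ⊎ + 6 ∣ₛ v → + 6 ∣ₛ x ⊎ + 6 ∣ₛ y
      combine t′ u v _ ex ey (inj₁ ds) (inj₁ du) = inj₂ (subst (+ 6 ∣ₛ_) (sym ey) (∣m∣n⇒∣m+n (∣m⇒∣m*n v ds) (∣n⇒∣m*n t′ du)))
      combine t′ u v _ ex ey (inj₁ ds) (inj₂ dv) = inj₁ (subst (+ 6 ∣ₛ_) (sym ex) (∣m∣n⇒∣m-n (∣m⇒∣m*n u ds) (∣n⇒∣m*n t′ dv)))
      combine t′ u v _ ex ey (inj₂ dt) (inj₁ du) = inj₁ (subst (+ 6 ∣ₛ_) (sym ex) (∣m∣n⇒∣m-n (∣n⇒∣m*n s du) (∣m⇒∣m*n v dt)))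
      combine t′ u v _ ex ey (inj₂ dt) (inj₂ dv) = inj₂ (subst (+ 6 ∣ₛ_) (sym ey) (∣m∣n⇒∣m+n (∣n⇒∣m*n s dv) (∣m⇒∣m*n u dt)))
      norm-t′ : ∀ {t′} → t′ ≡ t ⊎ t′ ≡ - t → gauss s t′ ≡ + p
      norm-t′ (inj₁ refl) = est
      norm-t′ (inj₂ refl) = trans (l′ s t) est
        where
        l′ : ∀ s t → gauss s (- t) ≡ gauss s t
        l′ = solve 2 (λ s t → gaussₑ s (⊟ t) ⊜ gaussₑ s t) refl
      div-t′ : ∀ {t′} → t′ ≡ t ⊎ t′ ≡ - t → + 6 ∣ₛ s ⊎ + 6 ∣ₛ t′
      div-t′ (inj₁ refl) = s∨t
      div-t′ (inj₂ refl) = Sum.map₂ ∣m⇒∣-m s∨t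
      descend : GaussQuotient pp s t x y → GaussOutcome n x y
      descend (u , v , t′ , t′-is , ex , ey) = Sum.map (Good-∣ n′∣n) (combine t′ u v t′-is ex ey (div-t′ t′-is))
          (go n′ (rec (cofactor-< p (prime⇒1< pp) ∤2 n≡)) u v (gauss-pos u v) (∤-divisor n′∣n ∤2) (∤-divisor n′∣n ∤3))
        where
        n′ : ℕ
        n′ = ℤ.∣ gauss u v ∣
        n≡ : n ≡ p ℕ.* n′
        n≡ = scaled-factor {k = p} (trans (sym e) (trans (cong₂ gauss ex ey) (trans (l s t′ u v) (cong (_* gauss u v) (norm-t′ t′-is))))) (gauss-pos u v)
        n′∣n : n′ ℕ.∣ n
        n′∣n = ℕ.divides p n≡
    split : (∃₂ λ s t → gauss s t ≡ + p) → GaussOutcome n x y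
    split (s , t , est) = [ (λ good → inj₁ (p , good , p∣n))
      , (λ s∨t → descend s t est s∨t (gauss-divide pp s t est x y (subst (+ p ∣ₛ_) (sym e) (∣ᵤ⇒∣ p∣n)))) ]′
      (gauss-prime-classify pp r s t est)

-- Unless a good prime is met, the factors removed are squares of primes 11 modulo 12, which are
-- inert in ℤ[ω], and primes 1 modulo 12; all are 1 modulo 4.
eis-good : ∀ n x y → eis x y ≡ + n → ¬ (2 ℕ.∣ n) → ¬ (3 ℕ.∣ n) → Good n ⊎ n % 4 ≡ 1
eis-good n = go n (<-wellFounded n)
  where
  go : ∀ n → Acc ℕ._<_ n → ∀ x y → eis x y ≡ + n → ¬ (2 ℕ.∣ n) → ¬ (3 ℕ.∣ n) → Good n ⊎ n % 4 ≡ 1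
  by-prime : ∀ n → Acc ℕ._<_ n → ∀ x y → eis x y ≡ + n → ¬ (2 ℕ.∣ n) → ¬ (3 ℕ.∣ n) → ∀ p → Prime p → p ℕ.∣ n →
    p % 12 ≡ 1 ⊎ p % 12 ≡ 5 ⊎ p % 12 ≡ 7 ⊎ p % 12 ≡ 11 → Good n ⊎ n % 4 ≡ 1
  descend : ∀ n → Acc ℕ._<_ n → ¬ (2 ℕ.∣ n) → ¬ (3 ℕ.∣ n) → ∀ k u v → 1 ℕ.< k → k % 4 ≡ 1 → n ≡ k ℕ.* ℤ.∣ eis u v ∣ → Good n ⊎ n % 4 ≡ 1
  descend n (acc rec) ∤2 ∤3 k u v 1<k k≡1 n≡ = Sum.map (Good-∣ n′∣n) mod4
      (go n′ (rec (cofactor-< k 1<k ∤2 n≡)) u v (eis-abs u v) (∤-divisor n′∣n ∤2) (∤-divisor n′∣n ∤3))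
    where
    n′ : ℕ
    n′ = ℤ.∣ eis u v ∣
    n′∣n : n′ ℕ.∣ n
    n′∣n = ℕ.divides k n≡
    mod4 : n′ % 4 ≡ 1 → n % 4 ≡ 1
    mod4 r = trans (cong (_% 4) n≡) (trans (ℕ.%-distribˡ-* k n′ 4) (cong₂ (λ a b → (a ℕ.* b) % 4) k≡1 r))
  go zero          _  x y e ∤2 ∤3 = ⊥-elim (∤2 (2 ℕ.∣0))
  go (suc zero)    _  x y e ∤2 ∤3 = inj₂ refl
  go n@(suc (suc _)) ac x y e ∤2 ∤3 = let p , pp , p∣n = prime-divisor n (s≤s (s≤s z≤n)) in
    by-prime n ac x y e ∤2 ∤3 p pp p∣n (coprime-mod-12 p (∤-divisor p∣n ∤2) (∤-divisor p∣n ∤3))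
  by-prime n _ x y e ∤2 ∤3 p pp p∣n (inj₂ (inj₁ r))        = inj₁ (p , inj₁ (pp , r) , p∣n)
  by-prime n _ x y e ∤2 ∤3 p pp p∣n (inj₂ (inj₂ (inj₁ r))) = inj₁ (p , inj₂ (inj₁ (pp , r)) , p∣n)
  by-prime n ac x y e ∤2 ∤3 p pp p∣n (inj₂ (inj₂ (inj₂ r))) =
      divided (eis-inert pp (proj₂ (11-mod-12 {p} r)) x y (subst (+ p ∣ₛ_) (sym e) (∣ᵤ⇒∣ p∣n)))
    where
    l : ∀ u v p → eis (u * p) (v * p) ≡ (p * p) * eis u v
    l = solve 3 (λ u v p → eisₑ (u ⊠ p) (v ⊠ p) ⊜ (p ⊠ p) ⊠ eisₑ u v) refl
    p²%4 : (p ℕ.* p) % 4 ≡ 1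
    p²%4 = trans (ℕ.%-distribˡ-* p p 4) (cong₂ (λ a b → (a ℕ.* b) % 4) (proj₁ (11-mod-12 {p} r)) (proj₁ (11-mod-12 {p} r)))
    divided : + p ∣ₛ x × + p ∣ₛ y → Good n ⊎ n % 4 ≡ 1
    divided (divides u eu , divides v ev) = descend n ac ∤2 ∤3 (p ℕ.* p) u v (1<p² pp) p²%4
      (scaled-factor {k = p ℕ.* p} (trans (sym e) (trans (cong₂ eis eu ev) (trans (l u v (+ p)) (cong (_* eis u v) (sym (pos-* p p)))))) (eis-abs u v))
  by-prime n ac x y e ∤2 ∤3 p pp p∣n (inj₁ r) = split (eis-represents-1-mod-3 pp (proj₂ (≡1-mod-12 p r)))
    where
    divided : (∃₂ λ u v → eis x y ≡ + p * eis u v) → Good n ⊎ n % 4 ≡ 1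
    divided (u , v , euv) = descend n ac ∤2 ∤3 p u v (prime⇒1< pp) (proj₁ (≡1-mod-12 p r)) (scaled-factor {k = p} (trans (sym e) euv) (eis-abs u v))
    split : (∃₂ λ s t → eis s t ≡ + p) → Good n ⊎ n % 4 ≡ 1
    split (s , t , est) = divided (eis-divide pp s t est x y (subst (+ p ∣ₛ_) (sym e) (∣ᵤ⇒∣ p∣n)))

-- Necessity

gauss-good-ℤ : ∀ x y → ¬ (+ 2 ∣ₛ gauss x y) → ¬ (+ 3 ∣ₛ gauss x y) → Good ℤ.∣ gauss x y ∣ ⊎ + 6 ∣ₛ x ⊎ + 6 ∣ₛ y
gauss-good-ℤ x y ∤2 ∤3 = gauss-good ℤ.∣ gauss x y ∣ x y (gauss-pos x y) (∤2 ∘ ∣ᵤ⇒∣) (∤3 ∘ ∣ᵤ⇒∣)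

eis-good-ℤ : ∀ x y → ¬ (+ 2 ∣ₛ eis x y) → ¬ (+ 3 ∣ₛ eis x y) → Good ℤ.∣ eis x y ∣ ⊎ + 4 ∣ₛ eis x y + - + 1
eis-good-ℤ x y ∤2 ∤3 = Sum.map₂ from-% (eis-good ℤ.∣ eis x y ∣ x y (eis-abs x y) (∤2 ∘ ∣ᵤ⇒∣) (∤3 ∘ ∣ᵤ⇒∣))
  where
  l : ∀ k → + 1 + k + - + 1 ≡ k
  l = solve-∀
  from-% : ℤ.∣ eis x y ∣ % 4 ≡ 1 → + 4 ∣ₛ eis x y + - + 1
  from-% r = divides (+ k) (trans (cong (_+ - + 1) (trans (eis-abs x y) (trans (cong +_ (trans (ℕ.m≡m%n+[m/n]*n ℤ.∣ eis x y ∣ 4) (cong (ℕ._+ k ℕ.* 4) r)))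
      (pos-+ 1 (k ℕ.* 4))))) (trans (l (+ (k ℕ.* 4))) (pos-* k 4)))
    where
    k : ℕ
    k = ℤ.∣ eis x y ∣ ℕ./ 4

∣-resp : ∀ {k x y} → x ≡ y → k ∣ₛ x → k ∣ₛ y
∣-resp = subst (_ ∣ₛ_)

∣-weaken : ∀ {x} k l → k * l ∣ₛ x → k ∣ₛ x
∣-weaken k l (divides q e) = divides (q * l) (trans e (lemma q k l))
  where
  lemma : ∀ q k l → q * (k * l) ≡ (q * l) * k
  lemma = solve-∀

6∣⇒3∣ : ∀ {x} → + 6 ∣ₛ x → + 3 ∣ₛ x
6∣⇒3∣ = ∣-weaken (+ 3) (+ 2)

6∣⇒2∣ : ∀ {x} → + 6 ∣ₛ x → + 2 ∣ₛ x
6∣⇒2∣ = ∣-weaken (+ 2) (+ 3)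

Good-factor : ∀ {x y} → y ∣ₛ x → Good ℤ.∣ y ∣ → Good ℤ.∣ x ∣
Good-factor d = Good-∣ (∣⇒∣ᵤ d)

∣-* : ∀ {i j x y} → i ∣ₛ x → j ∣ₛ y → i * j ∣ₛ x * y
∣-* {i} {j} (divides p e) (divides q e′) = divides (p * q) (trans (cong₂ _*_ e e′) (l p i q j))
  where
  l : ∀ p i q j → (p * i) * (q * j) ≡ (p * q) * (i * j)
  l = solve-∀

-- The congruences between the values of a group ring element at 1, -1, i, ω, -ω, iω that are
-- needed: u + iv is the relative norm to ℤ[i] of the value at iω.
record Congruences (a b r s A₀ A₁ C₀ C₁ β₀ β₁ β₂ β₃ : ℤ) : Set where
  field
    κ λ′ K L S T x y z₁ z₂ : ℤ
    r-ω : r ≡ β₀ + β₁ + + 3 * κ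
    s-ω : s ≡ β₂ + β₃ + + 3 * λ′
    a-ω : a ≡ A₀ + A₁ + + 3 * K
    b-ω : b ≡ C₀ + C₁ + + 3 * L
    a-S : a ≡ S + T
    b-S : b ≡ S + - T
    r-S : r ≡ S + + 2 * x
    s-T : s ≡ T + + 2 * y
    difference-ω : eis A₀ A₁ + - eis C₀ C₁ ≡ + 2 * tr β₀ β₁ β₂ β₃ + + 4 * z₁
    sum-ω : eis A₀ A₁ + eis C₀ C₁ ≡ + 2 * re₁₂ β₀ β₁ β₂ β₃ + + 4 * z₂

congruences : ∀ w → let v = spectrum ⟪ w ⟫ in
  Congruences (v (# 0)) (v (# 1)) (v (# 2)) (v (# 3)) (v (# 4)) (v (# 5)) (v (# 6)) (v (# 7)) (v (# 8)) (v (# 9)) (v (# 10)) (v (# 11))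
congruences w = record
  { κ = k₀ + - k₂ ; λ′ = k₁ + - k₃ ; K = k₀ + k₁ + k₂ + k₃ ; L = k₀ + - k₁ + k₂ + - k₃
  ; S = h₀ + h₂ ; T = h₁ + h₃ ; x = - h₂ ; y = - h₃
  -- By polarisation `c - c′` is twice the trace pairing of p₀ + p₂ with p₁ + p₃. Passing to p₀ - p₂
  -- and p₁ - p₃ changes the sign of the two cross terms collected in `z₁`; `z₂` arises in the same
  -- way from the parallelogram law.
  ; z₁ = tr p₀ q₀ p₃ q₃ + tr p₂ q₂ p₁ q₁
  ; z₂ = tr p₀ q₀ p₂ q₂ + eis p₁ q₁ + eis p₃ q₃
  ; r-ω = l₁ p₀ q₀ k₀ p₂ q₂ k₂ ; s-ω = l₁ p₁ q₁ k₁ p₃ q₃ k₃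
  ; a-ω = l₂ p₀ q₀ k₀ p₁ q₁ k₁ p₂ q₂ k₂ p₃ q₃ k₃ ; b-ω = l₃ p₀ q₀ k₀ p₁ q₁ k₁ p₂ q₂ k₂ p₃ q₃ k₃
  ; a-S = l₄ h₀ h₁ h₂ h₃ ; b-S = l₅ h₀ h₁ h₂ h₃ ; r-S = l₆ h₀ h₂ ; s-T = l₆ h₁ h₃
  ; difference-ω = l₇ p₀ q₀ p₁ q₁ p₂ q₂ p₃ q₃ ; sum-ω = l₈ p₀ q₀ p₁ q₁ p₂ q₂ p₃ q₃
  }
  where
  p₀ p₁ p₂ p₃ q₀ q₁ q₂ q₃ k₀ k₁ k₂ k₃ h₀ h₁ h₂ h₃ : ℤ
  p₀ = w (# 0) ; p₁ = w (# 1) ; p₂ = w (# 2) ; p₃ = w (# 3)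
  q₀ = w (# 4) ; q₁ = w (# 5) ; q₂ = w (# 6) ; q₃ = w (# 7)
  k₀ = w (# 8) ; k₁ = w (# 9) ; k₂ = w (# 10) ; k₃ = w (# 11)
  h₀ = p₀ + q₀ + + 3 * k₀ ; h₁ = p₁ + q₁ + + 3 * k₁ ; h₂ = p₂ + q₂ + + 3 * k₂ ; h₃ = p₃ + q₃ + + 3 * k₃
  l₁ : ∀ p₀ q₀ k₀ p₂ q₂ k₂ → (p₀ + q₀ + + 3 * k₀) + - (p₂ + q₂ + + 3 * k₂) ≡ (p₀ + - p₂) + (q₀ + - q₂) + + 3 * (k₀ + - k₂)
  l₁ = solve-∀
  l₂ : ∀ p₀ q₀ k₀ p₁ q₁ k₁ p₂ q₂ k₂ p₃ q₃ k₃ → (p₀ + q₀ + + 3 * k₀) + (p₁ + q₁ + + 3 * k₁) + (p₂ + q₂ + + 3 * k₂) + (p₃ + q₃ + + 3 * k₃)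
    ≡ (p₀ + p₁ + p₂ + p₃) + (q₀ + q₁ + q₂ + q₃) + + 3 * (k₀ + k₁ + k₂ + k₃)
  l₂ = solve-∀
  l₃ : ∀ p₀ q₀ k₀ p₁ q₁ k₁ p₂ q₂ k₂ p₃ q₃ k₃ → (p₀ + q₀ + + 3 * k₀) + - (p₁ + q₁ + + 3 * k₁) + (p₂ + q₂ + + 3 * k₂) + - (p₃ + q₃ + + 3 * k₃)
    ≡ (p₀ + - p₁ + p₂ + - p₃) + (q₀ + - q₁ + q₂ + - q₃) + + 3 * (k₀ + - k₁ + k₂ + - k₃)
  l₃ = solve-∀
  l₄ : ∀ h₀ h₁ h₂ h₃ → h₀ + h₁ + h₂ + h₃ ≡ (h₀ + h₂) + (h₁ + h₃)
  l₄ = solve-∀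
  l₅ : ∀ h₀ h₁ h₂ h₃ → h₀ + - h₁ + h₂ + - h₃ ≡ (h₀ + h₂) + - (h₁ + h₃)
  l₅ = solve-∀
  l₆ : ∀ h₀ h₂ → h₀ + - h₂ ≡ (h₀ + h₂) + + 2 * - h₂
  l₆ = solve-∀
  l₇ : ∀ p₀ q₀ p₁ q₁ p₂ q₂ p₃ q₃ → eis (p₀ + p₁ + p₂ + p₃) (q₀ + q₁ + q₂ + q₃) + - eis (p₀ + - p₁ + p₂ + - p₃) (q₀ + - q₁ + q₂ + - q₃)
    ≡ + 2 * tr (p₀ + - p₂) (q₀ + - q₂) (p₁ + - p₃) (q₁ + - q₃) + + 4 * (tr p₀ q₀ p₃ q₃ + tr p₂ q₂ p₁ q₁)
  l₇ = solve 8 (λ p₀ q₀ p₁ q₁ p₂ q₂ p₃ q₃ → eisₑ (p₀ ⊞ p₁ ⊞ p₂ ⊞ p₃) (q₀ ⊞ q₁ ⊞ q₂ ⊞ q₃) ⊞ ⊟ eisₑ (p₀ ⊞ ⊟ p₁ ⊞ p₂ ⊞ ⊟ p₃) (q₀ ⊞ ⊟ q₁ ⊞ q₂ ⊞ ⊟ q₃)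
    ⊜ Κ (+ 2) ⊠ trₑ (p₀ ⊞ ⊟ p₂) (q₀ ⊞ ⊟ q₂) (p₁ ⊞ ⊟ p₃) (q₁ ⊞ ⊟ q₃) ⊞ Κ (+ 4) ⊠ (trₑ p₀ q₀ p₃ q₃ ⊞ trₑ p₂ q₂ p₁ q₁)) refl
  l₈ : ∀ p₀ q₀ p₁ q₁ p₂ q₂ p₃ q₃ → eis (p₀ + p₁ + p₂ + p₃) (q₀ + q₁ + q₂ + q₃) + eis (p₀ + - p₁ + p₂ + - p₃) (q₀ + - q₁ + q₂ + - q₃)
    ≡ + 2 * re₁₂ (p₀ + - p₂) (q₀ + - q₂) (p₁ + - p₃) (q₁ + - q₃) + + 4 * (tr p₀ q₀ p₂ q₂ + eis p₁ q₁ + eis p₃ q₃)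
  l₈ = solve 8 (λ p₀ q₀ p₁ q₁ p₂ q₂ p₃ q₃ → eisₑ (p₀ ⊞ p₁ ⊞ p₂ ⊞ p₃) (q₀ ⊞ q₁ ⊞ q₂ ⊞ q₃) ⊞ eisₑ (p₀ ⊞ ⊟ p₁ ⊞ p₂ ⊞ ⊟ p₃) (q₀ ⊞ ⊟ q₁ ⊞ q₂ ⊞ ⊟ q₃)
    ⊜ Κ (+ 2) ⊠ re₁₂ₑ (p₀ ⊞ ⊟ p₂) (q₀ ⊞ ⊟ q₂) (p₁ ⊞ ⊟ p₃) (q₁ ⊞ ⊟ q₃) ⊞ Κ (+ 4) ⊠ (trₑ p₀ q₀ p₂ q₂ ⊞ eisₑ p₁ q₁ ⊞ eisₑ p₃ q₃)) refl

Parity : ℤ → Set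
Parity x = (∃ λ y → x ≡ + 2 * y) ⊎ (∃ λ y → x ≡ + 2 * y + + 1)

2∣? : ∀ x → Parity x
2∣? x = from (fin-residue 2 x)
  where
  from : Residue 2 x → Parity x
  from (zero , y , e)     = inj₁ (y , trans e (trans (+-identityˡ (y * + 2)) (*-comm y (+ 2))))
  from (suc zero , y , e) = inj₂ (y , trans e (trans (+-comm (+ 1) (y * + 2)) (cong (_+ + 1) (*-comm y (+ 2)))))

twice : ∀ {x} y → x ≡ + 2 * y → + 2 ∣ₛ x
twice y e = divides y (trans e (*-comm (+ 2) y))

odd-∤2 : ∀ y → ¬ (+ 2 ∣ₛ + 2 * y + + 1)
odd-∤2 y d = absurd (∣m+n∣m⇒∣n d (twice y refl))
  where
  absurd : ¬ (+ 2 ∣ₛ + 1)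
  absurd d with () ← ℕ.∣1⇒≡1 (∣⇒∣ᵤ d)

halve : ∀ {x} → + 2 ∣ₛ x → ∃ λ y → x ≡ + 2 * y
halve (divides y e) = y , trans e (*-comm y (+ 2))

pronic-even : ∀ i → ∃ λ t → i * (i + + 1) ≡ + 2 * t
pronic-even i = from (2∣? i)
  where
  l₀ : ∀ y → (+ 2 * y) * (+ 2 * y + + 1) ≡ + 2 * (y * (+ 2 * y + + 1))
  l₀ = solve-∀
  l₁ : ∀ y → (+ 2 * y + + 1) * (+ 2 * y + + 1 + + 1) ≡ + 2 * ((+ 2 * y + + 1) * (y + + 1))
  l₁ = solve-∀
  from : Parity i → ∃ λ t → i * (i + + 1) ≡ + 2 * t
  from (inj₁ (y , e)) = _ , trans (cong (λ i → i * (i + + 1)) e) (l₀ y)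
  from (inj₂ (y , e)) = _ , trans (cong (λ i → i * (i + + 1)) e) (l₁ y)

odd-cofactor : ∀ {p q} → ¬ (+ 2 ∣ₛ q) → + 2 ∣ₛ p * q → + 2 ∣ₛ p
odd-cofactor {p} {q} ∤ d = [ (λ z → z) , ⊥-elim ∘ ∤ ]′ (euclid prime[2] {p} {q} d)

gauss-∣² : ∀ {k x y} → k ∣ₛ x → k ∣ₛ y → k * k ∣ₛ gauss x y
gauss-∣² dx dy = ∣m∣n⇒∣m+n (∣-* dx dx) (∣-* dy dy)

gauss-parity : ∀ x y → + 2 ∣ₛ gauss x y → + 2 ∣ₛ x + y
gauss-parity x y d = [ (λ z → z) , (λ z → z) ]′ (euclid prime[2] {x + y} {x + y} (∣-resp (l x y) (∣m∣n⇒∣m+n d (∣m⇒∣m*n (x * y) (divides (+ 1) refl)))))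
  where
  l : ∀ x y → gauss x y + + 2 * (x * y) ≡ (x + y) * (x + y)
  l = solve 2 (λ x y → gaussₑ x y ⊞ Κ (+ 2) ⊠ (x ⊠ y) ⊜ (x ⊞ y) ⊠ (x ⊞ y)) refl

-- Modulo 1 - ω the element x + yω becomes x + y and conjugation becomes trivial, so its norm
-- becomes a square.
eis-trace : ∀ x y → eis x y ≡ (x + y) * (x + y) + + 3 * - (x * y)
eis-trace = solve 2 (λ x y → eisₑ x y ⊜ (x ⊞ y) ⊠ (x ⊞ y) ⊞ Κ (+ 3) ⊠ ⊟ (x ⊠ y)) refl

3∣3* : ∀ x → + 3 ∣ₛ + 3 * x
3∣3* x = divides x (*-comm (+ 3) x)

eis-3∣⇒ : ∀ x y → + 3 ∣ₛ eis x y → + 3 ∣ₛ x + y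
eis-3∣⇒ x y d = [ (λ z → z) , (λ z → z) ]′ (euclid prime[3] {x + y} {x + y} (∣m+n∣n⇒∣m (∣-resp (eis-trace x y) d) (3∣3* (- (x * y)))))

eis-3∣⇐ : ∀ x y → + 3 ∣ₛ x + y → + 3 ∣ₛ eis x y
eis-3∣⇐ x y d = ∣-resp (sym (eis-trace x y)) (∣m∣n⇒∣m+n (∣m⇒∣m*n (x + y) d) (3∣3* (- (x * y))))

re₁₂-trace : ∀ β₀ β₁ β₂ β₃ → re₁₂ β₀ β₁ β₂ β₃ ≡ (β₀ + β₁) * (β₀ + β₁) + - ((β₂ + β₃) * (β₂ + β₃)) + + 3 * (β₂ * β₃ + - (β₀ * β₁))
re₁₂-trace = solve 4 (λ β₀ β₁ β₂ β₃ → re₁₂ₑ β₀ β₁ β₂ β₃ ⊜ (β₀ ⊞ β₁) ⊠ (β₀ ⊞ β₁) ⊞ ⊟ ((β₂ ⊞ β₃) ⊠ (β₂ ⊞ β₃)) ⊞ Κ (+ 3) ⊠ (β₂ ⊠ β₃ ⊞ ⊟ (β₀ ⊠ β₁))) refl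

tr-trace : ∀ β₀ β₁ β₂ β₃ → tr β₀ β₁ β₂ β₃ ≡ + 2 * ((β₀ + β₁) * (β₂ + β₃)) + + 3 * - (β₀ * β₃ + β₁ * β₂)
tr-trace = solve 4 (λ β₀ β₁ β₂ β₃ → trₑ β₀ β₁ β₂ β₃ ⊜ Κ (+ 2) ⊠ ((β₀ ⊞ β₁) ⊠ (β₂ ⊞ β₃)) ⊞ Κ (+ 3) ⊠ ⊟ (β₀ ⊠ β₃ ⊞ β₁ ⊠ β₂)) refl

-- Division by 1 - ω.
eis-third : ∀ x y → + 3 ∣ₛ eis x y → ∃₂ λ x′ y′ → eis x y ≡ + 3 * eis x′ y′
eis-third x y d = from (eis-3∣⇒ x y d)
  where
  l : ∀ x y → y ≡ (x + y) + - x
  l = solve-∀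
  l′ : ∀ x w → eis x (w * + 3 + - x) ≡ + 3 * eis (x + - w) w
  l′ = solve 2 (λ x w → eisₑ x (w ⊠ Κ (+ 3) ⊞ ⊟ x) ⊜ Κ (+ 3) ⊠ eisₑ (x ⊞ ⊟ w) w) refl
  from : + 3 ∣ₛ x + y → ∃₂ λ x′ y′ → eis x y ≡ + 3 * eis x′ y′
  from (divides w e) = x + - w , w , trans (cong (eis x) (trans (l x y) (cong (_+ - x) e))) (l′ x w)

-- The norms of the values at ω and -ω cannot be 3 and 1 modulo 4 when v is even.
three-one : ∀ {A₀ A₁ C₀ C₁ v z} → eis A₀ A₁ + - eis C₀ C₁ ≡ + 2 * v + + 4 * z →
  ¬ (+ 2 ∣ₛ eis A₀ A₁) → ¬ (+ 2 ∣ₛ eis C₀ C₁) → ¬ (+ 3 ∣ₛ eis C₀ C₁) → + 3 ∣ₛ eis A₀ A₁ → ¬ (+ 9 ∣ₛ eis A₀ A₁) →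
  Good ℤ.∣ eis A₀ A₁ ∣ ⊎ Good ℤ.∣ eis C₀ C₁ ∣ ⊎ ¬ (+ 2 ∣ₛ v)
three-one {A₀} {A₁} {C₀} {C₁} {v} {z} e ∤2c ∤2c′ ∤3c′ 3∣c ∤9c = from (eis-third A₀ A₁ 3∣c)
  where
  l : ∀ i j v z → + 3 * (+ 1 + i * + 4) + - (+ 1 + j * + 4) ≡ + 2 * v + + 4 * z → + 2 * + 1 ≡ + 2 * (v + + 2 * (z + j + - (+ 3 * i)))
  l i j v z e = trans (l₁ i j) (trans (cong (_+ - (+ 4 * (+ 3 * i + - j))) e) (l₂ i j v z))
    where
    l₁ : ∀ i j → + 2 * + 1 ≡ + 3 * (+ 1 + i * + 4) + - (+ 1 + j * + 4) + - (+ 4 * (+ 3 * i + - j))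
    l₁ = solve-∀
    l₂ : ∀ i j v z → + 2 * v + + 4 * z + - (+ 4 * (+ 3 * i + - j)) ≡ + 2 * (v + + 2 * (z + j + - (+ 3 * i)))
    l₂ = solve-∀
  l₃ : ∀ x → x ≡ + 1 + (x + - + 1)
  l₃ = solve-∀
  one-mod-4 : ∀ {x} i → x + - + 1 ≡ i * + 4 → x ≡ + 1 + i * + 4
  one-mod-4 {x} i ei = trans (l₃ x) (cong (λ t → + 1 + t) ei)
  from : (∃₂ λ x′ y′ → eis A₀ A₁ ≡ + 3 * eis x′ y′) → Good ℤ.∣ eis A₀ A₁ ∣ ⊎ Good ℤ.∣ eis C₀ C₁ ∣ ⊎ ¬ (+ 2 ∣ₛ v)
  from (x′ , y′ , ec) = combine (eis-good-ℤ x′ y′ (λ d → ∤2c (∣-resp (sym ec) (∣n⇒∣m*n (+ 3) d))) (λ d → ∤9c (∣-resp (sym ec) (*-monoʳ-∣ (+ 3) d)))) (eis-good-ℤ C₀ C₁ ∤2c′ ∤3c′)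
    where
    combine : Good ℤ.∣ eis x′ y′ ∣ ⊎ + 4 ∣ₛ eis x′ y′ + - + 1 → Good ℤ.∣ eis C₀ C₁ ∣ ⊎ + 4 ∣ₛ eis C₀ C₁ + - + 1 →
      Good ℤ.∣ eis A₀ A₁ ∣ ⊎ Good ℤ.∣ eis C₀ C₁ ∣ ⊎ ¬ (+ 2 ∣ₛ v)
    combine (inj₁ good) _ = inj₁ (Good-factor (divides (+ 3) ec) good)
    combine (inj₂ _) (inj₁ good) = inj₂ (inj₁ good)
    combine (inj₂ (divides i ei)) (inj₂ (divides j ej)) = inj₂ (inj₂ λ 2∣v → 2∤1 (∣-resp (sym 1≡)
        (∣m∣n⇒∣m+n 2∣v (divides (z + j + - (+ 3 * i)) (*-comm (+ 2) (z + j + - (+ 3 * i)))))))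
      where
      1≡ : + 1 ≡ v + + 2 * (z + j + - (+ 3 * i))
      1≡ = *-cancelˡ-≡ (+ 2) (+ 1) _ (l i j v z (trans (cong₂ (λ c c′ → c + - c′) (sym (trans ec (cong (+ 3 *_) (one-mod-4 i ei)))) (sym (one-mod-4 j ej))) e))
      2∤1 : ¬ (+ 2 ∣ₛ + 1)
      2∤1 = odd-∤2 (+ 0)

module Necessity {a b r s A₀ A₁ C₀ C₁ β₀ β₁ β₂ β₃ : ℤ} (cong-s : Congruences a b r s A₀ A₁ C₀ C₁ β₀ β₁ β₂ β₃) where
  open Congruences cong-s

  private
    g c c′ u v f N R₁ R₂ : ℤ
    g = gauss r s
    c = eis A₀ A₁
    c′ = eis C₀ C₁
    u = re₁₂ β₀ β₁ β₂ β₃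
    v = tr β₀ β₁ β₂ β₃
    f = gauss u v
    N = a * (b * (g * (c * (c′ * f))))
    R₁ = β₀ + β₁
    R₂ = β₂ + β₃

    g∣N : g ∣ₛ N
    g∣N = ∣n⇒∣m*n a (∣n⇒∣m*n b (∣m⇒∣m*n _ ∣-refl))
    c∣N : c ∣ₛ N
    c∣N = ∣n⇒∣m*n a (∣n⇒∣m*n b (∣n⇒∣m*n g (∣m⇒∣m*n _ ∣-refl)))
    c′∣N : c′ ∣ₛ N
    c′∣N = ∣n⇒∣m*n a (∣n⇒∣m*n b (∣n⇒∣m*n g (∣n⇒∣m*n c (∣m⇒∣m*n _ ∣-refl))))
    f∣N : f ∣ₛ N
    f∣N = ∣n⇒∣m*n a (∣n⇒∣m*n b (∣n⇒∣m*n g (∣n⇒∣m*n c (∣n⇒∣m*n c′ ∣-refl))))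

    some-factor : ∀ {p} → Prime p → + p ∣ₛ N → + p ∣ₛ a ⊎ + p ∣ₛ b ⊎ + p ∣ₛ g ⊎ + p ∣ₛ c ⊎ + p ∣ₛ c′ ⊎ + p ∣ₛ f
    some-factor pp d = Sum.map₂ (λ d → Sum.map₂ (λ d → Sum.map₂ (λ d → Sum.map₂ (λ d → euclid pp {c′} {f} d)
      (euclid pp {c} {c′ * f} d)) (euclid pp {g} {c * (c′ * f)} d)) (euclid pp {b} {g * (c * (c′ * f))} d)) (euclid pp {a} {b * (g * (c * (c′ * f)))} d)

    u-R : u ≡ R₁ * R₁ + - (R₂ * R₂) + + 3 * (β₂ * β₃ + - (β₀ * β₁))
    u-R = re₁₂-trace β₀ β₁ β₂ β₃

    v-R : v ≡ + 2 * (R₁ * R₂) + + 3 * - (β₀ * β₃ + β₁ * β₂)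
    v-R = tr-trace β₀ β₁ β₂ β₃

    3∣r⇒ : + 3 ∣ₛ r → + 3 ∣ₛ R₁
    3∣r⇒ d = ∣m+n∣n⇒∣m (∣-resp r-ω d) (3∣3* κ)
    3∣s⇒ : + 3 ∣ₛ s → + 3 ∣ₛ R₂
    3∣s⇒ d = ∣m+n∣n⇒∣m (∣-resp s-ω d) (3∣3* λ′)
    3∣r⇐ : + 3 ∣ₛ R₁ → + 3 ∣ₛ r
    3∣r⇐ d = ∣-resp (sym r-ω) (∣m∣n⇒∣m+n d (3∣3* κ))
    3∣s⇐ : + 3 ∣ₛ R₂ → + 3 ∣ₛ s
    3∣s⇐ d = ∣-resp (sym s-ω) (∣m∣n⇒∣m+n d (3∣3* λ′))

    3∣v⇒ : + 3 ∣ₛ v → + 3 ∣ₛ R₁ ⊎ + 3 ∣ₛ R₂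
    3∣v⇒ d = [ (λ d → ⊥-elim (3∤2 d)) , euclid prime[3] {R₁} {R₂} ]′ (euclid prime[3] {+ 2} {R₁ * R₂} (∣m+n∣n⇒∣m (∣-resp v-R d) (3∣3* (- (β₀ * β₃ + β₁ * β₂)))))
      where
      3∤2 : ¬ (+ 3 ∣ₛ + 2)
      3∤2 d with ∣⇒∣ᵤ d
      ... | ℕ.divides (suc q) ()
    3∣v⇐ : + 3 ∣ₛ R₁ ⊎ + 3 ∣ₛ R₂ → + 3 ∣ₛ v
    3∣v⇐ d = ∣-resp (sym v-R) (∣m∣n⇒∣m+n (∣n⇒∣m*n (+ 2) ([ ∣m⇒∣m*n R₂ , ∣n⇒∣m*n R₁ ]′ d)) (3∣3* (- (β₀ * β₃ + β₁ * β₂))))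

    3∣g⇒ : + 3 ∣ₛ g → + 3 ∣ₛ r × + 3 ∣ₛ s
    3∣g⇒ = gauss-inert prime[3] refl r s

    -- The values at i and iω have the prime factor 3 simultaneously.
    81∣gf : + 3 ∣ₛ R₁ → + 3 ∣ₛ R₂ → + 81 ∣ₛ g * f
    81∣gf d₁ d₂ = ∣-* (gauss-∣² (3∣r⇐ d₁) (3∣s⇐ d₂))
      (gauss-∣² (∣-resp (sym u-R) (∣m∣n⇒∣m+n (∣m∣n⇒∣m-n (∣m⇒∣m*n R₁ d₁) (∣m⇒∣m*n R₂ d₂)) (3∣3* (β₂ * β₃ + - (β₀ * β₁))))) (3∣v⇐ (inj₁ d₁)))

    27∣-gf : + 3 ∣ₛ R₁ → + 3 ∣ₛ R₂ → + 27 ∣ₛ N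
    27∣-gf d₁ d₂ = ∣-resp (l a b g c c′ f) (∣n⇒∣m*n (a * b * c * c′) (∣-weaken (+ 27) (+ 3) (81∣gf d₁ d₂)))
      where
      l : ∀ a b g c c′ f → (a * b * c * c′) * (g * f) ≡ a * (b * (g * (c * (c′ * f))))
      l = solve-∀

    3∣g⇒27 : + 3 ∣ₛ g → + 27 ∣ₛ N
    3∣g⇒27 d = 27∣-gf (3∣r⇒ (proj₁ (3∣g⇒ d))) (3∣s⇒ (proj₂ (3∣g⇒ d)))

    -- Modulo 3, v is 2R₁R₂, which puts 3 into one of `R₁`, `R₂`, and u is R₁² - R₂², which puts it
    -- into the other.
    3∣f⇒27 : + 3 ∣ₛ f → + 27 ∣ₛ N
    3∣f⇒27 d = from (gauss-inert prime[3] refl u v d)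
      where
      square : ∀ {x} → + 3 ∣ₛ x * x → + 3 ∣ₛ x
      square {x} d = [ (λ z → z) , (λ z → z) ]′ (euclid prime[3] {x} {x} d)
      from : + 3 ∣ₛ u × + 3 ∣ₛ v → + 27 ∣ₛ N
      from (3∣u , 3∣v) = [ (λ d₁ → 27∣-gf d₁ (square (∣-resp (neg-involutive (R₂ * R₂)) (∣m⇒∣-m (∣m+n∣m⇒∣n difference-of-squares (∣m⇒∣m*n R₁ d₁))))))
          , (λ d₂ → 27∣-gf (square (∣m+n∣n⇒∣m difference-of-squares (∣m⇒∣-m (∣m⇒∣m*n R₂ d₂)))) d₂) ]′ (3∣v⇒ 3∣v)
        where
        difference-of-squares : + 3 ∣ₛ R₁ * R₁ + - (R₂ * R₂)
        difference-of-squares = ∣m+n∣n⇒∣m (∣-resp u-R 3∣u) (3∣3* (β₂ * β₃ + - (β₀ * β₁)))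

    3∣a⇔c : (+ 3 ∣ₛ a → + 3 ∣ₛ c) × (+ 3 ∣ₛ c → + 3 ∣ₛ a)
    3∣a⇔c = (λ d → eis-3∣⇐ A₀ A₁ (∣m+n∣n⇒∣m (∣-resp a-ω d) (3∣3* K))) , (λ d → ∣-resp (sym a-ω) (∣m∣n⇒∣m+n (eis-3∣⇒ A₀ A₁ d) (3∣3* K)))
    3∣b⇔c′ : (+ 3 ∣ₛ b → + 3 ∣ₛ c′) × (+ 3 ∣ₛ c′ → + 3 ∣ₛ b)
    3∣b⇔c′ = (λ d → eis-3∣⇐ C₀ C₁ (∣m+n∣n⇒∣m (∣-resp b-ω d) (3∣3* L))) , (λ d → ∣-resp (sym b-ω) (∣m∣n⇒∣m+n (eis-3∣⇒ C₀ C₁ d) (3∣3* L)))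

    ac-factor : ∀ {i j} → i ∣ₛ a → j ∣ₛ c → i * j ∣ₛ N
    ac-factor {i} {j} di dj = ∣-resp (l a b g c c′ f) (∣m⇒∣m*n (b * g * c′ * f) (∣-* di dj))
      where
      l : ∀ a b g c c′ f → (a * c) * (b * g * c′ * f) ≡ a * (b * (g * (c * (c′ * f))))
      l = solve-∀
    bc′-factor : ∀ {i j} → i ∣ₛ b → j ∣ₛ c′ → i * j ∣ₛ N
    bc′-factor {i} {j} di dj = ∣-resp (l a b g c c′ f) (∣m⇒∣m*n (a * g * c * f) (∣-* di dj))
      where
      l : ∀ a b g c c′ f → (b * c′) * (a * g * c * f) ≡ a * (b * (g * (c * (c′ * f))))
      l = solve-∀
    ac-b-factor : + 3 ∣ₛ a → + 3 ∣ₛ c → + 3 ∣ₛ b → + 27 ∣ₛ N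
    ac-b-factor da dc db = ∣-resp (l a b g c c′ f) (∣m⇒∣m*n (g * c′ * f) (∣-* (∣-* da dc) db))
      where
      l : ∀ a b g c c′ f → ((a * c) * b) * (g * c′ * f) ≡ a * (b * (g * (c * (c′ * f))))
      l = solve-∀

    -- As 3 is inert in ℤ[i], a factor 3 in `g` or `f` already forces 27. Otherwise it occurs in
    -- both of `a`, `c` or in both of `b`, `c′`, whose elements agree modulo 1 - ω.
    3-factor : + 3 ∣ₛ N → + 27 ∣ₛ N ⊎ (+ 3 ∣ₛ a × + 3 ∣ₛ c) ⊎ (+ 3 ∣ₛ b × + 3 ∣ₛ c′)
    3-factor d = from (some-factor prime[3] d)
      where
      from : + 3 ∣ₛ a ⊎ + 3 ∣ₛ b ⊎ + 3 ∣ₛ g ⊎ + 3 ∣ₛ c ⊎ + 3 ∣ₛ c′ ⊎ + 3 ∣ₛ f → + 27 ∣ₛ N ⊎ (+ 3 ∣ₛ a × + 3 ∣ₛ c) ⊎ (+ 3 ∣ₛ b × + 3 ∣ₛ c′)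
      from (inj₁ d) = inj₂ (inj₁ (d , proj₁ 3∣a⇔c d))
      from (inj₂ (inj₁ d)) = inj₂ (inj₂ (d , proj₁ 3∣b⇔c′ d))
      from (inj₂ (inj₂ (inj₁ d))) = inj₁ (3∣g⇒27 d)
      from (inj₂ (inj₂ (inj₂ (inj₁ d)))) = inj₂ (inj₁ (proj₂ 3∣a⇔c d , d))
      from (inj₂ (inj₂ (inj₂ (inj₂ (inj₁ d))))) = inj₂ (inj₂ (proj₂ 3∣b⇔c′ d , d))
      from (inj₂ (inj₂ (inj₂ (inj₂ (inj₂ d))))) = inj₁ (3∣f⇒27 d)

  3∣⇒9∣ : + 3 ∣ₛ N → + 9 ∣ₛ N
  3∣⇒9∣ d = [ ∣-weaken (+ 9) (+ 3) , [ (λ { (da , dc) → ac-factor da dc }) , (λ { (db , dc′) → bc′-factor db dc′ }) ]′ ]′ (3-factor d)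

  private
    -- With v odd, the value α = u + iv would be a unit modulo 6 by gauss-good; but its residue
    -- modulo 3 is the square of that of the value at i.
    v-odd-absurd : ¬ (+ 2 ∣ₛ N) → ¬ (+ 27 ∣ₛ N) → ¬ (+ 2 ∣ₛ v) → Good ℤ.∣ N ∣
    v-odd-absurd ∤2 ∤27 ∤2v = [ Good-factor g∣N , (λ rs → [ Good-factor f∣N , (λ uv → ⊥-elim (absurd rs uv)) ]′
        (gauss-good-ℤ u v (λ d → ∤2 (∣-trans d f∣N)) (∤27 ∘ 3∣f⇒27))) ]′ (gauss-good-ℤ r s (λ d → ∤2 (∣-trans d g∣N)) (∤27 ∘ 3∣g⇒27))
      where
      absurd : + 6 ∣ₛ r ⊎ + 6 ∣ₛ s → + 6 ∣ₛ u ⊎ + 6 ∣ₛ v → ⊥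
      absurd rs (inj₂ 6∣v) = ∤2v (6∣⇒2∣ 6∣v)
      absurd rs (inj₁ 6∣u) = ∤27 (3∣f⇒27 (∣-weaken (+ 3) (+ 3) (gauss-∣² (6∣⇒3∣ 6∣u) (3∣v⇐ (Sum.map (3∣r⇒ ∘ 6∣⇒3∣) (3∣s⇒ ∘ 6∣⇒3∣) rs)))))

  odd-good : ¬ (+ 2 ∣ₛ N) → + 3 ∣ₛ N → ¬ (+ 27 ∣ₛ N) → Good ℤ.∣ N ∣
  odd-good ∤2 3∣N ∤27 = from (3-factor 3∣N)
    where
    ∤2c : ¬ (+ 2 ∣ₛ c)
    ∤2c d = ∤2 (∣-trans d c∣N)
    ∤2c′ : ¬ (+ 2 ∣ₛ c′)
    ∤2c′ d = ∤2 (∣-trans d c′∣N)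
    finish : Good ℤ.∣ c ∣ ⊎ Good ℤ.∣ c′ ∣ ⊎ ¬ (+ 2 ∣ₛ v) → Good ℤ.∣ N ∣
    finish = [ Good-factor c∣N , [ Good-factor c′∣N , v-odd-absurd ∤2 ∤27 ]′ ]′
    -- Exchanging ω and -ω turns 2v into -2v, which is the same modulo 4.
    flipped : c′ + - c ≡ + 2 * v + + 4 * (- v + - z₁)
    flipped = trans (l₁ c c′) (trans (cong -_ difference-ω) (l₂ v z₁))
      where
      l₁ : ∀ c c′ → c′ + - c ≡ - (c + - c′)
      l₁ = solve-∀
      l₂ : ∀ v z → - (+ 2 * v + + 4 * z) ≡ + 2 * v + + 4 * (- v + - z)
      l₂ = solve-∀
    from : + 27 ∣ₛ N ⊎ (+ 3 ∣ₛ a × + 3 ∣ₛ c) ⊎ (+ 3 ∣ₛ b × + 3 ∣ₛ c′) → Good ℤ.∣ N ∣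
    from (inj₁ d) = ⊥-elim (∤27 d)
    from (inj₂ (inj₁ (da , dc))) = finish (three-one {A₀} {A₁} {C₀} {C₁} {v} {z₁} difference-ω ∤2c ∤2c′
      (λ d → ∤27 (ac-b-factor da dc (proj₂ 3∣b⇔c′ d))) dc (λ d → ∤27 (ac-factor da d)))
    from (inj₂ (inj₂ (db , dc′))) = finish (exchange (three-one {C₀} {C₁} {A₀} {A₁} {v} { - v + - z₁} flipped ∤2c′ ∤2c
      (λ d → ∤27 (ac-b-factor (proj₂ 3∣a⇔c d) d db)) dc′ (λ d → ∤27 (bc′-factor db d))))
      where
      exchange : ∀ {X Y Z : Set} → X ⊎ Y ⊎ Z → Y ⊎ X ⊎ Z
      exchange = [ inj₂ ∘ inj₁ , [ inj₁ , inj₂ ∘ inj₂ ]′ ]′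

  private
    c-parity : c ≡ u + v + + 2 * (z₁ + z₂)
    c-parity = *-cancelˡ-≡ (+ 2) c _ (trans (l₁ c c′) (trans (cong₂ _+_ sum-ω difference-ω) (l₂ u v z₁ z₂)))
      where
      l₁ : ∀ c c′ → + 2 * c ≡ (c + c′) + (c + - c′)
      l₁ = solve-∀
      l₂ : ∀ u v z₁ z₂ → (+ 2 * u + + 4 * z₂) + (+ 2 * v + + 4 * z₁) ≡ + 2 * (u + v + + 2 * (z₁ + z₂))
      l₂ = solve-∀

    c′-parity : c′ ≡ c + + 2 * - (v + + 2 * z₁)
    c′-parity = trans (l₁ c c′) (trans (cong (λ t → c + - t) difference-ω) (l₂ c v z₁))
      where
      l₁ : ∀ c c′ → c′ ≡ c + - (c + - c′)
      l₁ = solve-∀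
      l₂ : ∀ c v z → c + - (+ 2 * v + + 4 * z) ≡ c + + 2 * - (v + + 2 * z)
      l₂ = solve-∀

    2∣2* : ∀ x → + 2 ∣ₛ + 2 * x
    2∣2* x = twice x refl

    eis-2∣⇒4∣ : ∀ x y → + 2 ∣ₛ eis x y → + 4 ∣ₛ eis x y
    eis-2∣⇒4∣ x y d = from (eis-inert prime[2] refl x y d)
      where
      from : + 2 ∣ₛ x × + 2 ∣ₛ y → + 4 ∣ₛ eis x y
      from (dx , dy) = ∣m∣n⇒∣m+n (∣m∣n⇒∣m-n (∣-* dx dx) (∣-* dx dy)) (∣-* dy dy)

    half-of-4∣ : ∀ x y → + 4 ∣ₛ + 2 * x + + 4 * y → + 2 ∣ₛ x
    half-of-4∣ x y d = *-cancelˡ-∣ (+ 2) (∣m+n∣n⇒∣m d (divides y (*-comm (+ 4) y)))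

    2∣c⇒2∣c′ : + 2 ∣ₛ c → + 2 ∣ₛ c′
    2∣c⇒2∣c′ d = ∣-resp (sym c′-parity) (∣m∣n⇒∣m+n d (2∣2* (- (v + + 2 * z₁))))

    2∣c′⇒2∣c : + 2 ∣ₛ c′ → + 2 ∣ₛ c
    2∣c′⇒2∣c d = ∣m+n∣n⇒∣m (∣-resp c′-parity d) (2∣2* (- (v + + 2 * z₁)))

    2∣f⇒2∣c : + 2 ∣ₛ f → + 2 ∣ₛ c
    2∣f⇒2∣c d = ∣-resp (sym c-parity) (∣m∣n⇒∣m+n (gauss-parity u v d) (2∣2* (z₁ + z₂)))

    -- As 2 is inert in ℤ[ω], both `c` and `c′` are divisible by 4. The relations for their sum and
    -- difference then make `u` and `v` even, which gives a third factor 4 in `f`.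
    2∣c⇒64∣N : + 2 ∣ₛ c → + 64 ∣ₛ N
    2∣c⇒64∣N d = ∣n⇒∣m*n a (∣n⇒∣m*n b (∣n⇒∣m*n g (∣-* 4∣c (∣-* 4∣c′ (gauss-∣² 2∣u 2∣v)))))
      where
      4∣c : + 4 ∣ₛ c
      4∣c = eis-2∣⇒4∣ A₀ A₁ d
      4∣c′ : + 4 ∣ₛ c′
      4∣c′ = eis-2∣⇒4∣ C₀ C₁ (2∣c⇒2∣c′ d)
      2∣u : + 2 ∣ₛ u
      2∣u = half-of-4∣ u z₂ (∣-resp sum-ω (∣m∣n⇒∣m+n 4∣c 4∣c′))
      2∣v : + 2 ∣ₛ v
      2∣v = half-of-4∣ v z₁ (∣-resp difference-ω (∣m∣n⇒∣m-n 4∣c 4∣c′))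

    OddFactors : Set
    OddFactors = ¬ (+ 2 ∣ₛ c) × ¬ (+ 2 ∣ₛ c′) × ¬ (+ 2 ∣ₛ f)

    odd-factors : ¬ (+ 64 ∣ₛ N) → OddFactors
    odd-factors ∤64 = ∤64 ∘ 2∣c⇒64∣N , ∤64 ∘ 2∣c⇒64∣N ∘ 2∣c′⇒2∣c , ∤64 ∘ 2∣c⇒64∣N ∘ 2∣f⇒2∣c

    -- An odd norm from ℤ[i] which is the value at i up to a factor supported at 2.
    record OddPart : Set where
      field
        ρ σ k : ℤ
        -- Dividing r + is by 1 + i produces half the sum and half the difference of the
        -- coordinates, up to sign. The scale `k` is 2 or 4.
        sum-ρ : r + s ≡ k * ρ
        difference-σ : r + - s ≡ k * σ
        odd : ¬ (+ 2 ∣ₛ gauss ρ σ)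
        divides-N : gauss ρ σ ∣ₛ N

    g-split : ∀ ρ σ → gauss (ρ + σ) (ρ + - σ) ≡ + 2 * gauss ρ σ
    g-split = solve 2 (λ ρ σ → gaussₑ (ρ ⊞ σ) (ρ ⊞ ⊟ σ) ⊜ Κ (+ 2) ⊠ gaussₑ ρ σ) refl

    -- Divisibility by 16 and the odd part of the value at i come out of the same distinction by the
    -- parities of `S` and `T`, so they are obtained together.
    TwoAdic : Set
    TwoAdic = + 16 ∣ₛ N × (OddFactors → + 32 ∣ₛ N → ¬ (+ 64 ∣ₛ N) → OddPart)

    -- Here ab = S² - T² is a difference of odd squares, hence divisible by 8, and `g` is twice an
    -- odd norm.
    two-adic-odd : ∀ i j → S ≡ + 2 * i + + 1 → T ≡ + 2 * j + + 1 → TwoAdic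
    two-adic-odd i j eS eT = 16∣N , λ _ _ _ → record
        { ρ = ρ ; σ = σ ; k = + 2
        ; sum-ρ = trans (cong₂ _+_ er es) (l₁ i j x y)
        ; difference-σ = trans (cong₂ (λ r s → r + - s) er es) (l₂ i j x y)
        ; odd = odd
        ; divides-N = ∣-trans (divides (+ 2) eg) g∣N }
      where
      ρ σ : ℤ
      ρ = (i + x) + (j + y) + + 1
      σ = (i + x) + - (j + y)
      l₀ : ∀ i x → + 2 * i + + 1 + + 2 * x ≡ + 2 * (i + x) + + 1
      l₀ = solve-∀
      l₁ : ∀ i j x y → (+ 2 * (i + x) + + 1) + (+ 2 * (j + y) + + 1) ≡ + 2 * ((i + x) + (j + y) + + 1)
      l₁ = solve-∀
      l₂ : ∀ i j x y → (+ 2 * (i + x) + + 1) + - (+ 2 * (j + y) + + 1) ≡ + 2 * ((i + x) + - (j + y))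
      l₂ = solve-∀
      l₃ : ∀ m n → gauss (+ 2 * m + + 1) (+ 2 * n + + 1) ≡ + 2 * gauss (m + n + + 1) (m + - n)
      l₃ = solve 2 (λ m n → gaussₑ (Κ (+ 2) ⊠ m ⊞ Κ (+ 1)) (Κ (+ 2) ⊠ n ⊞ Κ (+ 1)) ⊜ Κ (+ 2) ⊠ gaussₑ (m ⊞ n ⊞ Κ (+ 1)) (m ⊞ ⊟ n)) refl
      l₄ : ∀ m n → (m + n + + 1) + (m + - n) ≡ + 2 * m + + 1
      l₄ = solve-∀
      l₅ : ∀ i j → (+ 2 * i + + 1 + (+ 2 * j + + 1)) * (+ 2 * i + + 1 + - (+ 2 * j + + 1)) ≡ + 4 * (i * (i + + 1) + - (j * (j + + 1)))
      l₅ = solve-∀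
      er : r ≡ + 2 * (i + x) + + 1
      er = trans r-S (trans (cong (_+ + 2 * x) eS) (l₀ i x))
      es : s ≡ + 2 * (j + y) + + 1
      es = trans s-T (trans (cong (_+ + 2 * y) eT) (l₀ j y))
      eg : g ≡ + 2 * gauss ρ σ
      eg = trans (cong₂ gauss er es) (l₃ (i + x) (j + y))
      odd : ¬ (+ 2 ∣ₛ gauss ρ σ)
      odd d = odd-∤2 (i + x) (∣-resp (l₄ (i + x) (j + y)) (gauss-parity ρ σ d))
      8∣ab : + 8 ∣ₛ a * b
      8∣ab = ∣-resp (sym (trans (cong₂ _*_ (trans a-S (cong₂ _+_ eS eT)) (trans b-S (cong₂ (λ S T → S + - T) eS eT))) (l₅ i j)))
        (*-monoʳ-∣ (+ 4) (∣m∣n⇒∣m-n (twice _ (proj₂ (pronic-even i))) (twice _ (proj₂ (pronic-even j)))))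
      16∣N : + 16 ∣ₛ N
      16∣N = ∣-resp (l a b g c c′ f) (∣m⇒∣m*n (c * (c′ * f)) (∣-* 8∣ab (twice (gauss ρ σ) eg)))
        where
        l : ∀ a b g c c′ f → ((a * b) * g) * (c * (c′ * f)) ≡ a * (b * (g * (c * (c′ * f))))
        l = solve-∀

    -- Now N = 16XYZ with `Z` odd under `OddFactors`. If 64 does not divide N, a further factor 2
    -- cannot come from `X`, whose two factors have equal parity; so it comes from `Y`, and half of
    -- `Y` is the odd norm.
    two-adic-even : ∀ i j → S ≡ + 2 * i → T ≡ + 2 * j → TwoAdic
    two-adic-even i j eS eT = divides (X * Y * Z) (trans eN (*-comm (+ 16) (X * Y * Z))) , odd-part
      where
      r′ s′ X Y Z : ℤ
      r′ = i + x
      s′ = j + y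
      X = (i + j) * (i + - j)
      Y = gauss r′ s′
      Z = c * (c′ * f)
      l₀ : ∀ i x → + 2 * i + + 2 * x ≡ + 2 * (i + x)
      l₀ = solve-∀
      l₁ : ∀ i j Y Z → (+ 2 * i + + 2 * j) * ((+ 2 * i + - (+ 2 * j)) * ((+ 4 * Y) * Z)) ≡ + 16 * ((i + j) * (i + - j) * Y * Z)
      l₁ = solve-∀
      l₂ : ∀ m n → gauss (+ 2 * m) (+ 2 * n) ≡ + 4 * gauss m n
      l₂ = solve 2 (λ m n → gaussₑ (Κ (+ 2) ⊠ m) (Κ (+ 2) ⊠ n) ⊜ Κ (+ 4) ⊠ gaussₑ m n) refl
      er : r ≡ + 2 * r′
      er = trans r-S (trans (cong (_+ + 2 * x) eS) (l₀ i x))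
      es : s ≡ + 2 * s′
      es = trans s-T (trans (cong (_+ + 2 * y) eT) (l₀ j y))
      eN : N ≡ + 16 * (X * Y * Z)
      eN = trans (cong₂ _*_ (trans a-S (cong₂ _+_ eS eT)) (cong₂ _*_ (trans b-S (cong₂ (λ S T → S + - T) eS eT))
        (cong (_* Z) (trans (cong₂ gauss er es) (l₂ r′ s′))))) (l₁ i j Y Z)
      l₃ : ∀ r s → + 2 * r + + 2 * s ≡ + 2 * (r + s)
      l₃ = solve-∀
      l₄ : ∀ ρ → + 2 * (+ 2 * ρ) ≡ + 4 * ρ
      l₄ = solve-∀
      l₅ : ∀ r s → + 2 * r + - (+ 2 * s) ≡ + 2 * (r + s + - (+ 2 * s))
      l₅ = solve-∀
      l₆ : ∀ ρ s → + 2 * (+ 2 * ρ + - (+ 2 * s)) ≡ + 4 * (ρ + - s)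
      l₆ = solve-∀
      l₇ : ∀ e q → + 32 * (e * q) ≡ + 32 * q * e
      l₇ = solve-∀
      l₈ : ∀ X e Z → + 16 * (X * (+ 2 * e) * Z) ≡ + 32 * (e * (X * Z))
      l₈ = solve-∀
      l₉ : ∀ ρ s → + 2 * ρ + - s ≡ ρ + (ρ + - s)
      l₉ = solve-∀
      l₁₀ : ∀ ρ s → s ≡ ρ + - (ρ + - s)
      l₁₀ = solve-∀
      l₁₁ : ∀ r s → r ≡ r + s + - s
      l₁₁ = solve-∀
      l₁₂ : ∀ i j → (i + j) + - (+ 2 * j) ≡ i + - j
      l₁₂ = solve-∀
      64∣ : + 4 ∣ₛ X * Y * Z → + 64 ∣ₛ N
      64∣ d = ∣-resp (sym eN) (*-monoʳ-∣ (+ 16) d)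
      odd-Z : OddFactors → ¬ (+ 2 ∣ₛ Z)
      odd-Z (∤c , ∤c′ , ∤f) d = [ ∤c , [ ∤c′ , ∤f ]′ ∘ euclid prime[2] {c′} {f} ]′ (euclid prime[2] {c} {c′ * f} d)
      same-parity : ∀ i j → + 2 ∣ₛ i + j → + 2 ∣ₛ i + - j
      same-parity i j d = ∣-resp (l₁₂ i j) (∣m∣n⇒∣m-n d (2∣2* j))
      4∣X : + 2 ∣ₛ X → + 4 ∣ₛ X
      4∣X d = [ (λ d → ∣-* d (same-parity i j d)) , (λ d → ∣-* (subst (λ j′ → + 2 ∣ₛ i + j′) (neg-involutive j) (same-parity i (- j) d)) d) ]′
        (euclid prime[2] {i + j} {i + - j} d)
      odd-Y : OddFactors → + 32 ∣ₛ N → ¬ (+ 2 ∣ₛ Y) → + 64 ∣ₛ N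
      odd-Y odds 32∣N ∤Y = 64∣ (∣m⇒∣m*n Z (∣m⇒∣m*n Y (4∣X (odd-cofactor {X} {Y} ∤Y
        (odd-cofactor {X * Y} {Z} (odd-Z odds) (*-cancelˡ-∣ (+ 16) (∣-resp eN 32∣N)))))))
      even-Y : ¬ (+ 64 ∣ₛ N) → (∃ λ ρ → r′ + s′ ≡ + 2 * ρ) → OddPart
      even-Y ∤64 (ρ , eρ) = record
          { ρ = ρ ; σ = ρ + - s′ ; k = + 4
          ; sum-ρ = trans (cong₂ _+_ er es) (trans (l₃ r′ s′) (trans (cong (+ 2 *_) eρ) (l₄ ρ)))
          ; difference-σ = trans (cong₂ (λ r s → r + - s) er es) (trans (l₅ r′ s′) (trans (cong (λ t → + 2 * (t + - (+ 2 * s′))) eρ) (l₆ ρ s′)))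
          ; odd = λ d → ∤64 (∣-resp (sym eN′) (*-monoʳ-∣ (+ 32) (∣m⇒∣m*n (X * Z) d)))
          ; divides-N = divides (+ 32 * (X * Z)) (trans eN′ (l₇ (gauss ρ (ρ + - s′)) (X * Z))) }
        where
        eY : Y ≡ + 2 * gauss ρ (ρ + - s′)
        eY = trans (cong₂ gauss (trans (l₁₁ r′ s′) (trans (cong (_+ - s′) eρ) (l₉ ρ s′))) (l₁₀ ρ s′)) (g-split ρ (ρ + - s′))
        eN′ : N ≡ + 32 * (gauss ρ (ρ + - s′) * (X * Z))
        eN′ = trans eN (trans (cong (λ Y → + 16 * (X * Y * Z)) eY) (l₈ X (gauss ρ (ρ + - s′)) Z))
      odd-part : OddFactors → + 32 ∣ₛ N → ¬ (+ 64 ∣ₛ N) → OddPart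
      odd-part odds 32∣N ∤64 = decide (+ 2 ∣? Y)
        where
        decide : Dec (+ 2 ∣ₛ Y) → OddPart
        decide (yes d) = even-Y ∤64 (halve (gauss-parity r′ s′ d))
        decide (no ∤Y) = ⊥-elim (∤64 (odd-Y odds 32∣N ∤Y))

    -- Modulo 2 each of `a`, `b` and r + s is S + T, which rules out mixed parities of `S` and `T`.
    S+T-even : + 2 ∣ₛ N → OddFactors → + 2 ∣ₛ S + T
    S+T-even d (∤c , ∤c′ , ∤f) = from (some-factor prime[2] d)
      where
      l₁ : ∀ S T → S + - T + + 2 * T ≡ S + T
      l₁ = solve-∀
      l₂ : ∀ S T x y → S + + 2 * x + (T + + 2 * y) ≡ S + T + + 2 * (x + y)
      l₂ = solve-∀
      from : + 2 ∣ₛ a ⊎ + 2 ∣ₛ b ⊎ + 2 ∣ₛ g ⊎ + 2 ∣ₛ c ⊎ + 2 ∣ₛ c′ ⊎ + 2 ∣ₛ f → + 2 ∣ₛ S + T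
      from (inj₁ d) = ∣-resp a-S d
      from (inj₂ (inj₁ d)) = ∣-resp (l₁ S T) (∣m∣n⇒∣m+n (∣-resp b-S d) (2∣2* T))
      from (inj₂ (inj₂ (inj₁ d))) = ∣m+n∣n⇒∣m (∣-resp (trans (cong₂ _+_ r-S s-T) (l₂ S T x y)) (gauss-parity r s d)) (2∣2* (x + y))
      from (inj₂ (inj₂ (inj₂ (inj₁ d)))) = ⊥-elim (∤c d)
      from (inj₂ (inj₂ (inj₂ (inj₂ (inj₁ d))))) = ⊥-elim (∤c′ d)
      from (inj₂ (inj₂ (inj₂ (inj₂ (inj₂ d))))) = ⊥-elim (∤f d)

    two-adic : + 2 ∣ₛ N → OddFactors → TwoAdic
    two-adic d odds = from (2∣? S) (2∣? T)
      where
      l₁ : ∀ i j → + 2 * i + (+ 2 * j + + 1) ≡ + 2 * (i + j) + + 1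
      l₁ = solve-∀
      l₂ : ∀ i j → + 2 * i + + 1 + + 2 * j ≡ + 2 * (i + j) + + 1
      l₂ = solve-∀
      from : Parity S → Parity T → TwoAdic
      from (inj₁ (i , eS)) (inj₁ (j , eT)) = two-adic-even i j eS eT
      from (inj₂ (i , eS)) (inj₂ (j , eT)) = two-adic-odd i j eS eT
      from (inj₁ (i , eS)) (inj₂ (j , eT)) = ⊥-elim (odd-∤2 (i + j) (∣-resp (trans (cong₂ _+_ eS eT) (l₁ i j)) (S+T-even d odds)))
      from (inj₂ (i , eS)) (inj₁ (j , eT)) = ⊥-elim (odd-∤2 (i + j) (∣-resp (trans (cong₂ _+_ eS eT) (l₂ i j)) (S+T-even d odds)))

  2∣⇒16∣ : + 2 ∣ₛ N → + 16 ∣ₛ N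
  2∣⇒16∣ d = decide (+ 2 ∣? c)
    where
    decide : Dec (+ 2 ∣ₛ c) → + 16 ∣ₛ N
    decide (yes 2∣c) = ∣-weaken (+ 16) (+ 4) (2∣c⇒64∣N 2∣c)
    decide (no  ∤c)  = proj₁ (two-adic d (∤c , ∤c ∘ 2∣c′⇒2∣c , ∤c ∘ 2∣f⇒2∣c))

  even-good : + 32 ∣ₛ N → ¬ (+ 64 ∣ₛ N) → ¬ (+ 3 ∣ₛ N) → Good ℤ.∣ N ∣
  even-good 32∣N ∤64 ∤3 = [ Good-factor c∣N , (λ c≡1 → [ Good-factor c′∣N , (λ c′≡1 → v-even (2∣v c≡1 c′≡1)) ]′
      (eis-good-ℤ C₀ C₁ (proj₁ (proj₂ odds)) (λ d → ∤3 (∣-trans d c′∣N)))) ]′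
      (eis-good-ℤ A₀ A₁ (proj₁ odds) (λ d → ∤3 (∣-trans d c∣N)))
    where
    odds : OddFactors
    odds = odd-factors ∤64
    part : OddPart
    part = proj₂ (two-adic (∣-weaken (+ 2) (+ 16) 32∣N) odds) odds 32∣N ∤64
    open OddPart part
    2∣v : + 4 ∣ₛ c + - + 1 → + 4 ∣ₛ c′ + - + 1 → + 2 ∣ₛ v
    2∣v dc dc′ = half-of-4∣ v z₁ (∣-resp (trans (l c c′) difference-ω) (∣m∣n⇒∣m-n dc dc′))
      where
      l : ∀ c c′ → c + - + 1 + - (c′ + - + 1) ≡ c + - c′
      l = solve-∀
    -- Through `k` the factor 3 of `ρ` or `σ` passes to r + s or r - s. Together with 3 dividing `r`
    -- or `s` it then divides both, hence `g`.
    3∣rs-absurd : + 3 ∣ₛ r ⊎ + 3 ∣ₛ s → + 3 ∣ₛ ρ ⊎ + 3 ∣ₛ σ → ⊥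
    3∣rs-absurd rs ρσ = ∤3 (∣-trans (∣-weaken (+ 3) (+ 3) (uncurry gauss-∣² (both rs ρσ))) g∣N)
      where
      combination : + 3 ∣ₛ ρ ⊎ + 3 ∣ₛ σ → + 3 ∣ₛ r + s ⊎ + 3 ∣ₛ r + - s
      combination = Sum.map (λ d → ∣-resp (sym sum-ρ) (∣n⇒∣m*n k d)) (λ d → ∣-resp (sym difference-σ) (∣n⇒∣m*n k d))
      both : + 3 ∣ₛ r ⊎ + 3 ∣ₛ s → + 3 ∣ₛ ρ ⊎ + 3 ∣ₛ σ → + 3 ∣ₛ r × + 3 ∣ₛ s
      both (inj₁ dr) ρσ = dr , [ (λ d → ∣m+n∣m⇒∣n d dr) , (λ d → ∣-resp (neg-involutive s) (∣m⇒∣-m (∣m+n∣m⇒∣n d dr))) ]′ (combination ρσ)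
      both (inj₂ ds) ρσ = [ (λ d → ∣m+n∣n⇒∣m d ds) , (λ d → ∣m+n∣n⇒∣m d (∣m⇒∣-m ds)) ]′ (combination ρσ) , ds
    v-even : + 2 ∣ₛ v → Good ℤ.∣ N ∣
    v-even 2∣v = [ Good-factor f∣N , (λ uv → [ Good-factor divides-N , (λ ρσ → ⊥-elim (absurd uv ρσ)) ]′
        (gauss-good-ℤ ρ σ odd (λ d → ∤3 (∣-trans d divides-N)))) ]′
        (gauss-good-ℤ u v (proj₂ (proj₂ odds)) (λ d → ∤3 (∣-trans d f∣N)))
      where
      -- With `v` even and `f` odd, `u` is odd, so 6 divides `v`. Modulo 3 this says that 3 divides
      -- `R₁` or `R₂`, that is `r` or `s`.
      absurd : + 6 ∣ₛ u ⊎ + 6 ∣ₛ v → + 6 ∣ₛ ρ ⊎ + 6 ∣ₛ σ → ⊥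
      absurd (inj₁ 6∣u) _ = proj₂ (proj₂ odds) (∣-weaken (+ 2) (+ 2) (gauss-∣² (6∣⇒2∣ 6∣u) 2∣v))
      absurd (inj₂ 6∣v) ρσ = 3∣rs-absurd (Sum.map 3∣r⇐ 3∣s⇐ (3∣v⇒ (6∣⇒3∣ 6∣v))) (Sum.map 6∣⇒3∣ 6∣⇒3∣ ρσ)

-- Families of determinants

realise : ∀ {n} (w v : Vec (Lin n) 12) {ok : True ((λ m i → eval (lookup spectrum i) (w ⟪ δ m ⟫)) ≋? (λ m i → (v ⟪ δ m ⟫) i))} →
  ∀ t {a b g c c′ f d} → eval (lookup v (# 0)) t ≡ a → eval (lookup v (# 1)) t ≡ b →
  gauss (eval (lookup v (# 2)) t) (eval (lookup v (# 3)) t) ≡ g →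
  eis (eval (lookup v (# 4)) t) (eval (lookup v (# 5)) t) ≡ c → eis (eval (lookup v (# 6)) t) (eval (lookup v (# 7)) t) ≡ c′ →
  norm₁₂ (eval (lookup v (# 8)) t) (eval (lookup v (# 9)) t) (eval (lookup v (# 10)) t) (eval (lookup v (# 11)) t) ≡ f →
  a * (b * (g * (c * (c′ * f)))) ≡ d → InS 12 d
realise w v {ok} t ea eb eg ec ec′ ef e = subst (InS 12) (trans (cong₂ _*_ ea (cong₂ _*_ eb (cong₂ _*_ eg (cong₂ _*_ ec (cong₂ _*_ ec′ ef))))) e)
  (family w v {ok} t)

constant : ∀ {n} → ℤ → Lin (suc n)
constant c = c · var zero

-- A group element of order four takes the value -1 at the character -1, and its values at the other
-- characters contribute norm 1; so multiplication by it changes the sign of `b` alone.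
InS-neg : ∀ {d} → InS 12 d → InS 12 (- d)
InS-neg {d} ins = from (InS⇒spectrum ins)
  where
  -- Multiplication by the group element 3, which acts trivially on the third roots of unity.
  shifted values : Vec (Lin 12) 12
  shifted = 𝐩 (# 3) ∷ 𝐩 (# 0) ∷ 𝐩 (# 1) ∷ 𝐩 (# 2) ∷ 𝐪 (# 3) ∷ 𝐪 (# 0) ∷ 𝐪 (# 1) ∷ 𝐪 (# 2) ∷ 𝐤 (# 3) ∷ 𝐤 (# 0) ∷ 𝐤 (# 1) ∷ 𝐤 (# 2) ∷ []
  values = s (# 0) ∷ ⊝ s (# 1) ∷ ⊝ s (# 3) ∷ s (# 2) ∷ s (# 4) ∷ s (# 5) ∷ ⊝ s (# 6) ∷ ⊝ s (# 7) ∷ ⊝ s (# 10) ∷ ⊝ s (# 11) ∷ s (# 8) ∷ s (# 9) ∷ []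
    where
    s : Fin 12 → Lin 12
    s = lookup spectrum
  gauss-turn : ∀ r s → gauss (- s) r ≡ gauss r s
  gauss-turn = solve 2 (λ r s → gaussₑ (⊟ s) r ⊜ gaussₑ r s) refl
  eis-neg : ∀ x y → eis (- x) (- y) ≡ eis x y
  eis-neg = solve 2 (λ x y → eisₑ (⊟ x) (⊟ y) ⊜ eisₑ x y) refl
  norm₁₂-turn : ∀ a b c d → norm₁₂ (- c) (- d) a b ≡ norm₁₂ a b c d
  norm₁₂-turn = solve 4 (λ a b c d → norm₁₂ₑ (⊟ c) (⊟ d) a b ⊜ norm₁₂ₑ a b c d) refl
  l : ∀ a b x → a * (- b * x) ≡ - (a * (b * x))
  l = solve-∀
  from : (∃ λ w → Δ (spectrum ⟪ w ⟫) ≡ d) → InS 12 (- d)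
  from (w , e) = realise shifted values w refl refl (gauss-turn (v (# 2)) (v (# 3))) refl (eis-neg (v (# 6)) (v (# 7)))
      (norm₁₂-turn (v (# 8)) (v (# 9)) (v (# 10)) (v (# 11)))
      (trans (l (v (# 0)) (v (# 1)) _) (cong -_ e))
    where
    v : Fin 12 → ℤ
    v = spectrum ⟪ w ⟫

unit-1 : ∀ n → InS 12 (+ 1 + + 12 * n)
unit-1 n = realise coefficients values (lookup (+ 1 ∷ n ∷ [])) refl refl refl refl refl refl (total n)
  where
  nᵥ : Lin 2
  nᵥ = var (# 1)
  coefficients values : Vec (Lin 2) 12
  coefficients =
      (constant (+ 1)) ∷ O ∷ O ∷ O
    ∷ O ∷ O ∷ O ∷ O
    ∷ nᵥ ∷ nᵥ ∷ nᵥ ∷ nᵥ ∷ []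
  values =
      (constant (+ 1) ⊕ + 12 · nᵥ) ∷ (constant (+ 1)) ∷ (constant (+ 1)) ∷ O
    ∷ (constant (+ 1)) ∷ O ∷ (constant (+ 1)) ∷ O
    ∷ (constant (+ 1)) ∷ O ∷ O ∷ O ∷ []
  total : ∀ n → (+ 1 + + 12 * n) * (+ 1 * (+ 1 * (+ 1 * (+ 1 * + 1)))) ≡ + 1 + + 12 * n
  total = solve-∀

-- For n = 0 the value at 1 is 5 and all others are units; the one at iω is a root of unity times 2
-- ± √3. Up to sign, 1 and 5 are all the classes prime to 12.
unit-5 : ∀ n → InS 12 (+ 5 + + 12 * n)
unit-5 n = realise coefficients values (lookup (+ 1 ∷ n ∷ [])) refl refl refl refl refl refl (total n)
  where
  nᵥ : Lin 2
  nᵥ = var (# 1)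
  coefficients values : Vec (Lin 2) 12
  coefficients =
      (constant (+ 1)) ∷ O ∷ (constant (- + 1)) ∷ (constant (+ 1))
    ∷ (constant (+ 1)) ∷ (constant (+ 1)) ∷ (constant (- + 1)) ∷ O
    ∷ nᵥ ∷ nᵥ ∷ (constant (+ 1) ⊕ nᵥ) ∷ nᵥ ∷ []
  values =
      (constant (+ 5) ⊕ + 12 · nᵥ) ∷ (constant (+ 1)) ∷ (constant (+ 1)) ∷ O
    ∷ (constant (+ 1)) ∷ (constant (+ 1)) ∷ (constant (- + 1)) ∷ (constant (- + 1))
    ∷ (constant (+ 2)) ∷ (constant (+ 2)) ∷ (constant (- + 1)) ∷ (constant (+ 1)) ∷ []
  total : ∀ n → (+ 5 + + 12 * n) * (+ 1 * (+ 1 * (+ 1 * (+ 1 * + 1)))) ≡ + 5 + + 12 * n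
  total = solve-∀

-- For n = 0 this is 1 + x + x³ with x of order four: the values at 1 and ω are 3, contributing 3
-- and 9, and the others have norm 1.
family-27 : ∀ n → InS 12 (- (+ 27 * (+ 1 + + 4 * n)))
family-27 n = realise coefficients values (lookup (+ 1 ∷ n ∷ [])) refl refl refl refl refl refl (total n)
  where
  nᵥ : Lin 2
  nᵥ = var (# 1)
  coefficients values : Vec (Lin 2) 12
  coefficients =
      (constant (+ 1)) ∷ (constant (+ 1)) ∷ O ∷ (constant (+ 1))
    ∷ O ∷ O ∷ O ∷ O
    ∷ nᵥ ∷ nᵥ ∷ nᵥ ∷ nᵥ ∷ []
  values =
      (constant (+ 3) ⊕ + 12 · nᵥ) ∷ (constant (- + 1)) ∷ (constant (+ 1)) ∷ O
    ∷ (constant (+ 3)) ∷ O ∷ (constant (- + 1)) ∷ O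
    ∷ (constant (+ 1)) ∷ O ∷ O ∷ O ∷ []
  total : ∀ n → (+ 3 + + 12 * n) * (- + 1 * (+ 1 * (+ 9 * (+ 1 * + 1)))) ≡ - (+ 27 * (+ 1 + + 4 * n))
  total = solve-∀

-- For n = 0 this is 1 - g with g a generator of the group. The norms of its values are 0, 2, 2, 3,
-- 1, 1, and the value 0 at the trivial character becomes 12n.
family-144 : ∀ n → InS 12 (+ 144 * n)
family-144 n = realise coefficients values (lookup (+ 1 ∷ n ∷ [])) refl refl refl refl refl refl (total n)
  where
  nᵥ : Lin 2
  nᵥ = var (# 1)
  coefficients values : Vec (Lin 2) 12
  coefficients =
      (constant (+ 1)) ∷ O ∷ O ∷ O
    ∷ O ∷ O ∷ O ∷ (constant (- + 1))
    ∷ nᵥ ∷ nᵥ ∷ nᵥ ∷ nᵥ ∷ []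
  values =
      (+ 12 · nᵥ) ∷ (constant (+ 2)) ∷ (constant (+ 1)) ∷ (constant (+ 1))
    ∷ (constant (+ 1)) ∷ (constant (- + 1)) ∷ (constant (+ 1)) ∷ (constant (+ 1))
    ∷ (constant (+ 1)) ∷ O ∷ O ∷ (constant (+ 1)) ∷ []
  total : ∀ n → (+ 12 * n) * (+ 2 * (+ 2 * (+ 3 * (+ 1 * + 1)))) ≡ + 144 * n
  total = solve-∀

-- For n = 0 this is 1 + x²(1 + y + y²) with x of order four and y of order three. The second term
-- vanishes wherever y goes to ω, leaving the values 4, 4 and -2 at 1, -1 and i.
family-64 : ∀ n → InS 12 (+ 64 * (+ 1 + + 3 * n))
family-64 n = realise coefficients values (lookup (+ 1 ∷ n ∷ [])) refl refl refl refl refl refl (total n)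
  where
  nᵥ : Lin 2
  nᵥ = var (# 1)
  coefficients values : Vec (Lin 2) 12
  coefficients =
      (constant (+ 1)) ∷ O ∷ O ∷ O
    ∷ O ∷ O ∷ O ∷ O
    ∷ nᵥ ∷ nᵥ ∷ (constant (+ 1) ⊕ nᵥ) ∷ nᵥ ∷ []
  values =
      (constant (+ 4) ⊕ + 12 · nᵥ) ∷ (constant (+ 4)) ∷ (constant (- + 2)) ∷ O
    ∷ (constant (+ 1)) ∷ O ∷ (constant (+ 1)) ∷ O
    ∷ (constant (+ 1)) ∷ O ∷ O ∷ O ∷ []
  total : ∀ n → (+ 4 + + 12 * n) * (+ 4 * (+ 4 * (+ 1 * (+ 1 * + 1)))) ≡ + 64 * (+ 1 + + 3 * n)
  total = solve-∀

-- For n = 0 this is x²(y + y²), with values 2, 2, -2 at 1, -1, i, and units elsewhere as ω + ω² =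
-- -1.
family-16 : ∀ n → InS 12 (+ 16 * (+ 1 + + 6 * n))
family-16 n = realise coefficients values (lookup (+ 1 ∷ n ∷ [])) refl refl refl refl refl refl (total n)
  where
  nᵥ : Lin 2
  nᵥ = var (# 1)
  coefficients values : Vec (Lin 2) 12
  coefficients =
      O ∷ O ∷ (constant (- + 1)) ∷ O
    ∷ O ∷ O ∷ O ∷ O
    ∷ nᵥ ∷ nᵥ ∷ (constant (+ 1) ⊕ nᵥ) ∷ nᵥ ∷ []
  values =
      (constant (+ 2) ⊕ + 12 · nᵥ) ∷ (constant (+ 2)) ∷ (constant (- + 2)) ∷ O
    ∷ (constant (- + 1)) ∷ O ∷ (constant (- + 1)) ∷ O
    ∷ (constant (+ 1)) ∷ O ∷ O ∷ O ∷ []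
  total : ∀ n → (+ 2 + + 12 * n) * (+ 2 * (+ 4 * (+ 1 * (+ 1 * + 1)))) ≡ + 16 * (+ 1 + + 6 * n)
  total = solve-∀

-- The value at i must agree modulo 3 with that of the unit 1 - iω, that is with 1 - i; hence the
-- class 1 + 2i. Opposite multiples of 1 + y + y² in degrees 0 and 2, or 1 and 3, move it by 6 and
-- leave the values at ±1 alone. The value 1 - ω at ω gives 3.
family-9-gauss : ∀ n k l {p} → gauss (+ 1 + + 6 * k) (+ 2 + + 6 * l) ≡ p → InS 12 (- (+ 9 * (+ 1 + + 4 * n) * p))
family-9-gauss n k l {p} e = realise coefficients values (lookup (+ 1 ∷ n ∷ k ∷ l ∷ [])) refl refl e refl refl refl (total n p)
  where
  nᵥ kᵥ lᵥ : Lin 4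
  nᵥ = var (# 1)
  kᵥ = var (# 2)
  lᵥ = var (# 3)
  coefficients values : Vec (Lin 4) 12
  coefficients =
      (constant (+ 1)) ∷ O ∷ O ∷ O
    ∷ O ∷ (constant (- + 1)) ∷ O ∷ O
    ∷ (nᵥ ⊕ kᵥ) ∷ (constant (+ 1) ⊕ nᵥ ⊕ lᵥ) ∷ (nᵥ ⊕ ⊝ kᵥ) ∷ (nᵥ ⊕ ⊝ lᵥ) ∷ []
  values =
      (constant (+ 3) ⊕ + 12 · nᵥ) ∷ (constant (- + 1)) ∷ (constant (+ 1) ⊕ + 6 · kᵥ) ∷ (constant (+ 2) ⊕ + 6 · lᵥ)
    ∷ (constant (+ 1)) ∷ (constant (- + 1)) ∷ (constant (+ 1)) ∷ (constant (+ 1))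
    ∷ (constant (+ 1)) ∷ O ∷ O ∷ (constant (- + 1)) ∷ []
  total : ∀ n p → (+ 3 + + 12 * n) * (- + 1 * (p * (+ 3 * (+ 1 * + 1)))) ≡ - (+ 9 * (+ 1 + + 4 * n) * p)
  total = solve-∀

-- The value at i is 1 + i times the given representation, so it contributes 2p; the values 2 + 12n
-- and 8 at 1 and -1 supply the remaining 16.
family-32-gauss : ∀ n k l {p} → gauss (+ 1 + + 6 * k) (+ 2 + + 6 * l) ≡ p → InS 12 (+ 32 * (+ 1 + + 6 * n) * p)
family-32-gauss n k l {p} e = realise coefficients values (lookup (+ 1 ∷ n ∷ k ∷ l ∷ [])) refl refl (trans (double k l) (cong (+ 2 *_) e)) refl refl refl (total n p)
  where
  nᵥ kᵥ lᵥ : Lin 4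
  nᵥ = var (# 1)
  kᵥ = var (# 2)
  lᵥ = var (# 3)
  coefficients values : Vec (Lin 4) 12
  coefficients =
      (constant (- + 1)) ∷ O ∷ O ∷ O
    ∷ O ∷ O ∷ O ∷ O
    ∷ (constant (+ 1) ⊕ nᵥ ⊕ kᵥ ⊕ ⊝ lᵥ) ∷ (nᵥ ⊕ kᵥ ⊕ lᵥ) ∷ (constant (+ 1) ⊕ nᵥ ⊕ ⊝ kᵥ ⊕ lᵥ) ∷ (constant (- + 1) ⊕ nᵥ ⊕ ⊝ kᵥ ⊕ ⊝ lᵥ) ∷ []
  values =
      (constant (+ 2) ⊕ + 12 · nᵥ) ∷ (constant (+ 8)) ∷ (constant (- + 1) ⊕ + 6 · kᵥ ⊕ (- + 6) · lᵥ) ∷ (constant (+ 3) ⊕ + 6 · kᵥ ⊕ + 6 · lᵥ)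
    ∷ (constant (- + 1)) ∷ O ∷ (constant (- + 1)) ∷ O
    ∷ (constant (- + 1)) ∷ O ∷ O ∷ O ∷ []
  double : ∀ k l → gauss (- + 1 + + 6 * k + - + 6 * l) (+ 3 + + 6 * k + + 6 * l) ≡ + 2 * gauss (+ 1 + + 6 * k) (+ 2 + + 6 * l)
  double = solve 2 (λ k l → gaussₑ (Κ (- + 1) ⊞ Κ (+ 6) ⊠ k ⊞ Κ (- + 6) ⊠ l) (Κ (+ 3) ⊞ Κ (+ 6) ⊠ k ⊞ Κ (+ 6) ⊠ l) ⊜ Κ (+ 2) ⊠ gaussₑ (Κ (+ 1) ⊞ Κ (+ 6) ⊠ k) (Κ (+ 2) ⊞ Κ (+ 6) ⊠ l)) refl
  total : ∀ n p → (+ 2 + + 12 * n) * (+ 8 * ((+ 2 * p) * (+ 1 * (+ 1 * + 1)))) ≡ + 32 * (+ 1 + + 6 * n) * p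
  total = solve-∀

-- The prime is the norm of the value at -ω. In this family it agrees modulo 4 with 1 + 2ω, the
-- value of norm 3 at ω, and its coordinate sum is 1 modulo 3 to match the value 1 at -1; these are
-- the conditions in `EisNormal`.
family-9-eis : ∀ n y m {p} → eis (+ 5 + - + 4 * y + + 12 * m) (+ 2 + + 4 * y) ≡ p → InS 12 (- (+ 9 * (+ 1 + - + 4 * n) * p))
family-9-eis n y m {p} e = realise coefficients values (lookup (+ 1 ∷ n ∷ y ∷ m ∷ [])) refl refl refl refl e refl (total n p)
  where
  nᵥ yᵥ mᵥ : Lin 4
  nᵥ = var (# 1)
  yᵥ = var (# 2)
  mᵥ = var (# 3)
  coefficients values : Vec (Lin 4) 12
  coefficients =
      (constant (+ 2) ⊕ ⊝ yᵥ ⊕ + 3 · mᵥ) ∷ (constant (- + 1) ⊕ yᵥ ⊕ (- + 3) · mᵥ) ∷ (constant (+ 1) ⊕ ⊝ yᵥ ⊕ + 3 · mᵥ) ∷ (constant (- + 1) ⊕ yᵥ ⊕ (- + 3) · mᵥ)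
    ∷ (constant (+ 1) ⊕ yᵥ) ∷ (⊝ yᵥ) ∷ (constant (+ 1) ⊕ yᵥ) ∷ (⊝ yᵥ)
    ∷ (constant (- + 1) ⊕ nᵥ ⊕ ⊝ mᵥ) ∷ (nᵥ ⊕ mᵥ) ∷ (constant (- + 1) ⊕ nᵥ ⊕ ⊝ mᵥ) ∷ (nᵥ ⊕ mᵥ) ∷ []
  values =
      (constant (- + 3) ⊕ + 12 · nᵥ) ∷ (constant (+ 1)) ∷ (constant (+ 1)) ∷ O
    ∷ (constant (+ 1)) ∷ (constant (+ 2)) ∷ (constant (+ 5) ⊕ (- + 4) · yᵥ ⊕ + 12 · mᵥ) ∷ (constant (+ 2) ⊕ + 4 · yᵥ)
    ∷ (constant (+ 1)) ∷ O ∷ O ∷ O ∷ []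
  total : ∀ n p → (- + 3 + + 12 * n) * (+ 1 * (+ 1 * (+ 3 * (p * + 1)))) ≡ - (+ 9 * (+ 1 + - + 4 * n) * p)
  total = solve-∀

-- The value at ω is now -1, so c - c′ = 1 - p is 2 modulo 4 for p ≡ 7 modulo 12. This requires `v`
-- odd, which the unit ω + i(1 + ω) at iω achieves with v = 1.
family-32-eis : ∀ n y m {p} → eis (+ 5 + - + 4 * y + + 12 * m) (+ 2 + + 4 * y) ≡ p → InS 12 (- (+ 32 * (+ 1 + + 6 * n) * p))
family-32-eis n y m {p} e = realise coefficients values (lookup (+ 1 ∷ n ∷ y ∷ m ∷ [])) refl refl refl refl e refl (total n p)
  where
  nᵥ yᵥ mᵥ : Lin 4
  nᵥ = var (# 1)
  yᵥ = var (# 2)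
  mᵥ = var (# 3)
  coefficients values : Vec (Lin 4) 12
  coefficients =
      (constant (+ 1) ⊕ ⊝ yᵥ ⊕ + 3 · mᵥ) ∷ (constant (- + 1) ⊕ yᵥ ⊕ (- + 3) · mᵥ) ∷ (constant (+ 1) ⊕ ⊝ yᵥ ⊕ + 3 · mᵥ) ∷ (constant (- + 2) ⊕ yᵥ ⊕ (- + 3) · mᵥ)
    ∷ (constant (+ 1) ⊕ yᵥ) ∷ (⊝ yᵥ) ∷ yᵥ ∷ (constant (- + 1) ⊕ ⊝ yᵥ)
    ∷ (constant (- + 1) ⊕ nᵥ ⊕ ⊝ mᵥ) ∷ (constant (+ 1) ⊕ nᵥ ⊕ mᵥ) ∷ (nᵥ ⊕ ⊝ mᵥ) ∷ (constant (+ 1) ⊕ nᵥ ⊕ mᵥ) ∷ []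
  values =
      (constant (+ 2) ⊕ + 12 · nᵥ) ∷ (constant (- + 2)) ∷ (constant (- + 2)) ∷ (constant (+ 2))
    ∷ (constant (- + 1)) ∷ O ∷ (constant (+ 5) ⊕ (- + 4) · yᵥ ⊕ + 12 · mᵥ) ∷ (constant (+ 2) ⊕ + 4 · yᵥ)
    ∷ O ∷ (constant (+ 1)) ∷ (constant (+ 1)) ∷ (constant (+ 1)) ∷ []
  total : ∀ n p → (+ 2 + + 12 * n) * (- + 2 * (+ 8 * (+ 1 * (p * + 1)))) ≡ - (+ 32 * (+ 1 + + 6 * n) * p)
  total = solve-∀

-- The value at iω is 1 modulo 2, to suit the values -1 at ω and -ω, and is 1 + 2i modulo 1 - ω, to
-- suit the value -2 + 2i at i. The latter contributes 8.
family-32-norm₁₂ : ∀ n i j k l {p} → norm₁₂ (+ 1 + + 6 * i + - + 2 * j) (+ 2 * j) (+ 2 + - + 2 * k + + 6 * l) (+ 2 * k) ≡ p → InS 12 (+ 32 * (+ 1 + + 6 * n) * p)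
family-32-norm₁₂ n i j k l {p} e = realise coefficients values (lookup (+ 1 ∷ n ∷ i ∷ j ∷ k ∷ l ∷ [])) refl refl refl refl refl e (total n p)
  where
  nᵥ iᵥ jᵥ kᵥ lᵥ : Lin 6
  nᵥ = var (# 1)
  iᵥ = var (# 2)
  jᵥ = var (# 3)
  kᵥ = var (# 4)
  lᵥ = var (# 5)
  coefficients values : Vec (Lin 6) 12
  coefficients =
      (+ 3 · iᵥ ⊕ ⊝ jᵥ) ∷ (constant (+ 1) ⊕ ⊝ kᵥ ⊕ + 3 · lᵥ) ∷ (constant (- + 1) ⊕ (- + 3) · iᵥ ⊕ jᵥ) ∷ (constant (- + 1) ⊕ kᵥ ⊕ (- + 3) · lᵥ)
    ∷ jᵥ ∷ kᵥ ∷ (⊝ jᵥ) ∷ (⊝ kᵥ)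
    ∷ (nᵥ ⊕ ⊝ iᵥ) ∷ (nᵥ ⊕ ⊝ lᵥ) ∷ (constant (+ 1) ⊕ nᵥ ⊕ iᵥ) ∷ (nᵥ ⊕ lᵥ) ∷ []
  values =
      (constant (+ 2) ⊕ + 12 · nᵥ) ∷ (constant (+ 2)) ∷ (constant (- + 2)) ∷ (constant (+ 2))
    ∷ (constant (- + 1)) ∷ O ∷ (constant (- + 1)) ∷ O
    ∷ (constant (+ 1) ⊕ + 6 · iᵥ ⊕ (- + 2) · jᵥ) ∷ (+ 2 · jᵥ) ∷ (constant (+ 2) ⊕ (- + 2) · kᵥ ⊕ + 6 · lᵥ) ∷ (+ 2 · kᵥ) ∷ []
  total : ∀ n p → (+ 2 + + 12 * n) * (+ 2 * (+ 8 * (+ 1 * (+ 1 * p)))) ≡ + 32 * (+ 1 + + 6 * n) * p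
  total = solve-∀

-- The factor 3 needs the value 1 - ω at ω, and modulo the prime above 2 this is 1 + iω. An element
-- in normal form is 1 there, so it is multiplied by that unit.
family-9-norm₁₂ : ∀ n i j k l {p} → norm₁₂ (+ 1 + + 6 * i + - + 2 * j) (+ 2 * j) (+ 2 + - + 2 * k + + 6 * l) (+ 2 * k) ≡ p → InS 12 (- (+ 9 * (+ 1 + + 4 * n) * p))
family-9-norm₁₂ n i j k l {p} e = realise coefficients values (lookup (+ 1 ∷ n ∷ i ∷ j ∷ k ∷ l ∷ [])) refl refl refl refl refl (trans (twist i j k l) e) (total n p)
  where
  nᵥ iᵥ jᵥ kᵥ lᵥ : Lin 6
  nᵥ = var (# 1)
  iᵥ = var (# 2)
  jᵥ = var (# 3)
  kᵥ = var (# 4)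
  lᵥ = var (# 5)
  coefficients values : Vec (Lin 6) 12
  coefficients =
      (constant (+ 1) ⊕ + 3 · iᵥ ⊕ ⊝ jᵥ ⊕ kᵥ) ∷ (constant (+ 1) ⊕ ⊝ jᵥ ⊕ ⊝ kᵥ ⊕ + 3 · lᵥ) ∷ ((- + 3) · iᵥ ⊕ jᵥ ⊕ ⊝ kᵥ) ∷ (constant (- + 1) ⊕ jᵥ ⊕ kᵥ ⊕ (- + 3) · lᵥ)
    ∷ (constant (- + 1) ⊕ jᵥ ⊕ + 2 · kᵥ ⊕ (- + 3) · lᵥ) ∷ (+ 3 · iᵥ ⊕ (- + 2) · jᵥ ⊕ kᵥ) ∷ (constant (+ 1) ⊕ ⊝ jᵥ ⊕ (- + 2) · kᵥ ⊕ + 3 · lᵥ) ∷ (constant (- + 1) ⊕ (- + 3) · iᵥ ⊕ + 2 · jᵥ ⊕ ⊝ kᵥ)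
    ∷ (nᵥ ⊕ ⊝ iᵥ ⊕ ⊝ kᵥ ⊕ lᵥ) ∷ (nᵥ ⊕ ⊝ iᵥ ⊕ jᵥ ⊕ ⊝ lᵥ) ∷ (nᵥ ⊕ iᵥ ⊕ kᵥ ⊕ ⊝ lᵥ) ∷ (constant (+ 1) ⊕ nᵥ ⊕ iᵥ ⊕ ⊝ jᵥ ⊕ lᵥ) ∷ []
  values =
      (constant (+ 3) ⊕ + 12 · nᵥ) ∷ (constant (- + 1)) ∷ (constant (- + 1)) ∷ O
    ∷ (constant (+ 1)) ∷ (constant (- + 1)) ∷ (constant (+ 1)) ∷ (constant (+ 1))
    ∷ (constant (+ 1) ⊕ + 6 · iᵥ ⊕ (- + 2) · jᵥ ⊕ + 2 · kᵥ) ∷ (constant (- + 2) ⊕ + 2 · jᵥ ⊕ + 4 · kᵥ ⊕ (- + 6) · lᵥ) ∷ (constant (+ 2) ⊕ (- + 2) · jᵥ ⊕ (- + 2) · kᵥ ⊕ + 6 · lᵥ) ∷ (constant (+ 1) ⊕ + 6 · iᵥ ⊕ (- + 4) · jᵥ ⊕ + 2 · kᵥ) ∷ []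
  -- Multiplication by the unit 1 + iω.
  twist : ∀ i j k l → norm₁₂ (+ 1 + + 6 * i + - + 2 * j + + 2 * k) (- + 2 + + 2 * j + + 4 * k + - + 6 * l) (+ 2 + - + 2 * j + - + 2 * k + + 6 * l) (+ 1 + + 6 * i + - + 4 * j + + 2 * k) ≡ norm₁₂ (+ 1 + + 6 * i + - + 2 * j) (+ 2 * j) (+ 2 + - + 2 * k + + 6 * l) (+ 2 * k)
  twist = solve 4 (λ i j k l → norm₁₂ₑ (Κ (+ 1) ⊞ Κ (+ 6) ⊠ i ⊞ Κ (- + 2) ⊠ j ⊞ Κ (+ 2) ⊠ k) (Κ (- + 2) ⊞ Κ (+ 2) ⊠ j ⊞ Κ (+ 4) ⊠ k ⊞ Κ (- + 6) ⊠ l) (Κ (+ 2) ⊞ Κ (- + 2) ⊠ j ⊞ Κ (- + 2) ⊠ k ⊞ Κ (+ 6) ⊠ l) (Κ (+ 1) ⊞ Κ (+ 6) ⊠ i ⊞ Κ (- + 4) ⊠ j ⊞ Κ (+ 2) ⊠ k) ⊜ norm₁₂ₑ (Κ (+ 1) ⊞ Κ (+ 6) ⊠ i ⊞ Κ (- + 2) ⊠ j) (Κ (+ 2) ⊠ j) (Κ (+ 2) ⊞ Κ (- + 2) ⊠ k ⊞ Κ (+ 6) ⊠ l) (Κ (+ 2) ⊠ k)) refl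
  total : ∀ n p → (+ 3 + + 12 * n) * (- + 1 * (+ 1 * (+ 3 * (+ 1 * p)))) ≡ - (+ 9 * (+ 1 + + 4 * n) * p)
  total = solve-∀

-- Normal forms of representations

-- Signs are free by `InS-neg`, so one residue class of each pair ±c suffices.
PlusMinus : ℤ → ℤ → ℤ → Set
PlusMinus c k x = ∃ λ n → x ≡ c + k * n ⊎ x ≡ - (c + k * n)

private
  plus : ∀ {x} c k a → x ≡ c + a * k → PlusMinus c k x
  plus c k a e = a , inj₁ (trans e (cong (λ t → c + t) (*-comm a k)))

  minus : ∀ {x} c k a → x ≡ k + - c + a * k → PlusMinus c k x
  minus c k a e = - a + - + 1 , inj₂ (trans e (l c k a))
    where
    l : ∀ c k a → k + - c + a * k ≡ - (c + k * (- a + - + 1))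
    l = solve-∀

  residue-∣ : ∀ {x d i n} a → x ≡ + i + a * + n → d ℕ.∣ i → d ℕ.∣ n → + d ∣ₛ x
  residue-∣ {i = i} {n = n} a e d∣i d∣n = ∣-resp (sym e) (∣m∣n⇒∣m+n {m = + i} (∣ᵤ⇒∣ {i = + i} d∣i) (∣n⇒∣m*n a (∣ᵤ⇒∣ {i = + n} d∣n)))

odd-plus-minus : ∀ x → ¬ (+ 2 ∣ₛ x) → PlusMinus (+ 1) (+ 4) x
odd-plus-minus x ∤2 = from (fin-residue 4 x)
  where
  from : Residue 4 x → PlusMinus (+ 1) (+ 4) x
  from (zero , a , e) = ⊥-elim (∤2 (residue-∣ {i = 0} a e (ℕ.divides 0 refl) (ℕ.divides 2 refl)))
  from (suc zero , a , e) = plus (+ 1) (+ 4) a e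
  from (suc (suc zero) , a , e) = ⊥-elim (∤2 (residue-∣ {i = 2} a e (ℕ.divides 1 refl) (ℕ.divides 2 refl)))
  from (suc (suc (suc zero)) , a , e) = minus (+ 1) (+ 4) a e

∤3-plus-minus : ∀ x → ¬ (+ 3 ∣ₛ x) → PlusMinus (+ 1) (+ 3) x
∤3-plus-minus x ∤3 = from (fin-residue 3 x)
  where
  from : Residue 3 x → PlusMinus (+ 1) (+ 3) x
  from (zero , a , e) = ⊥-elim (∤3 (residue-∣ {i = 0} a e (ℕ.divides 0 refl) (ℕ.divides 1 refl)))
  from (suc zero , a , e) = plus (+ 1) (+ 3) a e
  from (suc (suc zero) , a , e) = minus (+ 1) (+ 3) a e

coprime-6-plus-minus : ∀ x → ¬ (+ 2 ∣ₛ x) → ¬ (+ 3 ∣ₛ x) → PlusMinus (+ 1) (+ 6) x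
coprime-6-plus-minus x ∤2 ∤3 = from (fin-residue 6 x)
  where
  from : Residue 6 x → PlusMinus (+ 1) (+ 6) x
  from (zero , a , e) = ⊥-elim (∤2 (residue-∣ {i = 0} a e (ℕ.divides 0 refl) (ℕ.divides 3 refl)))
  from (suc zero , a , e) = plus (+ 1) (+ 6) a e
  from (suc (suc zero) , a , e) = ⊥-elim (∤2 (residue-∣ {i = 2} a e (ℕ.divides 1 refl) (ℕ.divides 3 refl)))
  from (suc (suc (suc zero)) , a , e) = ⊥-elim (∤3 (residue-∣ {i = 3} a e (ℕ.divides 1 refl) (ℕ.divides 2 refl)))
  from (suc (suc (suc (suc zero))) , a , e) = ⊥-elim (∤2 (residue-∣ {i = 4} a e (ℕ.divides 2 refl) (ℕ.divides 3 refl)))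
  from (suc (suc (suc (suc (suc zero)))) , a , e) = minus (+ 1) (+ 6) a e

coprime-6-mod-12 : ∀ x → ¬ (+ 2 ∣ₛ x) → ¬ (+ 3 ∣ₛ x) → PlusMinus (+ 1) (+ 12) x ⊎ PlusMinus (+ 5) (+ 12) x
coprime-6-mod-12 x ∤2 ∤3 = from (coprime-6-plus-minus x ∤2 ∤3)
  where
  l₀ : ∀ k → + 1 + + 6 * (+ 2 * k) ≡ + 1 + + 12 * k
  l₀ = solve-∀
  l₁ : ∀ k → + 1 + + 6 * (+ 2 * k + + 1) ≡ - (+ 5 + + 12 * (- k + - + 1))
  l₁ = solve-∀
  from : PlusMinus (+ 1) (+ 6) x → PlusMinus (+ 1) (+ 12) x ⊎ PlusMinus (+ 5) (+ 12) x
  from (n , e) = by-parity (2∣? n)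
    where
    by-parity : Parity n → PlusMinus (+ 1) (+ 12) x ⊎ PlusMinus (+ 5) (+ 12) x
    by-parity (inj₁ (k , en)) = inj₁ (k , Sum.map (λ e → trans e one) (λ e → trans e (cong -_ one)) e)
      where
      one : + 1 + + 6 * n ≡ + 1 + + 12 * k
      one = trans (cong (λ n → + 1 + + 6 * n) en) (l₀ k)
    by-parity (inj₂ (k , en)) = inj₂ (- k + - + 1 , Sum.swap (Sum.map (λ e → trans e five) (λ e → trans e (trans (cong -_ five) (neg-involutive _))) e))
      where
      five : + 1 + + 6 * n ≡ - (+ 5 + + 12 * (- k + - + 1))
      five = trans (cong (λ n → + 1 + + 6 * n) en) (l₁ k)

gauss-normal : ∀ {p} s t → gauss s t ≡ + p → p % 12 ≡ 5 → ∃₂ λ k l → gauss (+ 1 + + 6 * k) (+ 2 + + 6 * l) ≡ + p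
gauss-normal {p} s t e r = from (gauss-residues-6 p s t e)
  where
  table : ∀ (i j : Fin 6) → (toℕ i ℕ.* toℕ i ℕ.+ toℕ j ℕ.* toℕ j) % 12 ≡ 5 →
    ((i ≡ # 1 ⊎ i ≡ # 5) × (j ≡ # 2 ⊎ j ≡ # 4)) ⊎ ((j ≡ # 1 ⊎ j ≡ # 5) × (i ≡ # 2 ⊎ i ≡ # 4))
  table = toWitness {a? = F.all? λ i → F.all? λ j → ((toℕ i ℕ.* toℕ i ℕ.+ toℕ j ℕ.* toℕ j) % 12 ℕ.≟ 5) →-dec
    (((i F.≟ # 1 ⊎-dec i F.≟ # 5) ×-dec (j F.≟ # 2 ⊎-dec j F.≟ # 4)) ⊎-dec ((j F.≟ # 1 ⊎-dec j F.≟ # 5) ×-dec (i F.≟ # 2 ⊎-dec i F.≟ # 4)))} _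
  square : ∀ {s} c → PlusMinus c (+ 6) s → ∃ λ k → s * s ≡ (c + + 6 * k) * (c + + 6 * k)
  square c (k , inj₁ e) = k , cong (λ s → s * s) e
  square c (k , inj₂ e) = k , trans (cong (λ s → s * s) e) (l (c + + 6 * k))
    where
    l : ∀ x → - x * - x ≡ x * x
    l = solve-∀
  one : ∀ {s} (i : Fin 6) a → s ≡ + toℕ i + a * + 6 → i ≡ # 1 ⊎ i ≡ # 5 → PlusMinus (+ 1) (+ 6) s
  one i a e (inj₁ refl) = plus (+ 1) (+ 6) a e
  one i a e (inj₂ refl) = minus (+ 1) (+ 6) a e
  two : ∀ {s} (i : Fin 6) a → s ≡ + toℕ i + a * + 6 → i ≡ # 2 ⊎ i ≡ # 4 → PlusMinus (+ 2) (+ 6) s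
  two i a e (inj₁ refl) = plus (+ 2) (+ 6) a e
  two i a e (inj₂ refl) = minus (+ 2) (+ 6) a e
  build : ∀ s t → gauss s t ≡ + p → (∃ λ k → s * s ≡ (+ 1 + + 6 * k) * (+ 1 + + 6 * k)) → (∃ λ l → t * t ≡ (+ 2 + + 6 * l) * (+ 2 + + 6 * l)) →
    ∃₂ λ k l → gauss (+ 1 + + 6 * k) (+ 2 + + 6 * l) ≡ + p
  build s t e (k , ek) (l , el) = k , l , trans (cong₂ _+_ (sym ek) (sym el)) e
  from : GaussResidues 6 12 p s t →
    ∃₂ λ k l → gauss (+ 1 + + 6 * k) (+ 2 + + 6 * l) ≡ + p
  from (i , j , a , b , ea , eb , m) =
    [ (λ { (i∈ , j∈) → build s t e (square (+ 1) (one i a ea i∈)) (square (+ 2) (two j b eb j∈)) })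
    , (λ { (j∈ , i∈) → build t s (trans (+-comm (t * t) (s * s)) e) (square (+ 1) (one j b eb j∈)) (square (+ 2) (two i a ea i∈)) }) ]′ (table i j (trans m r))

eis-turn : ∀ s t → eis (t + - s) (- s) ≡ eis s t
eis-turn = solve 2 (λ s t → eisₑ (t ⊞ ⊟ s) (⊟ s) ⊜ eisₑ s t) refl

EisNormal : ℕ → Set
EisNormal p = ∃₂ λ y n → eis (+ 5 + - + 4 * y + + 12 * n) (+ 2 + + 4 * y) ≡ + p

-- Multiplication by units and conjugation bring a representation of p ≡ 7 (mod 12) to the normal form.
eis-normal : ∀ {p} s t → eis s t ≡ + p → p % 12 ≡ 7 → EisNormal p
eis-normal {p} s t e r = from-parity (2∣? s) (2∣? t)
  where
  p≡ : ∃ λ q → + p ≡ + 7 + q * + 12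
  p≡ = + (p ℕ./ 12) , trans (cong +_ (trans (ℕ.m≡m%n+[m/n]*n p 12) (cong (ℕ._+ p ℕ./ 12 ℕ.* 12) r))) (trans (pos-+ 7 (p ℕ./ 12 ℕ.* 12)) (cong (λ t → + 7 + t) (pos-* (p ℕ./ 12) 12)))
  q : ℤ
  q = proj₁ p≡
  ∤p : ∀ {d} → d ℕ.∣ 12 → ¬ (+ d ∣ₛ + 7) → ¬ (+ d ∣ₛ + p)
  ∤p d∣12 ∤7 d = ∤7 (∣m+n∣n⇒∣m (∣-resp (proj₂ p≡) d) (∣n⇒∣m*n q (∣ᵤ⇒∣ {i = + 12} d∣12)))
  3∤7 : ¬ (+ 3 ∣ₛ + 7)
  3∤7 d with ∣⇒∣ᵤ d
  ... | ℕ.divides (suc (suc (suc q))) ()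
  2∤p : ¬ (+ 2 ∣ₛ + p)
  2∤p = ∤p (ℕ.divides 6 refl) (odd-∤2 (+ 3))
  3∤p : ¬ (+ 3 ∣ₛ + p)
  3∤p = ∤p (ℕ.divides 4 refl) 3∤7
  -- Here x ≡ 1 and y ≡ 2 modulo 4, and only x + y ≡ 1 modulo 3 is missing.
  mod-3 : ∀ x y → eis (+ 1 + + 4 * x) (+ 2 + + 4 * y) ≡ + p → EisNormal p
  mod-3 x y e = from (fin-residue 3 (x + y))
    where
    l₁ : ∀ x y a → x + y ≡ a → + 1 + + 4 * x ≡ + 1 + + 4 * (a + - y)
    l₁ x y a e = cong (λ x → + 1 + + 4 * x) (trans (l x y) (cong (_+ - y) e))
      where
      l : ∀ x y → x ≡ (x + y) + - y
      l = solve-∀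
    l₂ : ∀ y n → + 1 + + 4 * (+ 1 + n * + 3 + - y) ≡ + 5 + - + 4 * y + + 12 * n
    l₂ = solve-∀
    3∣sum : ∀ x y → + 3 ∣ₛ x + y → + 3 ∣ₛ eis (+ 1 + + 4 * x) (+ 2 + + 4 * y)
    3∣sum x y d = eis-3∣⇐ (+ 1 + + 4 * x) (+ 2 + + 4 * y) (∣-resp (l x y) (∣m∣n⇒∣m+n (∣n⇒∣m*n (+ 4) d) (divides (+ 1) refl)))
      where
      l : ∀ x y → + 4 * (x + y) + + 3 ≡ (+ 1 + + 4 * x) + (+ 2 + + 4 * y)
      l = solve-∀
    conjugate : ∀ x y → eis (y + - x) y ≡ eis x y
    conjugate = solve 2 (λ x y → eisₑ (y ⊞ ⊟ x) y ⊜ eisₑ x y) refl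
    l₄ : ∀ x y n → x + y ≡ + 2 + n * + 3 → (+ 2 + + 4 * y) + - (+ 1 + + 4 * x) ≡ + 5 + - + 4 * y + + 12 * (y + - + 1 + - n)
    l₄ x y n e = trans (l x y) (trans (cong (λ t → + 1 + + 8 * y + - (+ 4 * t)) e) (l′ y n))
      where
      l : ∀ x y → (+ 2 + + 4 * y) + - (+ 1 + + 4 * x) ≡ + 1 + + 8 * y + - (+ 4 * (x + y))
      l = solve-∀
      l′ : ∀ y n → + 1 + + 8 * y + - (+ 4 * (+ 2 + n * + 3)) ≡ + 5 + - + 4 * y + + 12 * (y + - + 1 + - n)
      l′ = solve-∀
    from : Residue 3 (x + y) → EisNormal p
    from (zero , n , es) = ⊥-elim (3∤p (∣-resp e (3∣sum x y (divides n (trans es (+-identityˡ (n * + 3)))))))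
    from (suc zero , n , es) = y , n , trans (cong (λ X → eis X (+ 2 + + 4 * y)) (sym (trans (l₁ x y (+ 1 + n * + 3) es) (l₂ y n)))) e
    from (suc (suc zero) , n , es) = y , y + - + 1 + - n , trans (cong (λ X → eis X (+ 2 + + 4 * y)) (sym (l₄ x y n es)))
      (trans (conjugate (+ 1 + + 4 * x) (+ 2 + + 4 * y)) e)
  -- An even second coordinate is 2 modulo 4 because p ≡ 3 modulo 4.
  mod-4 : ∀ x y → ¬ (+ 2 ∣ₛ x) → eis x (+ 2 * y) ≡ + p → EisNormal p
  mod-4 x y ∤x e = from (odd-plus-minus x ∤x) (2∣? y)
    where
    -- The cofactor showing that the form at (1 + 4n, 4i) differs from 7 + 12q by 2 modulo 4, so
    -- that it cannot be `p`.
    W : ℤ → ℤ → ℤ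
    W n i = + 2 * n + + 4 * (n * n) + - i + - (+ 4 * (n * i)) + + 4 * (i * i) + - (+ 3 * q) + - + 2
    l₀ : ∀ n i q → eis (+ 1 + + 4 * n) (+ 2 * (+ 2 * i)) + - (+ 7 + q * + 12) ≡ + 2 * (+ 2 * (+ 2 * n + + 4 * (n * n) + - i + - (+ 4 * (n * i)) + + 4 * (i * i) + - (+ 3 * q) + - + 2) + + 1)
    l₀ = solve 3 (λ n i q → eisₑ (Κ (+ 1) ⊞ Κ (+ 4) ⊠ n) (Κ (+ 2) ⊠ (Κ (+ 2) ⊠ i)) ⊞ ⊟ (Κ (+ 7) ⊞ q ⊠ Κ (+ 12))
      ⊜ Κ (+ 2) ⊠ (Κ (+ 2) ⊠ (Κ (+ 2) ⊠ n ⊞ Κ (+ 4) ⊠ (n ⊠ n) ⊞ ⊟ i ⊞ ⊟ (Κ (+ 4) ⊠ (n ⊠ i)) ⊞ Κ (+ 4) ⊠ (i ⊠ i) ⊞ ⊟ (Κ (+ 3) ⊠ q) ⊞ ⊟ Κ (+ 2)) ⊞ Κ (+ 1))) refl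
    negate : ∀ x y → eis (- x) (- y) ≡ eis x y
    negate = solve 2 (λ x y → eisₑ (⊟ x) (⊟ y) ⊜ eisₑ x y) refl
    not-4∣ : ∀ n i → eis (+ 1 + + 4 * n) (+ 2 * (+ 2 * i)) ≢ + p
    not-4∣ n i e = odd-∤2 (W n i) (*-cancelˡ-∣ (+ 2) {+ 2} {+ 2 * W n i + + 1} (∣-resp (trans (sym (+-inverseʳ (+ p))) (trans (cong₂ (λ u v → u + - v) (sym e) (proj₂ p≡)) (l₀ n i q))) (divides (+ 0) refl)))
    l₁ : ∀ i → + 2 * (+ 2 * i + + 1) ≡ + 2 + + 4 * i
    l₁ = solve-∀
    l₂ : ∀ i → - (+ 2 * (+ 2 * i + + 1)) ≡ + 2 + + 4 * (- i + - + 1)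
    l₂ = solve-∀
    l₃ : ∀ i → - (+ 2 * (+ 2 * i)) ≡ + 2 * (+ 2 * - i)
    l₃ = solve-∀
    positive : ∀ n → x ≡ - (+ 1 + + 4 * n) → ∀ {t} → - (+ 2 * y) ≡ t → eis (+ 1 + + 4 * n) t ≡ + p
    positive n ex et = trans (cong₂ eis (sym (trans (cong -_ ex) (neg-involutive (+ 1 + + 4 * n)))) (sym et)) (trans (negate x (+ 2 * y)) e)
    from : PlusMinus (+ 1) (+ 4) x → Parity y → EisNormal p
    from (n , inj₁ ex) (inj₁ (i , ey)) = ⊥-elim (not-4∣ n i (trans (cong₂ (λ x y → eis x (+ 2 * y)) (sym ex) (sym ey)) e))
    from (n , inj₁ ex) (inj₂ (i , ey)) = mod-3 n i (trans (cong₂ eis (sym ex) (sym (trans (cong (+ 2 *_) ey) (l₁ i)))) e)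
    from (n , inj₂ ex) (inj₁ (i , ey)) = ⊥-elim (not-4∣ n (- i) (positive n ex (trans (cong (λ y → - (+ 2 * y)) ey) (l₃ i))))
    from (n , inj₂ ex) (inj₂ (i , ey)) = mod-3 n (- i + - + 1) (positive n ex (trans (cong (λ y → - (+ 2 * y)) ey) (l₂ i)))
  not-both : ∀ x y → eis x y ≡ + p → + 2 ∣ₛ x → + 2 ∣ₛ y → ⊥
  not-both x y e dx dy = 2∤p (∣-resp e (∣m∣n⇒∣m+n (∣m∣n⇒∣m-n (∣m⇒∣m*n x dx) (∣m⇒∣m*n y dx)) (∣m⇒∣m*n y dy)))
  second-even : ∀ x y {z} → eis x y ≡ + p → y ≡ + 2 * z → EisNormal p
  second-even x y {z} e ey = mod-4 x z (λ dx → not-both x y e dx (twice z ey)) (trans (cong (eis x) (sym ey)) e)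
  l₁ : ∀ i → - (+ 2 * i) ≡ + 2 * - i
  l₁ = solve-∀
  l₂ : ∀ i j → - ((+ 2 * j + + 1) + - (+ 2 * i + + 1)) ≡ + 2 * (i + - j)
  l₂ = solve-∀
  from-parity : Parity s → Parity t → EisNormal p
  -- The unit in `eis-turn` permutes the three nonzero classes modulo 2 cyclically; at most two
  -- turns make the second coordinate even.
  from-parity _ (inj₁ (j , et)) = second-even s t e et
  from-parity (inj₁ (i , es)) _ = second-even (t + - s) (- s) (trans (eis-turn s t) e) (trans (cong -_ es) (l₁ i))
  from-parity (inj₂ (i , es)) (inj₂ (j , et)) = second-even (- s + - (t + - s)) (- (t + - s))
    (trans (eis-turn (t + - s) (- s)) (trans (eis-turn s t) e)) (trans (cong₂ (λ s t → - (t + - s)) es et) (l₂ i j))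

GoodPrime⇒Prime : ∀ {p} → GoodPrime p → Prime p
GoodPrime⇒Prime (inj₁ (pp , _))        = pp
GoodPrime⇒Prime (inj₂ (inj₁ (pp , _))) = pp
GoodPrime⇒Prime (inj₂ (inj₂ (pp , _))) = pp

¬Good-1 : ¬ Good 1
¬Good-1 (p , good , p∣1) = ℕ.<-irrefl (sym (ℕ.∣1⇒≡1 p∣1)) (prime⇒1< (GoodPrime⇒Prime good))

Norm₁₂Normal : ℕ → Set
Norm₁₂Normal p = ∃₂ λ i j → ∃₂ λ k l → norm₁₂ (+ 1 + + 6 * i + - + 2 * j) (+ 2 * j) (+ 2 + - + 2 * k + + 6 * l) (+ 2 * k) ≡ + p

module _ {p : ℕ} (2∤p : ¬ (+ 2 ∣ₛ + p)) (3∤p : ¬ (+ 3 ∣ₛ + p)) where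
  private
    record Rep (b₀ b₁ b₂ b₃ : ℤ) : Set where
      constructor rep
      field
        norm : norm₁₂ b₀ b₁ b₂ b₃ ≡ + p
        3∣re : + 3 ∣ₛ re₁₂ b₀ b₁ b₂ b₃

    transport : ∀ {b₀ b₁ b₂ b₃ c₀ c₁ c₂ c₃} → re₁₂ c₀ c₁ c₂ c₃ ≡ re₁₂ b₀ b₁ b₂ b₃ → norm₁₂ c₀ c₁ c₂ c₃ ≡ norm₁₂ b₀ b₁ b₂ b₃ →
      Rep b₀ b₁ b₂ b₃ → Rep c₀ c₁ c₂ c₃
    transport er en (rep n d) = rep (trans en n) (∣-resp (sym er) d)

    omega : ∀ {b₀ b₁ b₂ b₃} → Rep b₀ b₁ b₂ b₃ → Rep (- b₁) (b₀ + - b₁) (- b₃) (b₂ + - b₃)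
    omega {b₀} {b₁} {b₂} {b₃} = transport (l₁ b₀ b₁ b₂ b₃) (l₂ b₀ b₁ b₂ b₃)
      where
      l₁ : ∀ a b c d → re₁₂ (- b) (a + - b) (- d) (c + - d) ≡ re₁₂ a b c d
      l₁ = solve 4 (λ a b c d → re₁₂ₑ (⊟ b) (a ⊞ ⊟ b) (⊟ d) (c ⊞ ⊟ d) ⊜ re₁₂ₑ a b c d) refl
      l₂ : ∀ a b c d → norm₁₂ (- b) (a + - b) (- d) (c + - d) ≡ norm₁₂ a b c d
      l₂ = solve 4 (λ a b c d → norm₁₂ₑ (⊟ b) (a ⊞ ⊟ b) (⊟ d) (c ⊞ ⊟ d) ⊜ norm₁₂ₑ a b c d) refl

    negate : ∀ {b₀ b₁ b₂ b₃} → Rep b₀ b₁ b₂ b₃ → Rep (- b₀) (- b₁) (- b₂) (- b₃)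
    negate {b₀} {b₁} {b₂} {b₃} = transport (l₁ b₀ b₁ b₂ b₃) (l₂ b₀ b₁ b₂ b₃)
      where
      l₁ : ∀ a b c d → re₁₂ (- a) (- b) (- c) (- d) ≡ re₁₂ a b c d
      l₁ = solve 4 (λ a b c d → re₁₂ₑ (⊟ a) (⊟ b) (⊟ c) (⊟ d) ⊜ re₁₂ₑ a b c d) refl
      l₂ : ∀ a b c d → norm₁₂ (- a) (- b) (- c) (- d) ≡ norm₁₂ a b c d
      l₂ = solve 4 (λ a b c d → norm₁₂ₑ (⊟ a) (⊟ b) (⊟ c) (⊟ d) ⊜ norm₁₂ₑ a b c d) refl

    conjugate : ∀ {b₀ b₁ b₂ b₃} → Rep b₀ b₁ b₂ b₃ → Rep b₀ b₁ (- b₂) (- b₃)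
    conjugate {b₀} {b₁} {b₂} {b₃} = transport (l₁ b₀ b₁ b₂ b₃) (l₂ b₀ b₁ b₂ b₃)
      where
      l₁ : ∀ a b c d → re₁₂ a b (- c) (- d) ≡ re₁₂ a b c d
      l₁ = solve 4 (λ a b c d → re₁₂ₑ a b (⊟ c) (⊟ d) ⊜ re₁₂ₑ a b c d) refl
      l₂ : ∀ a b c d → norm₁₂ a b (- c) (- d) ≡ norm₁₂ a b c d
      l₂ = solve 4 (λ a b c d → norm₁₂ₑ a b (⊟ c) (⊟ d) ⊜ norm₁₂ₑ a b c d) refl

    swap-parts : ∀ {b₀ b₁ b₂ b₃} → Rep b₀ b₁ b₂ b₃ → Rep b₂ b₃ b₀ b₁
    swap-parts {b₀} {b₁} {b₂} {b₃} (rep n d) = rep (trans (l₂ b₀ b₁ b₂ b₃) n) (∣-resp (sym (l₁ b₀ b₁ b₂ b₃)) (∣m⇒∣-m d))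
      where
      l₁ : ∀ a b c d → re₁₂ c d a b ≡ - re₁₂ a b c d
      l₁ = solve 4 (λ a b c d → re₁₂ₑ c d a b ⊜ ⊟ re₁₂ₑ a b c d) refl
      l₂ : ∀ a b c d → norm₁₂ c d a b ≡ norm₁₂ a b c d
      l₂ = solve 4 (λ a b c d → norm₁₂ₑ c d a b ⊜ norm₁₂ₑ a b c d) refl

    -- A factor 3 in either sum would divide `tr`, which is twice their product modulo 3. Since 3
    -- also divides `re₁₂`, it would divide `p`.
    trace₁-unit : ∀ {b₀ b₁ b₂ b₃} → Rep b₀ b₁ b₂ b₃ → ¬ (+ 3 ∣ₛ b₀ + b₁) × ¬ (+ 3 ∣ₛ b₂ + b₃)
    trace₁-unit {b₀} {b₁} {b₂} {b₃} r@(rep n d) = at-first r , at-first (swap-parts r)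
      where
      at-first : ∀ {b₀ b₁ b₂ b₃} → Rep b₀ b₁ b₂ b₃ → ¬ (+ 3 ∣ₛ b₀ + b₁)
      at-first {b₀} {b₁} {b₂} {b₃} (rep n d) 3∣R = 3∤p (∣-resp n (∣-weaken (+ 3) (+ 3) (gauss-∣² d
        (∣-resp (sym (tr-trace b₀ b₁ b₂ b₃)) (∣m∣n⇒∣m+n (∣n⇒∣m*n (+ 2) (∣m⇒∣m*n (b₂ + b₃) 3∣R)) (3∣3* (- (b₀ * b₃ + b₁ * b₂))))))))

    -- The four coordinates are 1, 0, 0, 0 modulo 2; it remains to fix two signs modulo 3.
    sign-Y : ∀ n m₁ m₂ m₃ → Rep (+ 1 + + 6 * n + - + 2 * m₁) (+ 2 * m₁) (+ 2 * m₂) (+ 2 * m₃) → Norm₁₂Normal p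
    sign-Y n m₁ m₂ m₃ r = from (fin-residue 3 (m₂ + m₃))
      where
      l₀ : ∀ m₂ m₃ → + 2 * (m₂ + m₃) ≡ + 2 * m₂ + + 2 * m₃
      l₀ = solve-∀
      l₁ : ∀ m₂ m₃ l → m₂ + m₃ ≡ + 1 + l * + 3 → + 2 * m₂ ≡ + 2 + - + 2 * m₃ + + 6 * l
      l₁ m₂ m₃ l e = trans (l₂ m₂ m₃) (trans (cong (λ t → + 2 * (t + - m₃)) e) (l₃ m₃ l))
        where
        l₂ : ∀ m₂ m₃ → + 2 * m₂ ≡ + 2 * ((m₂ + m₃) + - m₃)
        l₂ = solve-∀
        l₃ : ∀ m₃ l → + 2 * (+ 1 + l * + 3 + - m₃) ≡ + 2 + - + 2 * m₃ + + 6 * l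
        l₃ = solve-∀
      l₄ : ∀ m → - (+ 2 * m) ≡ + 2 * - m
      l₄ = solve-∀
      l₅ : ∀ m₂ m₃ → - m₂ + - m₃ ≡ - (m₂ + m₃)
      l₅ = solve-∀
      l₆ : ∀ l → - (+ 2 + l * + 3) ≡ + 1 + (- l + - + 1) * + 3
      l₆ = solve-∀
      finish : ∀ m₂ m₃ l → m₂ + m₃ ≡ + 1 + l * + 3 → Rep (+ 1 + + 6 * n + - + 2 * m₁) (+ 2 * m₁) (+ 2 * m₂) (+ 2 * m₃) → Norm₁₂Normal p
      finish m₂ m₃ l e r = n , m₁ , m₃ , l , trans (cong (λ t → norm₁₂ (+ 1 + + 6 * n + - + 2 * m₁) (+ 2 * m₁) t (+ 2 * m₃)) (sym (l₁ m₂ m₃ l e))) (Rep.norm r)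
      from : Residue 3 (m₂ + m₃) → Norm₁₂Normal p
      from (zero , l , e) = ⊥-elim (proj₂ (trace₁-unit r) (∣-resp (l₀ m₂ m₃) (∣n⇒∣m*n (+ 2) (divides l (trans e (+-identityˡ (l * + 3)))))))
      from (suc zero , l , e) = finish m₂ m₃ l e r
      from (suc (suc zero) , l , e) = finish (- m₂) (- m₃) (- l + - + 1) (trans (l₅ m₂ m₃) (trans (cong -_ e) (l₆ l)))
        (subst₂ (λ c d → Rep (+ 1 + + 6 * n + - + 2 * m₁) (+ 2 * m₁) c d) (l₄ m₂) (l₄ m₃) (conjugate r))

    sign-X : ∀ m₀ m₁ m₂ m₃ → Rep (+ 2 * m₀ + + 1) (+ 2 * m₁) (+ 2 * m₂) (+ 2 * m₃) → Norm₁₂Normal p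
    sign-X m₀ m₁ m₂ m₃ r = from (fin-residue 3 (m₀ + m₁))
      where
      l₀ : ∀ m₀ m₁ n → m₀ + m₁ ≡ + 1 + n * + 3 → + 2 * m₀ + + 1 + + 2 * m₁ ≡ (+ 1 + + 2 * n) * + 3
      l₀ m₀ m₁ n e = trans (l m₀ m₁) (trans (cong (λ t → + 2 * t + + 1) e) (l′ n))
        where
        l : ∀ m₀ m₁ → + 2 * m₀ + + 1 + + 2 * m₁ ≡ + 2 * (m₀ + m₁) + + 1
        l = solve-∀
        l′ : ∀ n → + 2 * (+ 1 + n * + 3) + + 1 ≡ (+ 1 + + 2 * n) * + 3
        l′ = solve-∀
      l₁ : ∀ m₀ m₁ n → m₀ + m₁ ≡ + 0 + n * + 3 → + 2 * m₀ + + 1 ≡ + 1 + + 6 * n + - + 2 * m₁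
      l₁ m₀ m₁ n e = trans (l m₀ m₁) (trans (cong (λ t → + 2 * (t + - m₁) + + 1) e) (l′ m₁ n))
        where
        l : ∀ m₀ m₁ → + 2 * m₀ + + 1 ≡ + 2 * ((m₀ + m₁) + - m₁) + + 1
        l = solve-∀
        l′ : ∀ m₁ n → + 2 * (+ 0 + n * + 3 + - m₁) + + 1 ≡ + 1 + + 6 * n + - + 2 * m₁
        l′ = solve-∀
      l₂ : ∀ m₀ → - (+ 2 * m₀ + + 1) ≡ + 2 * (- m₀ + - + 1) + + 1
      l₂ = solve-∀
      l₃ : ∀ m → - (+ 2 * m) ≡ + 2 * - m
      l₃ = solve-∀
      l₄ : ∀ m₀ m₁ n → m₀ + m₁ ≡ + 2 + n * + 3 → (- m₀ + - + 1) + - m₁ ≡ + 0 + (- n + - + 1) * + 3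
      l₄ m₀ m₁ n e = trans (l m₀ m₁) (trans (cong (λ t → - t + - + 1) e) (l′ n))
        where
        l : ∀ m₀ m₁ → (- m₀ + - + 1) + - m₁ ≡ - (m₀ + m₁) + - + 1
        l = solve-∀
        l′ : ∀ n → - (+ 2 + n * + 3) + - + 1 ≡ + 0 + (- n + - + 1) * + 3
        l′ = solve-∀
      finish : ∀ m₀ m₁ m₂ m₃ n → m₀ + m₁ ≡ + 0 + n * + 3 → Rep (+ 2 * m₀ + + 1) (+ 2 * m₁) (+ 2 * m₂) (+ 2 * m₃) → Norm₁₂Normal p
      finish m₀ m₁ m₂ m₃ n e r = sign-Y n m₁ m₂ m₃ (subst (λ t → Rep t (+ 2 * m₁) (+ 2 * m₂) (+ 2 * m₃)) (l₁ m₀ m₁ n e) r)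
      from : Residue 3 (m₀ + m₁) → Norm₁₂Normal p
      from (zero , n , e) = finish m₀ m₁ m₂ m₃ n e r
      from (suc zero , n , e) = ⊥-elim (proj₁ (trace₁-unit r) (divides (+ 1 + + 2 * n) (l₀ m₀ m₁ n e)))
      from (suc (suc zero) , n , e) = finish (- m₀ + - + 1) (- m₁) (- m₂) (- m₃) (- n + - + 1) (l₄ m₀ m₁ n e)
        (subst₂ (λ a b → Rep a b (+ 2 * - m₂) (+ 2 * - m₃)) (l₂ m₀) (l₃ m₁)
          (subst₂ (λ c d → Rep (- (+ 2 * m₀ + + 1)) (- (+ 2 * m₁)) c d) (l₃ m₂) (l₃ m₃) (negate r)))

    -- Multiplication by ω permutes the nonzero classes of b₀ + b₁ω modulo 2 and keeps the other
    -- component even, so the class of 1 can be reached.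
    rotate : ∀ b₀ b₁ m₂ m₃ → Rep b₀ b₁ (+ 2 * m₂) (+ 2 * m₃) → ¬ (+ 2 ∣ₛ eis b₀ b₁) → Norm₁₂Normal p
    rotate b₀ b₁ m₂ m₃ r ∤X = from (2∣? b₀) (2∣? b₁)
      where
      l₁ : ∀ m → - (+ 2 * m) ≡ + 2 * - m
      l₁ = solve-∀
      l₂ : ∀ m n → + 2 * m + - (+ 2 * n) ≡ + 2 * (m + - n)
      l₂ = solve-∀
      turn : ∀ {b₀ b₁ m₂ m₃} → Rep b₀ b₁ (+ 2 * m₂) (+ 2 * m₃) → Rep (- b₁) (b₀ + - b₁) (+ 2 * - m₃) (+ 2 * (m₂ + - m₃))
      turn {b₀} {b₁} {m₂} {m₃} r = subst₂ (Rep (- b₁) (b₀ + - b₁)) (l₁ m₃) (l₂ m₂ m₃) (omega r)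
      l₃ : ∀ i j → (+ 2 * i + + 1) + - (+ 2 * j + + 1) ≡ + 2 * (i + - j)
      l₃ = solve-∀
      l₄ : ∀ j → - (+ 2 * j + + 1) ≡ + 2 * (- j + - + 1) + + 1
      l₄ = solve-∀
      l₅ : ∀ i j → + 2 * i + - (+ 2 * j + + 1) ≡ + 2 * (i + - j + - + 1) + + 1
      l₅ = solve-∀
      both-odd : ∀ {b₀ b₁} i j m₂ m₃ → b₀ ≡ + 2 * i + + 1 → b₁ ≡ + 2 * j + + 1 → Rep b₀ b₁ (+ 2 * m₂) (+ 2 * m₃) → Norm₁₂Normal p
      both-odd i j m₂ m₃ refl refl r = sign-X (- j + - + 1) (i + - j) (- m₃) (m₂ + - m₃)
        (subst₂ (λ a b → Rep a b (+ 2 * - m₃) (+ 2 * (m₂ + - m₃))) (l₄ j) (l₃ i j) (turn r))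
      from : Parity b₀ → Parity b₁ → Norm₁₂Normal p
      from (inj₁ (i , e₀)) (inj₁ (j , e₁)) = ⊥-elim (∤X (∣m∣n⇒∣m+n (∣m∣n⇒∣m-n (∣m⇒∣m*n b₀ (twice i e₀)) (∣m⇒∣m*n b₁ (twice i e₀))) (∣m⇒∣m*n b₁ (twice j e₁))))
      from (inj₂ (i , e₀)) (inj₁ (j , e₁)) = sign-X i j m₂ m₃ (subst₂ (λ a b → Rep a b (+ 2 * m₂) (+ 2 * m₃)) e₀ e₁ r)
      from (inj₂ (i , e₀)) (inj₂ (j , e₁)) = both-odd i j m₂ m₃ e₀ e₁ r
      from (inj₁ (i , e₀)) (inj₂ (j , e₁)) = both-odd (- j + - + 1) (i + - j + - + 1) (- m₃) (m₂ + - m₃)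
        (trans (cong -_ e₁) (l₄ j)) (trans (cong₂ (λ a b → a + - b) e₀ e₁) (l₅ i j)) (turn r)

    even-Y : ∀ b₀ b₁ b₂ b₃ → Rep b₀ b₁ b₂ b₃ → ¬ (+ 2 ∣ₛ eis b₀ b₁) → + 2 ∣ₛ eis b₂ b₃ → Norm₁₂Normal p
    even-Y b₀ b₁ b₂ b₃ r ∤X d = from (eis-inert prime[2] refl b₂ b₃ d)
      where
      from : + 2 ∣ₛ b₂ × + 2 ∣ₛ b₃ → Norm₁₂Normal p
      from (d₂ , d₃) = rotate b₀ b₁ (proj₁ (halve d₂)) (proj₁ (halve d₃))
        (subst₂ (λ c d → Rep b₀ b₁ c d) (proj₂ (halve d₂)) (proj₂ (halve d₃)) r) ∤X

  -- As v is even and p odd, exactly one of the two ℤ[ω]-components is divisible by 2.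
  norm₁₂-normal-from : ∀ b₀ b₁ b₂ b₃ → norm₁₂ b₀ b₁ b₂ b₃ ≡ + p → + 3 ∣ₛ re₁₂ b₀ b₁ b₂ b₃ → + 2 ∣ₛ tr b₀ b₁ b₂ b₃ → Norm₁₂Normal p
  norm₁₂-normal-from b₀ b₁ b₂ b₃ e 3∣u 2∣v = decide (+ 2 ∣? eis b₀ b₁) (+ 2 ∣? eis b₂ b₃)
    where
    2∤u : ¬ (+ 2 ∣ₛ re₁₂ b₀ b₁ b₂ b₃)
    2∤u 2∣u = 2∤p (∣-resp e (∣-weaken (+ 2) (+ 2) (gauss-∣² 2∣u 2∣v)))
    odd-difference : ∀ x y → ¬ (+ 2 ∣ₛ x) → ¬ (+ 2 ∣ₛ y) → + 2 ∣ₛ x + - y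
    odd-difference x y ∤x ∤y = from (2∣? x) (2∣? y)
      where
      l : ∀ i j → (+ 2 * i + + 1) + - (+ 2 * j + + 1) ≡ + 2 * (i + - j)
      l = solve-∀
      from : Parity x → Parity y → + 2 ∣ₛ x + - y
      from (inj₁ (i , ex)) _ = ⊥-elim (∤x (twice i ex))
      from _ (inj₁ (j , ey)) = ⊥-elim (∤y (twice j ey))
      from (inj₂ (i , ex)) (inj₂ (j , ey)) = twice (i + - j) (trans (cong₂ (λ x y → x + - y) ex ey) (l i j))
    decide : Dec (+ 2 ∣ₛ eis b₀ b₁) → Dec (+ 2 ∣ₛ eis b₂ b₃) → Norm₁₂Normal p
    decide (yes dX) (yes dY) = ⊥-elim (2∤u (∣m∣n⇒∣m-n dX dY))
    decide (no ∤X)  (yes dY) = even-Y b₀ b₁ b₂ b₃ (rep e 3∣u) ∤X dY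
    decide (yes dX) (no ∤Y)  = even-Y b₂ b₃ b₀ b₁ (swap-parts (rep e 3∣u)) ∤Y dX
    decide (no ∤X)  (no ∤Y)  = ⊥-elim (2∤u (odd-difference (eis b₀ b₁) (eis b₂ b₃) ∤X ∤Y))

-- Multiplication by the unit 1 + iω, whose relative norm to ℤ[i] is -i.
unit-turn-re : ∀ a b c d → re₁₂ (a + d) (b + - c + d) (- b + c) (a + - b + d) ≡ tr a b c d
unit-turn-re = solve 4 (λ a b c d → re₁₂ₑ (a ⊞ d) (b ⊞ ⊟ c ⊞ d) (⊟ b ⊞ c) (a ⊞ ⊟ b ⊞ d) ⊜ trₑ a b c d) refl

unit-turn-tr : ∀ a b c d → tr (a + d) (b + - c + d) (- b + c) (a + - b + d) ≡ - re₁₂ a b c d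
unit-turn-tr = solve 4 (λ a b c d → trₑ (a ⊞ d) (b ⊞ ⊟ c ⊞ d) (⊟ b ⊞ c) (a ⊞ ⊟ b ⊞ d) ⊜ ⊟ re₁₂ₑ a b c d) refl

-- By the definition of P₁ the relative norm u + iv of any element of norm p has one coordinate
-- divisible by 2 and the other by 3. The normal form wants 3 in `u` and 2 in `v`; the unit 1 + iω
-- exchanges the coordinates if necessary.
norm₁₂-normal : ∀ {p} → InP1 p → Norm₁₂Normal p
norm₁₂-normal {p} (pp , r , κ , τ , ep) = from (norm₁₂-represents pp r)
  where
  s t : ℤ
  s = + 6 * κ + + 2
  t = + 6 * τ + + 3
  2∣s : + 2 ∣ₛ s
  2∣s = ∣m∣n⇒∣m+n (∣m⇒∣m*n κ (divides (+ 3) refl)) (divides (+ 1) refl)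
  3∣t : + 3 ∣ₛ t
  3∣t = ∣m∣n⇒∣m+n (∣m⇒∣m*n τ (divides (+ 2) refl)) (divides (+ 1) refl)
  ∤p : ∀ {d} .{{_ : ℕ.NonZero d}} → d ℕ.∣ 12 → 1 % d ≡ 1 → ¬ (+ d ∣ₛ + p)
  ∤p {d} d∣12 1%d d∣p = ℕ.1+n≢0 (trans (sym (trans (sym (ℕ.m∣n⇒o%n%m≡o%m d 12 p d∣12)) (trans (cong (_% d) r) 1%d))) (ℕ.n∣m⇒m%n≡0 p d (∣⇒∣ᵤ d∣p)))
  module _ (a b c d : ℤ) (e : norm₁₂ a b c d ≡ + p) where
    u v : ℤ
    u = re₁₂ a b c d
    v = tr a b c d
    turn-norm : norm₁₂ (a + d) (b + - c + d) (- b + c) (a + - b + d) ≡ + p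
    turn-norm = trans (cong₂ gauss (unit-turn-re a b c d) (unit-turn-tr a b c d)) (trans (l u v) e)
      where
      l : ∀ u v → gauss v (- u) ≡ gauss u v
      l = solve 2 (λ u v → gaussₑ v (⊟ u) ⊜ gaussₑ u v) refl
    l-product : ∀ s t x y → gauss (s * x + - (t * y)) (s * y + t * x) ≡ gauss s t * gauss x y
    l-product = solve 4 (λ s t x y → gaussₑ (s ⊠ x ⊞ ⊟ (t ⊠ y)) (s ⊠ y ⊞ t ⊠ x) ⊜ gaussₑ s t ⊠ gaussₑ x y) refl
    l-sign : ∀ s t → gauss s (- t) ≡ gauss s t
    l-sign = solve 2 (λ s t → gaussₑ s (⊟ t) ⊜ gaussₑ s t) refl
    normal : (+ 3 ∣ₛ u × + 2 ∣ₛ v) ⊎ (+ 2 ∣ₛ u × + 3 ∣ₛ v) → Norm₁₂Normal p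
    normal (inj₁ (3∣u , 2∣v)) = norm₁₂-normal-from (∤p (ℕ.divides 6 refl) refl) (∤p (ℕ.divides 4 refl) refl) a b c d e 3∣u 2∣v
    normal (inj₂ (2∣u , 3∣v)) = norm₁₂-normal-from (∤p (ℕ.divides 6 refl) refl) (∤p (ℕ.divides 4 refl) refl)
      (a + d) (b + - c + d) (- b + c) (a + - b + d) turn-norm (∣-resp (sym (unit-turn-re a b c d)) 3∣v) (∣-resp (sym (unit-turn-tr a b c d)) (∣m⇒∣-m 2∣u))
    -- u + iv is a unit times s ± it.
    classify : GaussQuotient pp s t u v → (+ 3 ∣ₛ u × + 2 ∣ₛ v) ⊎ (+ 2 ∣ₛ u × + 3 ∣ₛ v)
    -- The cofactor x + iy has norm 1. For n = 1 no good prime is available, so `gauss-good` makes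
    -- one of its coordinates divisible by 6.
    classify (x , y , t′ , t′-is , eu , ev) = [ ⊥-elim ∘ ¬Good-1 , [ by-x , by-y ]′ ]′
        (gauss-good 1 x y unit (odd-∤2 (+ 0) ∘ ∣ᵤ⇒∣ {i = + 1}) (λ d → ℕ.1+n≢0 (ℕ.suc-injective (ℕ.∣1⇒≡1 d))))
      where
      norm-t′ : gauss s t′ ≡ + p
      norm-t′ = [ (λ { refl → sym ep }) , (λ { refl → trans (l-sign s t) (sym ep) }) ]′ t′-is
      3∣t′ : + 3 ∣ₛ t′
      3∣t′ = [ (λ { refl → 3∣t }) , (λ { refl → ∣m⇒∣-m 3∣t }) ]′ t′-is
      unit : gauss x y ≡ + 1
      unit = *-cancelˡ-≡ (+ p) (gauss x y) (+ 1) {{ℤ.≢-nonZero λ p≡0 → ℕ.<-irrefl (sym (+-injective p≡0)) (ℕ.<-trans (s≤s z≤n) (prime⇒1< pp))}}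
        (trans (cong (_* gauss x y) (sym norm-t′)) (trans (sym (l-product s t′ x y)) (trans (sym (cong₂ gauss eu ev)) (trans e (sym (*-identityʳ (+ p)))))))
      by-x : + 6 ∣ₛ x → _
      by-x d = inj₁ (∣-resp (sym eu) (∣m∣n⇒∣m-n (∣n⇒∣m*n s (6∣⇒3∣ d)) (∣m⇒∣m*n y 3∣t′)) , ∣-resp (sym ev) (∣m∣n⇒∣m+n (∣m⇒∣m*n y 2∣s) (∣n⇒∣m*n t′ (6∣⇒2∣ d))))
      by-y : + 6 ∣ₛ y → _
      by-y d = inj₂ (∣-resp (sym eu) (∣m∣n⇒∣m-n (∣m⇒∣m*n x 2∣s) (∣n⇒∣m*n t′ (6∣⇒2∣ d))) , ∣-resp (sym ev) (∣m∣n⇒∣m+n (∣n⇒∣m*n s (6∣⇒3∣ d)) (∣m⇒∣m*n x 3∣t′)))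
  from : (∃ λ a → ∃ λ b → ∃ λ c → ∃ λ d → norm₁₂ a b c d ≡ + p) → Norm₁₂Normal p
  from (a , b , c , d , e) = normal a b c d e (classify a b c d e (gauss-divide pp s t (sym ep) (re₁₂ a b c d) (tr a b c d) (divides (+ 1) (trans e (sym (*-identityˡ (+ p)))))))

-- Assembly of the classification

GoodPrime-residue : ∀ {p} → GoodPrime p → p % 12 ≡ 1 ⊎ p % 12 ≡ 5 ⊎ p % 12 ≡ 7
GoodPrime-residue (inj₁ (_ , r))            = inj₂ (inj₁ r)
GoodPrime-residue (inj₂ (inj₁ (_ , r)))     = inj₂ (inj₂ r)
GoodPrime-residue (inj₂ (inj₂ (_ , r , _))) = inj₁ r

-- This ensures that a good prime found in `d` lies in the cofactor of 9 or 32. A divisor of either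
-- is at most 32, which leaves a finite table.
GoodPrime-∤ : ∀ {p} → GoodPrime p → ¬ (p ℕ.∣ 9) × ¬ (p ℕ.∣ 32)
GoodPrime-∤ {p} good = (λ d → not-one (small (ℕ.≤-trans (ℕ.∣⇒≤ d) (ℕ.m≤m+n 9 23)) (inj₁ d))) , (λ d → not-one (small (ℕ.∣⇒≤ d) (inj₂ d)))
  where
  table : ∀ (q : Fin 33) → toℕ q ℕ.∣ 9 ⊎ toℕ q ℕ.∣ 32 → toℕ q % 12 ≡ 1 ⊎ toℕ q % 12 ≡ 5 ⊎ toℕ q % 12 ≡ 7 → toℕ q ≡ 1
  table = toWitness {a? = F.all? λ q → (toℕ q ℕ.∣? 9 ⊎-dec toℕ q ℕ.∣? 32) →-dec
    ((toℕ q % 12 ℕ.≟ 1 ⊎-dec toℕ q % 12 ℕ.≟ 5 ⊎-dec toℕ q % 12 ℕ.≟ 7) →-dec toℕ q ℕ.≟ 1)} _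
  small : p ℕ.≤ 32 → p ℕ.∣ 9 ⊎ p ℕ.∣ 32 → p ≡ 1
  small le d = trans (sym q≡p) (table q (subst (λ p → p ℕ.∣ 9 ⊎ p ℕ.∣ 32) (sym q≡p) d) (subst (λ p → p % 12 ≡ 1 ⊎ p % 12 ≡ 5 ⊎ p % 12 ≡ 7) (sym q≡p) (GoodPrime-residue good)))
    where
    q : Fin 33
    q = fromℕ< (s≤s le)
    q≡p : toℕ q ≡ p
    q≡p = F.toℕ-fromℕ< (s≤s le)
  not-one : p ≢ 1
  not-one e = ℕ.<-irrefl (sym e) (prime⇒1< (GoodPrime⇒Prime good))

coprime-6 : ∀ m → ¬ (+ 2 ∣ₛ m) → ¬ (+ 3 ∣ₛ m) → CoprimeTo 6 m
coprime-6 m ∤2 ∤3 {d} (d∣m , d∣6) = [ (λ e → trans (sym toℕ-d) e) , [ (λ 2∣d → ⊥-elim (∤2 (∣ᵤ⇒∣ (ℕ.∣-trans (subst (2 ℕ.∣_) toℕ-d 2∣d) d∣m))))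
    , (λ 3∣d → ⊥-elim (∤3 (∣ᵤ⇒∣ (ℕ.∣-trans (subst (3 ℕ.∣_) toℕ-d 3∣d) d∣m)))) ]′ ]′
    (table (fromℕ< (s≤s (ℕ.∣⇒≤ d∣6))) (subst (ℕ._∣ 6) (sym toℕ-d) d∣6))
  where
  toℕ-d : toℕ (fromℕ< (s≤s (ℕ.∣⇒≤ d∣6))) ≡ d
  toℕ-d = F.toℕ-fromℕ< (s≤s (ℕ.∣⇒≤ d∣6))
  table : ∀ (d : Fin 7) → toℕ d ℕ.∣ 6 → toℕ d ≡ 1 ⊎ 2 ℕ.∣ toℕ d ⊎ 3 ℕ.∣ toℕ d
  table = toWitness {a? = F.all? λ d → (toℕ d ℕ.∣? 6) →-dec (toℕ d ℕ.≟ 1 ⊎-dec 2 ℕ.∣? toℕ d ⊎-dec 3 ℕ.∣? toℕ d)} _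

coprime-prime : ∀ {p} → Prime p → ∀ m → ¬ (+ p ∣ₛ m) → CoprimeTo p m
coprime-prime {p} pp m ∤p {d} (d∣m , d∣p) = [ (λ e → e) , (λ { refl → ⊥-elim (∤p (∣ᵤ⇒∣ d∣m)) }) ]′ (prime⇒irreducible pp d∣p)

coprime⇒∤ : ∀ {t m} d → 1 ℕ.< d → d ℕ.∣ t → CoprimeTo t m → ¬ (+ d ∣ₛ m)
coprime⇒∤ d 1<d d∣t coprime d∣m = ℕ.<-irrefl (sym (coprime (∣⇒∣ᵤ d∣m , d∣t))) 1<d

private
  InS-resp : ∀ {d e} → d ≡ e → InS 12 d → InS 12 e
  InS-resp = subst (InS 12)

  InS-unneg : ∀ {d e} → d ≡ - e → InS 12 d → InS 12 e
  InS-unneg {d} {e} eq ins = InS-resp (trans (cong -_ eq) (neg-involutive e)) (InS-neg ins)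

  good-9 : ∀ {p} → GoodPrime p → ∀ n → InS 12 (+ 9 * (+ 1 + + 4 * n) * + p)
  good-9 {p} (inj₁ (pp , r)) n = from (gauss-represents-1-mod-4 pp (trans (sym (ℕ.m∣n⇒o%n%m≡o%m 4 12 p (ℕ.divides 3 refl))) (cong (_% 4) r)))
    where
    from : (∃₂ λ s t → gauss s t ≡ + p) → InS 12 (+ 9 * (+ 1 + + 4 * n) * + p)
    from (s , t , e) = let k , l , e′ = gauss-normal s t e r in InS-unneg refl (family-9-gauss n k l e′)
  good-9 {p} (inj₂ (inj₁ (pp , r))) n = from (eis-represents-1-mod-3 pp (trans (sym (ℕ.m∣n⇒o%n%m≡o%m 3 12 p (ℕ.divides 4 refl))) (cong (_% 3) r)))
    where
    l : ∀ n p → - (+ 9 * (+ 1 + - + 4 * - n) * p) ≡ - (+ 9 * (+ 1 + + 4 * n) * p)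
    l = solve-∀
    from : (∃₂ λ s t → eis s t ≡ + p) → InS 12 (+ 9 * (+ 1 + + 4 * n) * + p)
    from (s , t , e) = let y , m , e′ = eis-normal s t e r in InS-unneg (l n (+ p)) (family-9-eis (- n) y m e′)
  good-9 {p} (inj₂ (inj₂ p∈P₁)) n = let i , j , k , l , e = norm₁₂-normal p∈P₁ in InS-unneg refl (family-9-norm₁₂ n i j k l e)

  good-32 : ∀ {p} → GoodPrime p → ∀ n → InS 12 (+ 32 * (+ 1 + + 6 * n) * + p)
  good-32 {p} (inj₁ (pp , r)) n = from (gauss-represents-1-mod-4 pp (trans (sym (ℕ.m∣n⇒o%n%m≡o%m 4 12 p (ℕ.divides 3 refl))) (cong (_% 4) r)))
    where
    from : (∃₂ λ s t → gauss s t ≡ + p) → InS 12 (+ 32 * (+ 1 + + 6 * n) * + p)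
    from (s , t , e) = let k , l , e′ = gauss-normal s t e r in family-32-gauss n k l e′
  good-32 {p} (inj₂ (inj₁ (pp , r))) n = from (eis-represents-1-mod-3 pp (trans (sym (ℕ.m∣n⇒o%n%m≡o%m 3 12 p (ℕ.divides 4 refl))) (cong (_% 3) r)))
    where
    from : (∃₂ λ s t → eis s t ≡ + p) → InS 12 (+ 32 * (+ 1 + + 6 * n) * + p)
    from (s , t , e) = let y , m , e′ = eis-normal s t e r in InS-unneg refl (family-32-eis n y m e′)
  good-32 (inj₂ (inj₂ p∈P₁)) n = let i , j , k , l , e = norm₁₂-normal p∈P₁ in family-32-norm₁₂ n i j k l e

  by-sign : ∀ k l {m} c q → PlusMinus k l m → (∀ n → InS 12 (c * (k + l * n) * q)) → InS 12 (c * m * q)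
  by-sign k l c q (n , inj₁ e) ins = InS-resp (cong (λ m → c * m * q) (sym e)) (ins n)
  by-sign k l c q (n , inj₂ e) ins = InS-unneg (trans (lemma c (k + l * n) q) (cong (λ m → - (c * m * q)) (sym e))) (ins n)
    where
    lemma : ∀ c x q → c * x * q ≡ - (c * - x * q)
    lemma = solve-∀

  by-sign₁ : ∀ k l {m} c → PlusMinus k l m → (∀ n → InS 12 (c * (k + l * n))) → InS 12 (c * m)
  by-sign₁ k l {m} c pm ins = InS-resp (*-identityʳ (c * m)) (by-sign k l c (+ 1) pm (λ n → InS-resp (sym (*-identityʳ (c * (k + l * n)))) (ins n)))

  in-27 : ∀ m → ¬ (+ 2 ∣ₛ m) → InS 12 (+ 27 * m)
  in-27 m ∤2 = by-sign₁ (+ 1) (+ 4) (+ 27) (odd-plus-minus m ∤2) (λ n → InS-unneg refl (family-27 n))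

  in-unit : ∀ d → ¬ (+ 2 ∣ₛ d) → ¬ (+ 3 ∣ₛ d) → InS 12 d
  in-unit d ∤2 ∤3 = InS-resp (*-identityˡ d)
    ([ (λ pm → by-sign₁ (+ 1) (+ 12) (+ 1) pm (λ n → InS-resp (sym (*-identityˡ (+ 1 + + 12 * n))) (unit-1 n)))
    , (λ pm → by-sign₁ (+ 5) (+ 12) (+ 1) pm (λ n → InS-resp (sym (*-identityˡ (+ 5 + + 12 * n))) (unit-5 n))) ]′ (coprime-6-mod-12 d ∤2 ∤3))

record Constraints (d : ℤ) : Set where
  field
    from-3 : + 3 ∣ₛ d → + 9 ∣ₛ d
    from-2 : + 2 ∣ₛ d → + 16 ∣ₛ d
    odd-3  : ¬ (+ 2 ∣ₛ d) → + 3 ∣ₛ d → ¬ (+ 27 ∣ₛ d) → Good ℤ.∣ d ∣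
    even-∤3 : + 32 ∣ₛ d → ¬ (+ 64 ∣ₛ d) → ¬ (+ 3 ∣ₛ d) → Good ℤ.∣ d ∣

private
  constraints-of : ∀ {d} (v : Fin 12 → ℤ) → Congruences (v (# 0)) (v (# 1)) (v (# 2)) (v (# 3)) (v (# 4)) (v (# 5)) (v (# 6)) (v (# 7)) (v (# 8)) (v (# 9)) (v (# 10)) (v (# 11)) →
    Δ v ≡ d → Constraints d
  constraints-of v C e = subst Constraints e (record { from-3 = 3∣⇒9∣ ; from-2 = 2∣⇒16∣ ; odd-3 = odd-good ; even-∤3 = even-good })
    where
    open Necessity C

  constraints : ∀ {d} → InS 12 d → Constraints d
  constraints {d} ins = from (InS⇒spectrum ins)
    where
    from : (∃ λ w → Δ (spectrum ⟪ w ⟫) ≡ d) → Constraints d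
    from (w , e) = constraints-of (spectrum ⟪ w ⟫) (congruences w) e

  split-good : ∀ {d} c → + c ∣ₛ d → ((p , good , _) : Good ℤ.∣ d ∣) → ¬ (p ℕ.∣ c) → ∃ λ m → d ≡ + c * m * + p
  split-good {d} c (divides q e) (p , good , p∣d) ∤c = from (euclid (GoodPrime⇒Prime good) {q} {+ c} (∣-resp e (∣ᵤ⇒∣ p∣d)))
    where
    l : ∀ m p c → (m * p) * c ≡ c * m * p
    l = solve-∀
    from : + p ∣ₛ q ⊎ + p ∣ₛ + c → ∃ λ m → d ≡ + c * m * + p
    from (inj₁ (divides m eq)) = m , trans e (trans (cong (_* + c) eq) (l m (+ p) (+ c)))
    from (inj₂ d) = ⊥-elim (∤c (∣⇒∣ᵤ d))

  cofactor-∤ : ∀ {d} c m k p → d ≡ c * m * p → ¬ (c * k ∣ₛ d) → ¬ (k ∣ₛ m)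
  cofactor-∤ c m k p e ∤ k∣m = ∤ (∣-resp (sym e) (∣m⇒∣m*n p (*-monoʳ-∣ c k∣m)))

  factor-∤ : ∀ {d} c m k → d ≡ c * m → ¬ (c * k ∣ₛ d) → ¬ (k ∣ₛ m)
  factor-∤ c m k e ∤ k∣m = ∤ (∣-resp (sym e) (*-monoʳ-∣ c k∣m))

  OddShape EvenShape : ℤ → Set
  OddShape d = (∃ λ m → ∃ λ p → CoprimeTo 6 m × GoodPrime p × d ≡ + 9 * m * + p) ⊎ (∃ λ m → CoprimeTo 2 m × d ≡ + 27 * m)
  EvenShape d = (∃ λ m → CoprimeTo 6 m × d ≡ + 16 * m)
    ⊎ (∃ λ m → ∃ λ p → CoprimeTo 6 m × GoodPrime p × d ≡ + 32 * m * + p)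
    ⊎ (∃ λ m → CoprimeTo 3 m × d ≡ + 64 * m)

  odd⇒ : ∀ d → Odd d → + 3 ∣ d → InS 12 d → OddShape d
  odd⇒ d odd 3∣d ins = decide (+ 27 ∣? d)
    where
    ∤2 : ¬ (+ 2 ∣ₛ d)
    ∤2 = odd ∘ ∣⇒∣ᵤ
    decide : Dec (+ 27 ∣ₛ d) → OddShape d
    decide (yes (divides m e)) = inj₂ (m , coprime-prime prime[2] m (λ 2∣m → ∤2 (∣-resp (sym e) (∣m⇒∣m*n (+ 27) 2∣m))) , trans e (*-comm m (+ 27)))
    decide (no ∤27) = from-good (Constraints.odd-3 (constraints ins) ∤2 (∣ᵤ⇒∣ 3∣d) ∤27)
      where
      from-good : Good ℤ.∣ d ∣ → OddShape d
      from-good g@(p , good , _) = from-split (split-good 9 (Constraints.from-3 (constraints ins) (∣ᵤ⇒∣ 3∣d)) g (proj₁ (GoodPrime-∤ {p} good)))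
        where
        from-split : (∃ λ m → d ≡ + 9 * m * + p) → OddShape d
        from-split (m , e) = inj₁ (m , p , coprime-6 m (cofactor-∤ (+ 9) m (+ 2) (+ p) e (λ d → ∤2 (∣-weaken (+ 2) (+ 9) d))) (cofactor-∤ (+ 9) m (+ 3) (+ p) e ∤27) , good , e)

  odd⇐ : ∀ d → OddShape d → InS 12 d
  odd⇐ d (inj₁ (m , p , coprime , good , e)) = InS-resp (sym e) (by-sign (+ 1) (+ 4) (+ 9) (+ p)
    (odd-plus-minus m (coprime⇒∤ {m = m} 2 (s≤s (s≤s z≤n)) (ℕ.divides 3 refl) coprime)) (good-9 good))
  odd⇐ d (inj₂ (m , coprime , e)) = InS-resp (sym e) (in-27 m (coprime⇒∤ {m = m} 2 (s≤s (s≤s z≤n)) (ℕ.divides 1 refl) coprime))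

  even-3⇒ : ∀ d → Even d → + 3 ∣ d → InS 12 d → ∃ λ m → d ≡ + 144 * m
  even-3⇒ d even 3∣d ins = from (Constraints.from-2 (constraints ins) (∣ᵤ⇒∣ even)) (Constraints.from-3 (constraints ins) (∣ᵤ⇒∣ 3∣d))
    where
    -- The Bézout relation 4 · 16 - 7 · 9 = 1 combines divisibility by 16 and by 9.
    l : ∀ d → d ≡ + 64 * d + - (+ 63 * d)
    l = solve-∀
    l′ : ∀ q q′ → + 64 * (q′ * + 9) + - (+ 63 * (q * + 16)) ≡ + 144 * (+ 4 * q′ + - (+ 7 * q))
    l′ = solve-∀
    from : + 16 ∣ₛ d → + 9 ∣ₛ d → ∃ λ m → d ≡ + 144 * m
    from (divides q e) (divides q′ e′) = + 4 * q′ + - (+ 7 * q) ,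
      trans (l d) (trans (cong₂ (λ x y → + 64 * x + - (+ 63 * y)) e′ e) (l′ q q′))

  even⇒ : ∀ d → Even d → ¬ (+ 3 ∣ d) → InS 12 d → EvenShape d
  even⇒ d even ∤3 ins = decide (+ 32 ∣? d) (+ 64 ∣? d)
    where
    ∤3ₛ : ¬ (+ 3 ∣ₛ d)
    ∤3ₛ = ∤3 ∘ ∣⇒∣ᵤ
    decide : Dec (+ 32 ∣ₛ d) → Dec (+ 64 ∣ₛ d) → EvenShape d
    decide _ (yes (divides m e)) = inj₂ (inj₂ (m , coprime-prime prime[3] m (λ 3∣m → ∤3ₛ (∣-resp (sym e) (∣m⇒∣m*n (+ 64) 3∣m))) , trans e (*-comm m (+ 64))))
    decide (no ∤32) (no _) = from (Constraints.from-2 (constraints ins) (∣ᵤ⇒∣ even))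
      where
      from : + 16 ∣ₛ d → EvenShape d
      from (divides m e) = inj₁ (m , coprime-6 m (factor-∤ (+ 16) m (+ 2) e′ ∤32) (λ 3∣m → ∤3ₛ (∣-resp (sym e) (∣m⇒∣m*n (+ 16) 3∣m))) , e′)
        where
        e′ : d ≡ + 16 * m
        e′ = trans e (*-comm m (+ 16))
    decide (yes 32∣d) (no ∤64) = from-good (Constraints.even-∤3 (constraints ins) 32∣d ∤64 ∤3ₛ)
      where
      from-good : Good ℤ.∣ d ∣ → EvenShape d
      from-good g@(p , good , _) = from-split (split-good 32 32∣d g (proj₂ (GoodPrime-∤ {p} good)))
        where
        from-split : (∃ λ m → d ≡ + 32 * m * + p) → EvenShape d
        from-split (m , e) = inj₂ (inj₁ (m , p , coprime-6 m (cofactor-∤ (+ 32) m (+ 2) (+ p) e ∤64)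
          (cofactor-∤ (+ 32) m (+ 3) (+ p) e (λ d → ∤3ₛ (∣-weaken (+ 3) (+ 32) d))) , good , e))

  even⇐ : ∀ d → EvenShape d → InS 12 d
  even⇐ d (inj₁ (m , coprime , e)) = InS-resp (sym e) (by-sign₁ (+ 1) (+ 6) (+ 16) (coprime-6-plus-minus m
    (coprime⇒∤ {m = m} 2 (s≤s (s≤s z≤n)) (ℕ.divides 3 refl) coprime) (coprime⇒∤ {m = m} 3 (s≤s (s≤s z≤n)) (ℕ.divides 2 refl) coprime)) family-16)
  even⇐ d (inj₂ (inj₁ (m , p , coprime , good , e))) = InS-resp (sym e) (by-sign (+ 1) (+ 6) (+ 32) (+ p) (coprime-6-plus-minus m
    (coprime⇒∤ {m = m} 2 (s≤s (s≤s z≤n)) (ℕ.divides 3 refl) coprime) (coprime⇒∤ {m = m} 3 (s≤s (s≤s z≤n)) (ℕ.divides 2 refl) coprime)) (good-32 good))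
  even⇐ d (inj₂ (inj₂ (m , coprime , e))) = InS-resp (sym e) (by-sign₁ (+ 1) (+ 3) (+ 64) (∤3-plus-minus m
    (coprime⇒∤ {m = m} 3 (s≤s (s≤s z≤n)) (ℕ.divides 1 refl) coprime)) family-64)

theorem5p3 : (∀ (d : ℤ) → Odd d → ¬ (+ 3 ∣ d) → InS 12 d)
    × (∀ (d : ℤ) → Odd d → + 3 ∣ d →
    (InS 12 d ⇔
    ((∃ λ m → ∃ λ p → CoprimeTo 6 m × GoodPrime p × d ≡ + 9 * m * + p)
    ⊎ (∃ λ m → CoprimeTo 2 m × d ≡ + 27 * m))))
    × (∀ (d : ℤ) → Even d → + 3 ∣ d →
    (InS 12 d ⇔ (∃ λ m → d ≡ + 144 * m)))
    × (∀ (d : ℤ) → Even d → ¬ (+ 3 ∣ d) →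
    (InS 12 d ⇔
    ((∃ λ m → CoprimeTo 6 m × d ≡ + 16 * m)
    ⊎ (∃ λ m → ∃ λ p → CoprimeTo 6 m × GoodPrime p × d ≡ + 32 * m * + p)
    ⊎ (∃ λ m → CoprimeTo 3 m × d ≡ + 64 * m))))
theorem5p3 =
    (λ d odd ∤3 → in-unit d (odd ∘ ∣⇒∣ᵤ) (∤3 ∘ ∣⇒∣ᵤ))
  , (λ d odd 3∣d → mk⇔ (odd⇒ d odd 3∣d) (odd⇐ d))
  , (λ d even 3∣d → mk⇔ (even-3⇒ d even 3∣d) (λ { (m , e) → InS-resp (sym e) (family-144 m) }))
  , (λ d even ∤3 → mk⇔ (even⇒ d even ∤3) (even⇐ d))
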